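{- The zeros of all the polynomials $F_n(z)$, $n\ge 1$, are densely distributed on the left half of the circle $|z-1|=2$. That is, writing $C=\{z\in\mathbb C: |z-1|=2,\ \operatorname{Re} z\le 1\}$, every complex zero of every $F_n$ lies in $C$, and the set $\bigcup_{n\ge 1}\{z\in\mathbb C: F_n(z)=0\}$ is dense in $C$.
   Context: For $n\ge 1$, $F_n(z)=\sum_{m}A(n,m)z^m$, where $A(n,m)$ is the number of integer partitions with exactly $m$ even parts (counted with multiplicity) and largest hook length $n$ (the largest hook length of a partition $\lambda$ is $\lambda_1+\ell(\lambda)-1$, with $\lambda_1$ the largest part and $\ell(\lambda)$ the number of parts). Equivalently (a known fact recalled in the paper), $F_1(z)=1$, $F_2(z)=1+z$, and $F_n(z)=(1+z)F_{n-1}(z)+(1-z)F_{n-2}(z)$ for $n\ge 3$. -}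

module Defs where

open import Data.Nat.Base as ℕ using (ℕ; zero; suc; z≤n; s≤s)
import Data.Nat.Properties as ℕ
open import Data.Nat.Divisibility using (_∣_; _∣?_)
open import Data.Integer.Base as ℤ using (ℤ; +_; -[1+_])
import Data.Integer.Properties as ℤ
import Data.Rational.Unnormalised.Base as ℚᵘ
import Data.Rational.Unnormalised.Properties as ℚᵘ
open import Data.Rational.Base
open import Data.Rational.Properties
open import Data.Rational.Solver using () renaming (module +-*-Solver to ℚ-Solver)
open import Data.Nat.Solver using () renaming (module +-*-Solver to ℕ-Solver)
open import Data.List.Base
  using (List; []; _∷_; length; filter; map; upTo; foldr; cartesianProductWith)
open import Data.List.Relation.Unary.All as All using (All; []; _∷_)
open import Data.List.Relation.Unary.Any using (here; there)
open import Data.List.Relation.Unary.AllPairs using ([]; _∷_)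
open import Data.List.Relation.Unary.Linked as Linked using (Linked)
open import Data.List.Relation.Unary.Unique.Propositional using (Unique)
import Data.List.Relation.Unary.Unique.Propositional.Properties as Unique
open import Data.List.Membership.Propositional using (_∈_)
open import Data.List.Membership.Propositional.Properties
  using (∈-map⁺; ∈-upTo⁺; ∈-cartesianProductWith⁺; ∈-cartesianProductWith⁻; ∈-filter⁺; ∈-filter⁻)
open import Data.List.Properties using (∷-injective; length-filter; filter-none)
open import Data.Product.Base using (∃-syntax; _×_; _,_; proj₂)
open import Data.Sum.Base using (inj₁; inj₂)
open import Data.Empty using (⊥)
open import Function.Base using (_$_)
open import Function.Bundles using (_⇔_; mk⇔; Equivalence)
open import Relation.Binary.PropositionalEquality
open import Relation.Nullary.Decidable using (yes; no; _×-dec_)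
open import Relation.Nullary.Negation using (contradiction)
open import Relation.Unary using (Pred; Decidable)
open import Level using (0ℓ)

Eventually : (ℕ → Set) → Set
Eventually P = ∃[ N ] (∀ n → N ℕ.≤ n → P n)

IsCauchy : (ℕ → ℚ) → Set
IsCauchy s = ∀ ε → 0ℚ < ε →
  ∃[ N ] (∀ m n → N ℕ.≤ m → N ℕ.≤ n → ∣ s m - s n ∣ < ε)

half-pos : ∀ {ε} → 0ℚ < ε → 0ℚ < ½ * ε
half-pos {ε} p = subst (_< ½ * ε) (*-zeroʳ ½) (*-monoʳ-<-pos ½ p)

halves : ∀ ε → ½ * ε + ½ * ε ≡ ε
halves ε = trans (sym (*-distribʳ-+ ε ½ ½)) (*-identityˡ ε)

*-pos : ∀ {p q} → 0ℚ < p → 0ℚ < q → 0ℚ < p * q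
*-pos {p} {q} hp hq =
  subst (_< p * q) (*-zeroʳ p) (*-monoʳ-<-pos p {{positive hp}} hq)

∣∣-upper : ∀ p → p ≤ ∣ p ∣
∣∣-upper p with ≤-total 0ℚ p
... | inj₁ h = ≤-reflexive (sym (0≤p⇒∣p∣≡p h))
... | inj₂ h = ≤-trans h (0≤∣p∣ p)

∣-∣-sym : ∀ p q → ∣ p - q ∣ ≡ ∣ q - p ∣
∣-∣-sym p q = trans (cong ∣_∣ e) (∣-p∣≡∣p∣ (q - p))
  where
  e : p - q ≡ - (q - p)
  e = solve 2 (λ a b → a :- b := :- (b :- a)) refl p q
    where open ℚ-Solver

∣const∣ : ∀ q {ε} → 0ℚ < ε → ∣ q - q ∣ < ε
∣const∣ q {ε} h = subst (λ x → ∣ x ∣ < ε) (sym (+-inverseʳ q)) h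

const-isCauchy : ∀ q → IsCauchy (λ _ → q)
const-isCauchy q ε h = 0 , λ _ _ _ _ → ∣const∣ q h

+-isCauchy : ∀ s t → IsCauchy s → IsCauchy t → IsCauchy (λ n → s n + t n)
+-isCauchy s t cs ct ε h =
  let M , f = cs (½ * ε) (half-pos h)
      N , g = ct (½ * ε) (half-pos h)
  in M ℕ.⊔ N , λ m n hm hn → begin-strict
    ∣ (s m + t m) - (s n + t n) ∣
      ≡⟨ cong ∣_∣ (eq (s m) (t m) (s n) (t n)) ⟩
    ∣ (s m - s n) + (t m - t n) ∣
      ≤⟨ ∣p+q∣≤∣p∣+∣q∣ (s m - s n) (t m - t n) ⟩
    ∣ s m - s n ∣ + ∣ t m - t n ∣
      <⟨ +-mono-< (f m n (ℕ.m⊔n≤o⇒m≤o M N hm) (ℕ.m⊔n≤o⇒m≤o M N hn))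
                  (g m n (ℕ.m⊔n≤o⇒n≤o M N hm) (ℕ.m⊔n≤o⇒n≤o M N hn)) ⟩
    ½ * ε + ½ * ε
      ≡⟨ halves ε ⟩
    ε ∎
  where
  open ≤-Reasoning
  eq : ∀ a b c d → (a + b) - (c + d) ≡ (a - c) + (b - d)
  eq = solve 4 (λ a b c d → (a :+ b) :- (c :+ d) := (a :- c) :+ (b :- d)) refl
    where open ℚ-Solver

neg-isCauchy : ∀ s → IsCauchy s → IsCauchy (λ n → - s n)
neg-isCauchy s cs ε h =
  let N , f = cs ε h
  in N , λ m n hm hn →
    subst (_< ε) (trans (∣-∣-sym (s m) (s n)) (cong ∣_∣ (eq (s m) (s n)))) (f m n hm hn)
  where
  eq : ∀ a b → b - a ≡ (- a) - (- b)
  eq = solve 2 (λ a b → b :- a := (:- a) :- (:- b)) refl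
    where open ℚ-Solver

_÷⁺_ : ∀ {B} → ℚ → 0ℚ < B → ℚ
_÷⁺_ {B} p h = p * (1/ B) {{pos⇒nonZero B {{positive h}}}}

÷⁺-pos : ∀ {p B} → 0ℚ < p → (h : 0ℚ < B) → 0ℚ < p ÷⁺ h
÷⁺-pos {p} {B} hp h = *-pos hp
  (positive⁻¹ _ {{1/pos⇒pos B {{positive h}}}})

÷⁺-cancel : ∀ {B} p (h : 0ℚ < B) → B * (p ÷⁺ h) ≡ p
÷⁺-cancel {B} p h = trans (sym (*-assoc B p _)) $ trans (cong (_* _) (*-comm B p)) $
  trans (*-assoc p B _) $
  trans (cong (p *_) (*-inverseʳ B {{pos⇒nonZero B {{positive h}}}})) (*-identityʳ p)

eventually-bounded : ∀ s → IsCauchy s →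
  ∃[ B ] (0ℚ < B × Eventually (λ n → ∣ s n ∣ ≤ B))
eventually-bounded s cs =
  let N , f = cs 1ℚ (positive⁻¹ 1ℚ)
      B = 1ℚ + ∣ s N ∣
  in B
   , <-≤-trans (positive⁻¹ 1ℚ)
       (subst (_≤ B) (+-identityʳ 1ℚ) (+-monoʳ-≤ 1ℚ (0≤∣p∣ (s N))))
   , N
   , λ n hn → begin
       ∣ s n ∣                 ≡⟨ cong ∣_∣ (eq (s n) (s N)) ⟩
       ∣ (s n - s N) + s N ∣   ≤⟨ ∣p+q∣≤∣p∣+∣q∣ (s n - s N) (s N) ⟩
       ∣ s n - s N ∣ + ∣ s N ∣ ≤⟨ +-monoˡ-≤ ∣ s N ∣ (<⇒≤ (f n N hn ℕ.≤-refl)) ⟩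
       1ℚ + ∣ s N ∣            ∎
  where
  open ≤-Reasoning
  eq : ∀ a b → a ≡ (a - b) + b
  eq = solve 2 (λ a b → a := (a :- b) :+ b) refl
    where open ℚ-Solver

*-isCauchy : ∀ s t → IsCauchy s → IsCauchy t → IsCauchy (λ n → s n * t n)
*-isCauchy s t cs ct ε h =
  let B , B>0 , K , bs = eventually-bounded s cs
      C , C>0 , L , bt = eventually-bounded t ct
      M , f = cs ((½ * ε) ÷⁺ C>0) (÷⁺-pos (half-pos h) C>0)
      N , g = ct ((½ * ε) ÷⁺ B>0) (÷⁺-pos (half-pos h) B>0)
      P = (K ℕ.⊔ L) ℕ.⊔ (M ℕ.⊔ N)
  in P , λ m n hm hn →
    let hK : ∀ {o} → P ℕ.≤ o → K ℕ.≤ o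
        hK = ℕ.≤-trans (ℕ.≤-trans (ℕ.m≤m⊔n K L) (ℕ.m≤m⊔n (K ℕ.⊔ L) (M ℕ.⊔ N)))
        hL : ∀ {o} → P ℕ.≤ o → L ℕ.≤ o
        hL = ℕ.≤-trans (ℕ.≤-trans (ℕ.m≤n⊔m K L) (ℕ.m≤m⊔n (K ℕ.⊔ L) (M ℕ.⊔ N)))
        hM : ∀ {o} → P ℕ.≤ o → M ℕ.≤ o
        hM = ℕ.≤-trans (ℕ.≤-trans (ℕ.m≤m⊔n M N) (ℕ.m≤n⊔m (K ℕ.⊔ L) (M ℕ.⊔ N)))
        hN : ∀ {o} → P ℕ.≤ o → N ℕ.≤ o
        hN = ℕ.≤-trans (ℕ.≤-trans (ℕ.m≤n⊔m M N) (ℕ.m≤n⊔m (K ℕ.⊔ L) (M ℕ.⊔ N)))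
    in begin-strict
    ∣ s m * t m - s n * t n ∣
      ≡⟨ cong ∣_∣ (eq (s m) (t m) (s n) (t n)) ⟩
    ∣ s m * (t m - t n) + t n * (s m - s n) ∣
      ≤⟨ ∣p+q∣≤∣p∣+∣q∣ (s m * (t m - t n)) (t n * (s m - s n)) ⟩
    ∣ s m * (t m - t n) ∣ + ∣ t n * (s m - s n) ∣
      <⟨ +-mono-< {∣ s m * (t m - t n) ∣} {½ * ε} {∣ t n * (s m - s n) ∣} {½ * ε}
                  (small {p = ½ * ε} (s m) (t m - t n) B>0 (bs m (hK hm)) (g m n (hN hm) (hN hn)))
                  (small {p = ½ * ε} (t n) (s m - s n) C>0 (bt n (hL hn)) (f m n (hM hm) (hM hn))) ⟩
    ½ * ε + ½ * ε
      ≡⟨ halves ε ⟩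
    ε ∎
  where
  open ≤-Reasoning
  small : ∀ {B p} u v (h : 0ℚ < B) → ∣ u ∣ ≤ B → ∣ v ∣ < p ÷⁺ h → ∣ u * v ∣ < p
  small {B} {p} u v h hu hv = begin-strict
    ∣ u * v ∣     ≡⟨ ∣p*q∣≡∣p∣*∣q∣ u v ⟩
    ∣ u ∣ * ∣ v ∣ ≤⟨ *-monoʳ-≤-nonNeg ∣ v ∣ {{nonNegative (0≤∣p∣ v)}} hu ⟩
    B * ∣ v ∣     <⟨ *-monoʳ-<-pos B {{positive h}} hv ⟩
    B * (p ÷⁺ h)  ≡⟨ ÷⁺-cancel p h ⟩
    p             ∎

  eq : ∀ a b c d → a * b - c * d ≡ a * (b - d) + d * (a - c)
  eq = solve 4 (λ a b c d → a :* b :- c :* d := a :* (b :- d) :+ d :* (a :- c)) refl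
    where open ℚ-Solver

isqrt : ℕ → ℕ
isqrt zero    = zero
isqrt (suc n) with suc (isqrt n) ℕ.* suc (isqrt n) ℕ.≤? suc n
... | yes _ = suc (isqrt n)
... | no  _ = isqrt n

-- The largest multiple of 1 / (d (k+1)) whose square is at most a / d, for d = suc d-1.
sqrtFraction : ℕ → ℕ → ℕ → ℚ
sqrtFraction a d-1 k =
  + isqrt (a ℕ.* suc d-1 ℕ.* (suc k ℕ.* suc k)) / (suc d-1 ℕ.* suc k)

sqrtApprox : ℕ → ℚ → ℚ
sqrtApprox k q = sqrtFraction ℤ.∣ ↥ (q ⊔ 0ℚ) ∣ (ℚ.denominator-1 (q ⊔ 0ℚ)) k

isqrt-lower : ∀ n → isqrt n ℕ.* isqrt n ℕ.≤ n
isqrt-lower zero    = z≤n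
isqrt-lower (suc n) with suc (isqrt n) ℕ.* suc (isqrt n) ℕ.≤? suc n
... | yes h = h
... | no  _ = ℕ.m≤n⇒m≤1+n (isqrt-lower n)

isqrt-upper : ∀ n → n ℕ.< suc (isqrt n) ℕ.* suc (isqrt n)
isqrt-upper zero    = s≤s z≤n
isqrt-upper (suc n) with suc (isqrt n) ℕ.* suc (isqrt n) ℕ.≤? suc n
... | no  h = ℕ.≰⇒> h
... | yes h = ℕ.≤-<-trans (isqrt-upper n)
  (ℕ.*-mono-< {suc (isqrt n)} {suc (suc (isqrt n))} {suc (isqrt n)} {suc (suc (isqrt n))}
    (ℕ.n<1+n (suc (isqrt n))) (ℕ.n<1+n (suc (isqrt n))))

fromℚᵘ-*-≤ : ∀ x y z → x ℚᵘ.* y ℚᵘ.≤ z → fromℚᵘ x * fromℚᵘ y ≤ fromℚᵘ z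
fromℚᵘ-*-≤ x y z h = toℚᵘ-cancel-≤ $ ℚᵘ.≤-respˡ-≃ (ℚᵘ.≃-sym eq)
  (ℚᵘ.≤-respʳ-≃ (ℚᵘ.≃-sym (toℚᵘ-fromℚᵘ z)) h)
  where
  eq : toℚᵘ (fromℚᵘ x * fromℚᵘ y) ℚᵘ.≃ x ℚᵘ.* y
  eq = ℚᵘ.≃-trans (toℚᵘ-homo-* (fromℚᵘ x) (fromℚᵘ y))
         (ℚᵘ.*-cong (toℚᵘ-fromℚᵘ x) (toℚᵘ-fromℚᵘ y))

fromℚᵘ-*-> : ∀ x y z → z ℚᵘ.< x ℚᵘ.* y → fromℚᵘ z < fromℚᵘ x * fromℚᵘ y
fromℚᵘ-*-> x y z h = toℚᵘ-cancel-< $ ℚᵘ.<-respʳ-≃ (ℚᵘ.≃-sym eq)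
  (ℚᵘ.<-respˡ-≃ (ℚᵘ.≃-sym (toℚᵘ-fromℚᵘ z)) h)
  where
  eq : toℚᵘ (fromℚᵘ x * fromℚᵘ y) ℚᵘ.≃ x ℚᵘ.* y
  eq = ℚᵘ.≃-trans (toℚᵘ-homo-* (fromℚᵘ x) (fromℚᵘ y))
         (ℚᵘ.*-cong (toℚᵘ-fromℚᵘ x) (toℚᵘ-fromℚᵘ y))

fromℚᵘ-+-≤ : ∀ x y z → z ℚᵘ.≤ x ℚᵘ.+ y → fromℚᵘ z ≤ fromℚᵘ x + fromℚᵘ y
fromℚᵘ-+-≤ x y z h = toℚᵘ-cancel-≤ $ ℚᵘ.≤-respʳ-≃ (ℚᵘ.≃-sym eq)
  (ℚᵘ.≤-respˡ-≃ (ℚᵘ.≃-sym (toℚᵘ-fromℚᵘ z)) h)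
  where
  eq : toℚᵘ (fromℚᵘ x + fromℚᵘ y) ℚᵘ.≃ x ℚᵘ.+ y
  eq = ℚᵘ.≃-trans (toℚᵘ-homo-+ (fromℚᵘ x) (fromℚᵘ y))
         (ℚᵘ.+-cong (toℚᵘ-fromℚᵘ x) (toℚᵘ-fromℚᵘ y))

rational-square-lower : ∀ a d k r → r ℕ.* r ℕ.≤ a ℕ.* suc d ℕ.* (suc k ℕ.* suc k) →
  (+ r / (suc d ℕ.* suc k)) * (+ r / (suc d ℕ.* suc k)) ≤ + a / suc d
rational-square-lower a d k r h =
  fromℚᵘ-*-≤ (ℚᵘ.mkℚᵘ (+ r) _) (ℚᵘ.mkℚᵘ (+ r) _) (ℚᵘ.mkℚᵘ (+ a) d) $
  ℚᵘ.*≤* $ subst₂ ℤ._≤_ e₁ e₂ $ ℤ.+≤+ $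
  subst (r ℕ.* r ℕ.* suc d ℕ.≤_) (nat a (suc d) (suc k)) $ ℕ.*-monoˡ-≤ (suc d) h
  where
  nat : ∀ a d k → a ℕ.* d ℕ.* (k ℕ.* k) ℕ.* d ≡ a ℕ.* (d ℕ.* k ℕ.* (d ℕ.* k))
  nat = solve 3 (λ a d k → a :* d :* (k :* k) :* d := a :* (d :* k :* (d :* k))) refl
    where open ℕ-Solver
  e₁ : + (r ℕ.* r ℕ.* suc d) ≡ + r ℤ.* + r ℤ.* + suc d
  e₁ = trans (ℤ.pos-* (r ℕ.* r) (suc d)) (cong (ℤ._* + suc d) (ℤ.pos-* r r))
  e₂ : + (a ℕ.* (suc d ℕ.* suc k ℕ.* (suc d ℕ.* suc k))) ≡
       + a ℤ.* + (suc d ℕ.* suc k ℕ.* (suc d ℕ.* suc k))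
  e₂ = ℤ.pos-* a _

rational-square-upper : ∀ a d k r → a ℕ.* suc d ℕ.* (suc k ℕ.* suc k) ℕ.< r ℕ.* r →
  + a / suc d < (+ r / (suc d ℕ.* suc k)) * (+ r / (suc d ℕ.* suc k))
rational-square-upper a d k r h =
  fromℚᵘ-*-> (ℚᵘ.mkℚᵘ (+ r) _) (ℚᵘ.mkℚᵘ (+ r) _) (ℚᵘ.mkℚᵘ (+ a) d) $
  ℚᵘ.*<* $ subst₂ ℤ._<_ e₂ e₁ $ ℤ.+<+ $
  subst (ℕ._< r ℕ.* r ℕ.* suc d) (nat a (suc d) (suc k)) $ ℕ.*-monoˡ-< (suc d) h
  where
  nat : ∀ a d k → a ℕ.* d ℕ.* (k ℕ.* k) ℕ.* d ≡ a ℕ.* (d ℕ.* k ℕ.* (d ℕ.* k))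
  nat = solve 3 (λ a d k → a :* d :* (k :* k) :* d := a :* (d :* k :* (d :* k))) refl
    where open ℕ-Solver
  e₁ : + (r ℕ.* r ℕ.* suc d) ≡ + r ℤ.* + r ℤ.* + suc d
  e₁ = trans (ℤ.pos-* (r ℕ.* r) (suc d)) (cong (ℤ._* + suc d) (ℤ.pos-* r r))
  e₂ : + (a ℕ.* (suc d ℕ.* suc k ℕ.* (suc d ℕ.* suc k))) ≡
       + a ℤ.* + (suc d ℕ.* suc k ℕ.* (suc d ℕ.* suc k))
  e₂ = ℤ.pos-* a _

numerator-step : ∀ r d k →
  + suc r / (suc d ℕ.* suc k) ≤ + r / (suc d ℕ.* suc k) + + 1 / suc k
numerator-step r d k =
  fromℚᵘ-+-≤ (ℚᵘ.mkℚᵘ (+ r) _) (ℚᵘ.mkℚᵘ (+ 1) k) (ℚᵘ.mkℚᵘ (+ suc r) _) $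
  ℚᵘ.*≤* $ subst₂ ℤ._≤_ e₁ e₂ $ ℤ.+≤+ $
  subst (ℕ._≤ (r ℕ.* suc k ℕ.+ 1 ℕ.* D) ℕ.* D) (nat (suc r) D (suc k))
    (ℕ.*-monoˡ-≤ D h)
  where
  D : ℕ
  D = suc d ℕ.* suc k
  h : suc r ℕ.* suc k ℕ.≤ r ℕ.* suc k ℕ.+ 1 ℕ.* D
  h = subst₂ ℕ._≤_ (ℕ.+-comm (r ℕ.* suc k) (suc k))
        (cong (r ℕ.* suc k ℕ.+_) (sym (ℕ.*-identityˡ D)))
        (ℕ.+-monoʳ-≤ (r ℕ.* suc k) (ℕ.m≤m+n (suc k) (d ℕ.* suc k)))
  nat : ∀ a b c → a ℕ.* c ℕ.* b ≡ a ℕ.* (b ℕ.* c)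
  nat = solve 3 (λ a b c → a :* c :* b := a :* (b :* c)) refl
    where open ℕ-Solver
  e₁ : + (suc r ℕ.* (D ℕ.* suc k)) ≡ + suc r ℤ.* + (D ℕ.* suc k)
  e₁ = ℤ.pos-* (suc r) _
  e₂ : + ((r ℕ.* suc k ℕ.+ 1 ℕ.* D) ℕ.* D) ≡ (+ r ℤ.* + suc k ℤ.+ + 1 ℤ.* + D) ℤ.* + D
  e₂ = trans (ℤ.pos-* (r ℕ.* suc k ℕ.+ 1 ℕ.* D) D) (cong (ℤ._* + D)
         (cong₂ ℤ._+_ (ℤ.pos-* r (suc k)) (ℤ.pos-* 1 D)))

nonNeg-fraction : ∀ p → 0ℚ ≤ p → + ℤ.∣ ↥ p ∣ / ↧ₙ p ≡ p
nonNeg-fraction p@(mkℚ (+ _) _ _)    _ = ↥p/↧p≡p p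
nonNeg-fraction p@(mkℚ -[1+ _ ] _ _) h =
  contradiction (≤-<-trans h (negative⁻¹ p)) (<-irrefl refl)

fraction-nonNeg : ∀ a n .{{_ : ℕ.NonZero n}} → 0ℚ ≤ + a / n
fraction-nonNeg a n = nonNegative⁻¹ (+ a / n) {{normalize-nonNeg a n}}

*-mono-≤-square : ∀ {p q} → 0ℚ ≤ p → p ≤ q → p * p ≤ q * q
*-mono-≤-square {p} {q} h p≤q = ≤-trans
  (*-monoʳ-≤-nonNeg p {{nonNegative h}} p≤q)
  (*-monoˡ-≤-nonNeg q {{nonNegative (≤-trans h p≤q)}} p≤q)

sqrtFraction-nonNeg : ∀ a d k → 0ℚ ≤ sqrtFraction a d k
sqrtFraction-nonNeg a d k =
  fraction-nonNeg (isqrt (a ℕ.* suc d ℕ.* (suc k ℕ.* suc k))) (suc d ℕ.* suc k)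

sqrtApprox-nonNeg : ∀ k q → 0ℚ ≤ sqrtApprox k q
sqrtApprox-nonNeg k q =
  sqrtFraction-nonNeg ℤ.∣ ↥ (q ⊔ 0ℚ) ∣ (ℚ.denominator-1 (q ⊔ 0ℚ)) k

sqrtFraction-lower : ∀ a d k → sqrtFraction a d k * sqrtFraction a d k ≤ + a / suc d
sqrtFraction-lower a d k = rational-square-lower a d k
  (isqrt (a ℕ.* suc d ℕ.* (suc k ℕ.* suc k))) (isqrt-lower (a ℕ.* suc d ℕ.* (suc k ℕ.* suc k)))

sqrtFraction-upper : ∀ a d k →
  + a / suc d < (sqrtFraction a d k + + 1 / suc k) * (sqrtFraction a d k + + 1 / suc k)
sqrtFraction-upper a d k = <-≤-trans {+ a / suc d} {s * s}
  (rational-square-upper a d k (suc r) (isqrt-upper N))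
  (*-mono-≤-square (fraction-nonNeg (suc r) (suc d ℕ.* suc k)) (numerator-step r d k))
  where
  N r : ℕ
  N = a ℕ.* suc d ℕ.* (suc k ℕ.* suc k)
  r = isqrt N
  s : ℚ
  s = + suc r / (suc d ℕ.* suc k)

sqrtApprox-lower : ∀ k q → sqrtApprox k q * sqrtApprox k q ≤ q ⊔ 0ℚ
sqrtApprox-lower k q = subst (sqrtApprox k q * sqrtApprox k q ≤_)
  (nonNeg-fraction (q ⊔ 0ℚ) (p≤q⊔p q 0ℚ))
  (sqrtFraction-lower ℤ.∣ ↥ (q ⊔ 0ℚ) ∣ (ℚ.denominator-1 (q ⊔ 0ℚ)) k)

sqrtApprox-upper : ∀ k q →
  q ⊔ 0ℚ < (sqrtApprox k q + + 1 / suc k) * (sqrtApprox k q + + 1 / suc k)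
sqrtApprox-upper k q = subst
  (_< (sqrtApprox k q + + 1 / suc k) * (sqrtApprox k q + + 1 / suc k))
  (nonNeg-fraction (q ⊔ 0ℚ) (p≤q⊔p q 0ℚ))
  (sqrtFraction-upper ℤ.∣ ↥ (q ⊔ 0ℚ) ∣ (ℚ.denominator-1 (q ⊔ 0ℚ)) k)

recip-eventually-≤ : ∀ ε → 0ℚ < ε → Eventually (λ n → + 1 / suc n ≤ ε)
recip-eventually-≤ (mkℚ (+ zero) d c)   h = contradiction (↥p≡0⇒p≡0 (mkℚ (+ zero) d c) refl) (≢-sym (<⇒≢ h))
recip-eventually-≤ (mkℚ -[1+ a ] d c) h =
  contradiction (<-trans h (negative⁻¹ (mkℚ -[1+ a ] d c))) (<-irrefl refl)
recip-eventually-≤ ε@(mkℚ (+ suc a) d _) _ = d , λ n hn →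
  toℚᵘ-cancel-≤ $ ℚᵘ.≤-respˡ-≃ (ℚᵘ.≃-sym (toℚᵘ-fromℚᵘ (ℚᵘ.mkℚᵘ (+ 1) n))) $
  ℚᵘ.*≤* $ subst₂ ℤ._≤_ (ℤ.pos-* 1 (suc d)) (ℤ.pos-* (suc a) (suc n)) $ ℤ.+≤+ $
  ℕ.*-mono-≤ (s≤s (z≤n {a})) (s≤s hn)

∣-∣-bound : ∀ {p q ε} → p < q + ε → q < p + ε → ∣ p - q ∣ < ε
∣-∣-bound {p} {q} {ε} h k with ∣p∣≡p∨∣p∣≡-p (p - q)
... | inj₁ e = subst (_< ε) (sym e) (subst (p - q <_) (eq q ε) (+-monoˡ-< (- q) h))
  where
  eq : ∀ q ε → (q + ε) - q ≡ ε
  eq = solve 2 (λ q ε → (q :+ ε) :- q := ε) refl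
    where open ℚ-Solver
... | inj₂ e = subst (_< ε) (sym (trans e (eq₁ p q))) (subst (q - p <_) (eq p ε) (+-monoˡ-< (- p) k))
  where
  eq₁ : ∀ p q → - (p - q) ≡ q - p
  eq₁ = solve 2 (λ p q → :- (p :- q) := q :- p) refl
    where open ℚ-Solver
  eq : ∀ q ε → (q + ε) - q ≡ ε
  eq = solve 2 (λ q ε → (q :+ ε) :- q := ε) refl
    where open ℚ-Solver

≤-+∣-∣ : ∀ p q → p ≤ q + ∣ p - q ∣
≤-+∣-∣ p q = subst (_≤ q + ∣ p - q ∣) (eq p q) (+-monoʳ-≤ q (∣∣-upper (p - q)))
  where
  eq : ∀ p q → q + (p - q) ≡ p
  eq = solve 2 (λ p q → q :+ (p :- q) := p) refl
    where open ℚ-Solver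

⊔0-lipschitz : ∀ p q → p ⊔ 0ℚ ≤ (q ⊔ 0ℚ) + ∣ p - q ∣
⊔0-lipschitz p q = ⊔-lub
  (≤-trans (≤-+∣-∣ p q) (+-monoˡ-≤ ∣ p - q ∣ (p≤p⊔q q 0ℚ)))
  (subst (_≤ (q ⊔ 0ℚ) + ∣ p - q ∣) (+-identityʳ 0ℚ) (+-mono-≤ (p≤q⊔p q 0ℚ) (0≤∣p∣ (p - q))))

0≤+ : ∀ {a b} → 0ℚ ≤ a → 0ℚ ≤ b → 0ℚ ≤ a + b
0≤+ {a} {b} x y = subst (_≤ a + b) (+-identityʳ 0ℚ) (+-mono-≤ x y)

0≤* : ∀ {a b} → 0ℚ ≤ a → 0ℚ ≤ b → 0ℚ ≤ a * b
0≤* {a} {b} x y = subst (_≤ a * b) (*-zeroʳ a) (*-monoˡ-≤-nonNeg a {{nonNegative x}} y)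

square-comparison : ∀ s t u η p q δ → 0ℚ ≤ t → 0ℚ ≤ u → 0ℚ ≤ η → u ≤ η →
  s * s ≤ p → q < (t + u) * (t + u) → p ≤ q + δ → δ < η * η →
  s < t + (η + η)
square-comparison s t u η p q δ 0≤t 0≤u 0≤η u≤η s²≤p q< p≤ δ< with s <? t + (η + η)
... | yes h = h
... | no  h = contradiction contra (<-irrefl refl)
  where
  open ≤-Reasoning
  eq : ∀ t η → (t + (η + η)) * (t + (η + η)) ≡
               (t + η) * (t + η) + η * η + ((η + η) * (t + η))
  eq = solve 2 (λ t η → (t :+ (η :+ η)) :* (t :+ (η :+ η)) :=
               (t :+ η) :* (t :+ η) :+ η :* η :+ ((η :+ η) :* (t :+ η))) refl
    where open ℚ-Solver
  contra : p < p
  contra = begin-strict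
    p
      ≤⟨ p≤ ⟩
    q + δ
      <⟨ +-mono-< {q} {(t + u) * (t + u)} {δ} {η * η} q< δ< ⟩
    (t + u) * (t + u) + η * η
      ≤⟨ +-monoˡ-≤ (η * η) (*-mono-≤-square (0≤+ 0≤t 0≤u) (+-monoʳ-≤ t u≤η)) ⟩
    (t + η) * (t + η) + η * η
      ≡⟨ sym (+-identityʳ ((t + η) * (t + η) + η * η)) ⟩
    (t + η) * (t + η) + η * η + 0ℚ
      ≤⟨ +-monoʳ-≤ ((t + η) * (t + η) + η * η) (0≤* (0≤+ 0≤η 0≤η) (0≤+ 0≤t 0≤η)) ⟩
    (t + η) * (t + η) + η * η + ((η + η) * (t + η))
      ≡⟨ sym (eq t η) ⟩
    (t + (η + η)) * (t + (η + η))
      ≤⟨ *-mono-≤-square (0≤+ 0≤t (0≤+ 0≤η 0≤η)) (≮⇒≥ h) ⟩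
    s * s
      ≤⟨ s²≤p ⟩
    p ∎

sqrtApprox-close : ∀ m n p q {ε} → 0ℚ < ε → + 1 / suc n ≤ ½ * ε →
  ∣ p - q ∣ < (½ * ε) * (½ * ε) → sqrtApprox m p < sqrtApprox n q + ε
sqrtApprox-close m n p q {ε} ε>0 hn hpq =
  subst (λ x → sqrtApprox m p < sqrtApprox n q + x) (halves ε) $
  square-comparison (sqrtApprox m p) (sqrtApprox n q) (+ 1 / suc n) (½ * ε)
    (p ⊔ 0ℚ) (q ⊔ 0ℚ) ∣ p - q ∣
    (sqrtApprox-nonNeg n q) (fraction-nonNeg 1 (suc n)) (<⇒≤ (half-pos ε>0)) hn
    (sqrtApprox-lower m p) (sqrtApprox-upper n q) (⊔0-lipschitz p q) hpq

sqrt-isCauchy : ∀ s → IsCauchy s → IsCauchy (λ n → sqrtApprox n (s n))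
sqrt-isCauchy s cs ε ε>0 =
  let M , f = cs ((½ * ε) * (½ * ε)) (*-pos (half-pos ε>0) (half-pos ε>0))
      N , g = recip-eventually-≤ (½ * ε) (half-pos ε>0)
  in M ℕ.⊔ N , λ m n hm hn →
    let fm = ℕ.m⊔n≤o⇒m≤o M N hm
        fn = ℕ.m⊔n≤o⇒m≤o M N hn
        gm = ℕ.m⊔n≤o⇒n≤o M N hm
        gn = ℕ.m⊔n≤o⇒n≤o M N hn
    in ∣-∣-bound
      (sqrtApprox-close m n (s m) (s n) ε>0 (g n gn) (f m n fm fn))
      (sqrtApprox-close n m (s n) (s m) ε>0 (g m gm) (f n m fn fm))

-- Cauchy sequences of rationals; equality and order are those of the limits.
record ℝ : Set where
  constructor mkℝ
  field
    seq    : ℕ → ℚ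
    cauchy : IsCauchy seq

open ℝ public

abstract
  const-cauchy : ∀ q → IsCauchy (λ _ → q)
  const-cauchy = const-isCauchy

  +-cauchy : ∀ x y → IsCauchy (λ n → seq x n + seq y n)
  +-cauchy x y = +-isCauchy (seq x) (seq y) (cauchy x) (cauchy y)

  neg-cauchy : ∀ x → IsCauchy (λ n → - seq x n)
  neg-cauchy x = neg-isCauchy (seq x) (cauchy x)

  *-cauchy : ∀ x y → IsCauchy (λ n → seq x n * seq y n)
  *-cauchy x y = *-isCauchy (seq x) (seq y) (cauchy x) (cauchy y)

  sqrt-cauchy : ∀ x → IsCauchy (λ n → sqrtApprox n (seq x n))
  sqrt-cauchy x = sqrt-isCauchy (seq x) (cauchy x)

infixl 7 _*ᴿ_ _*ᶜ_
infixl 6 _+ᴿ_ _-ᴿ_ _+ᶜ_ _-ᶜ_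
infix  8 -ᴿ_ -ᶜ_
infixr 9 _^ᶜ_
infix  4 _≈ᴿ_ _≤ᴿ_ _<ᴿ_ _≈ᶜ_

ℚ→ℝ : ℚ → ℝ
ℚ→ℝ q = mkℝ (λ _ → q) (const-cauchy q)

0ᴿ 1ᴿ 2ᴿ : ℝ
0ᴿ = ℚ→ℝ 0ℚ
1ᴿ = ℚ→ℝ 1ℚ
2ᴿ = ℚ→ℝ (+ 2 / 1)

_+ᴿ_ _*ᴿ_ : ℝ → ℝ → ℝ
x +ᴿ y = mkℝ (λ n → seq x n + seq y n) (+-cauchy x y)
x *ᴿ y = mkℝ (λ n → seq x n * seq y n) (*-cauchy x y)

-ᴿ_ : ℝ → ℝ
-ᴿ x = mkℝ (λ n → - seq x n) (neg-cauchy x)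

_-ᴿ_ : ℝ → ℝ → ℝ
x -ᴿ y = x +ᴿ -ᴿ y

-- The square root of max(x , 0).
√ᴿ : ℝ → ℝ
√ᴿ x = mkℝ (λ n → sqrtApprox n (seq x n)) (sqrt-cauchy x)

record _≈ᴿ_ (x y : ℝ) : Set where
  constructor mk≈ᴿ
  field
    eventually-≈ : ∀ ε → 0ℚ < ε → Eventually (λ n → ∣ seq x n - seq y n ∣ < ε)

record _≤ᴿ_ (x y : ℝ) : Set where
  constructor mk≤ᴿ
  field
    eventually-≤ : ∀ ε → 0ℚ < ε → Eventually (λ n → seq x n < seq y n + ε)

record _<ᴿ_ (x y : ℝ) : Set where
  constructor mk<ᴿ
  field
    gap          : ℚ
    gap-pos      : 0ℚ < gap
    eventually-< : Eventually (λ n → seq x n + gap < seq y n)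

open _≈ᴿ_ public
open _≤ᴿ_ public
open _<ᴿ_ public

√ᴿ-nonNeg : ∀ x → 0ᴿ ≤ᴿ √ᴿ x
√ᴿ-nonNeg x = mk≤ᴿ λ ε ε>0 → 0 , λ n _ → ≤-<-trans (sqrtApprox-nonNeg n (seq x n)) $
  subst (_< sqrtApprox n (seq x n) + ε) (+-identityʳ (sqrtApprox n (seq x n)))
    (+-monoʳ-< (sqrtApprox n (seq x n)) ε>0)

square-error : ∀ s u q ε η B → 0ℚ ≤ s → s ≤ B → 0ℚ ≤ u → u ≤ 1ℚ → u ≤ η →
  (B + B + 1ℚ) * η ≡ ½ * ε → 0ℚ < ε →
  s * s ≤ q ⊔ 0ℚ → q ⊔ 0ℚ < (s + u) * (s + u) → 0ℚ < q + ½ * ε →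
  ∣ s * s - q ∣ < ε
square-error s u q ε η B 0≤s s≤B 0≤u u≤1 u≤η Bη≡ ε>0 lower upper q> =
  ∣-∣-bound below above
  where
  open ≤-Reasoning
  q≤ : q ≤ q + ½ * ε
  q≤ = subst (_≤ q + ½ * ε) (+-identityʳ q) (+-monoʳ-≤ q (<⇒≤ (half-pos ε>0)))
  ½ε<ε : ½ * ε < ε
  ½ε<ε = subst₂ _<_ (+-identityʳ (½ * ε)) (halves ε) (+-monoʳ-< (½ * ε) (half-pos ε>0))
  below : s * s < q + ε
  below = begin-strict
    s * s     ≤⟨ lower ⟩
    q ⊔ 0ℚ    ≤⟨ ⊔-lub q≤ (<⇒≤ q>) ⟩
    q + ½ * ε <⟨ +-monoʳ-< q ½ε<ε ⟩
    q + ε     ∎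
  0≤B : 0ℚ ≤ B
  0≤B = ≤-trans 0≤s s≤B
  eq : ∀ s u → (s + u) * (s + u) ≡ s * s + (s + s + u) * u
  eq = solve 2 (λ s u → (s :+ u) :* (s :+ u) := s :* s :+ (s :+ s :+ u) :* u) refl
    where open ℚ-Solver
  above : q < s * s + ε
  above = begin-strict
    q                               ≤⟨ p≤p⊔q q 0ℚ ⟩
    q ⊔ 0ℚ                          <⟨ upper ⟩
    (s + u) * (s + u)               ≡⟨ eq s u ⟩
    s * s + (s + s + u) * u         ≤⟨ +-monoʳ-≤ (s * s) (*-monoʳ-≤-nonNeg u {{nonNegative 0≤u}}
                                         (+-mono-≤ (+-mono-≤ s≤B s≤B) u≤1)) ⟩
    s * s + (B + B + 1ℚ) * u        ≤⟨ +-monoʳ-≤ (s * s) (*-monoˡ-≤-nonNeg (B + B + 1ℚ)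
                                         {{nonNegative (0≤+ (0≤+ 0≤B 0≤B) (nonNegative⁻¹ 1ℚ))}} u≤η) ⟩
    s * s + (B + B + 1ℚ) * η        ≡⟨ cong (λ x → s * s + x) Bη≡ ⟩
    s * s + ½ * ε                   <⟨ +-monoʳ-< (s * s) ½ε<ε ⟩
    s * s + ε                       ∎

√ᴿ-square : ∀ x → 0ᴿ ≤ᴿ x → √ᴿ x *ᴿ √ᴿ x ≈ᴿ x
√ᴿ-square x 0≤x = mk≈ᴿ λ ε ε>0 →
  let B , B>0 , N₁ , bounded = eventually-bounded (seq (√ᴿ x)) (cauchy (√ᴿ x))
      D>0 = 2B+1-pos B>0
      η = (½ * ε) ÷⁺ D>0
      N₂ , small = recip-eventually-≤ η (÷⁺-pos (half-pos ε>0) D>0)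
      N₃ , nonneg = eventually-≤ 0≤x (½ * ε) (half-pos ε>0)
  in N₁ ℕ.⊔ (N₂ ℕ.⊔ N₃) , λ n hn →
    let h₂₃ = ℕ.m⊔n≤o⇒n≤o N₁ (N₂ ℕ.⊔ N₃) hn
    in square-error (sqrtApprox n (seq x n)) (+ 1 / suc n) (seq x n) ε η B
      (sqrtApprox-nonNeg n (seq x n))
      (≤-trans (∣∣-upper (sqrtApprox n (seq x n))) (bounded n (ℕ.m⊔n≤o⇒m≤o N₁ (N₂ ℕ.⊔ N₃) hn)))
      (fraction-nonNeg 1 (suc n))
      (recip≤1 n)
      (small n (ℕ.m⊔n≤o⇒m≤o N₂ N₃ h₂₃))
      (÷⁺-cancel (½ * ε) D>0)
      ε>0
      (sqrtApprox-lower n (seq x n))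
      (sqrtApprox-upper n (seq x n))
      (nonneg n (ℕ.m⊔n≤o⇒n≤o N₂ N₃ h₂₃))
  where
  2B+1-pos : ∀ {B} → 0ℚ < B → 0ℚ < B + B + 1ℚ
  2B+1-pos {B} h = <-trans (positive⁻¹ 1ℚ)
    (subst (_< B + B + 1ℚ) (+-identityˡ 1ℚ) (+-monoˡ-< 1ℚ {0ℚ} {B + B} (+-mono-< h h)))
  recip≤1 : ∀ n → + 1 / suc n ≤ 1ℚ
  recip≤1 n = toℚᵘ-cancel-≤ $ ℚᵘ.≤-respˡ-≃ (ℚᵘ.≃-sym (toℚᵘ-fromℚᵘ (ℚᵘ.mkℚᵘ (+ 1) n))) $
    ℚᵘ.*≤* $ subst₂ ℤ._≤_ (ℤ.pos-* 1 1) (ℤ.pos-* 1 (suc n)) $ ℤ.+≤+ $ s≤s z≤n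

record ℂ : Set where
  constructor _+i_
  field
    re im : ℝ

open ℂ public

record _≈ᶜ_ (z w : ℂ) : Set where
  constructor _,ᶜ_
  field
    re-≈ : re z ≈ᴿ re w
    im-≈ : im z ≈ᴿ im w

open _≈ᶜ_ public

0ᶜ 1ᶜ : ℂ
0ᶜ = 0ᴿ +i 0ᴿ
1ᶜ = 1ᴿ +i 0ᴿ

_+ᶜ_ _*ᶜ_ : ℂ → ℂ → ℂ
z +ᶜ w = (re z +ᴿ re w) +i (im z +ᴿ im w)
z *ᶜ w = (re z *ᴿ re w -ᴿ im z *ᴿ im w) +i (re z *ᴿ im w +ᴿ im z *ᴿ re w)

-ᶜ_ : ℂ → ℂ
-ᶜ z = (-ᴿ re z) +i (-ᴿ im z)

_-ᶜ_ : ℂ → ℂ → ℂ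
z -ᶜ w = z +ᶜ -ᶜ w

_^ᶜ_ : ℂ → ℕ → ℂ
z ^ᶜ zero  = 1ᶜ
z ^ᶜ suc m = z *ᶜ z ^ᶜ m

∣_∣ᶜ : ℂ → ℝ
∣ z ∣ᶜ = √ᴿ (re z *ᴿ re z +ᴿ im z *ᴿ im z)

ℕ→ℂ : ℕ → ℂ
ℕ→ℂ n = ℚ→ℝ (+ n / 1) +i 0ᴿ

∑≤ : ℕ → (ℕ → ℂ) → ℂ
∑≤ zero    f = f zero
∑≤ (suc n) f = ∑≤ n f +ᶜ f (suc n)

IsPartition : Pred (List ℕ) 0ℓ
IsPartition ps = All (1 ℕ.≤_) ps × Linked ℕ._≥_ ps

isPartition? : Decidable IsPartition
isPartition? ps = All.all? (1 ℕ.≤?_) ps ×-dec Linked.linked? (λ p q → q ℕ.≤? p) ps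

largestPart : List ℕ → ℕ
largestPart = foldr ℕ._⊔_ 0

largestHook : List ℕ → ℕ
largestHook ps = largestPart ps ℕ.+ length ps ℕ.∸ 1

evenParts : List ℕ → ℕ
evenParts ps = length (filter (2 ∣?_) ps)

-- All lists of length at most ℓ with entries in {1 , … , k}.
boundedLists : ℕ → ℕ → List (List ℕ)
boundedLists k zero    = [] ∷ []
boundedLists k (suc ℓ) =
  [] ∷ cartesianProductWith _∷_ (map suc (upTo k)) (boundedLists k ℓ)

-- A partition with largest hook length n has at most n parts, each at most n,
-- so every such partition occurs here exactly once: see ∈-partitions and
-- partitions-unique.
partitions : ℕ → List (List ℕ)
partitions n =
  filter (λ ps → isPartition? ps ×-dec largestHook ps ℕ.≟ n) (boundedLists n n)

A : ℕ → ℕ → ℕ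
A n m = length (filter (λ ps → evenParts ps ℕ.≟ m) (partitions n))

-- The sum stops at m = n because A n m vanishes for m > n, by A-vanishes.
F : ℕ → ℂ → ℂ
F n z = ∑≤ n (λ m → ℕ→ℂ (A n m) *ᶜ z ^ᶜ m)

LeftHalfCircle : Pred ℂ 0ℓ
LeftHalfCircle z = ∣ z -ᶜ 1ᶜ ∣ᶜ ≈ᴿ 2ᴿ × re z ≤ᴿ 1ᴿ

boundedLists-unique : ∀ k ℓ → Unique (boundedLists k ℓ)
boundedLists-unique k zero    = [] ∷ []
boundedLists-unique k (suc ℓ) =
  All.tabulate (λ {ps} h e → nonempty (map suc (upTo k)) (boundedLists k ℓ) (subst (_∈ _) (sym e) h)) ∷
  Unique.cartesianProductWith⁺ _∷_ ∷-injective
    (Unique.map⁺ ℕ.suc-injective (Unique.upTo⁺ k)) (boundedLists-unique k ℓ)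
  where
  nonempty : ∀ xs (yss : List (List ℕ)) → [] ∈ cartesianProductWith _∷_ xs yss → ⊥
  nonempty xs yss h with ∈-cartesianProductWith⁻ _∷_ xs yss h
  ... | _ , _ , _ , _ , ()

∈-boundedLists : ∀ k ℓ ps → length ps ℕ.≤ ℓ →
  All (λ p → 1 ℕ.≤ p × p ℕ.≤ k) ps → ps ∈ boundedLists k ℓ
∈-boundedLists k zero    []           _       _ = here refl
∈-boundedLists k (suc ℓ) []           _       _ = here refl
∈-boundedLists k (suc ℓ) (suc p ∷ ps) (s≤s h) ((_ , p<k) ∷ bs) =
  there (∈-cartesianProductWith⁺ _∷_ (∈-map⁺ suc (∈-upTo⁺ p<k)) (∈-boundedLists k ℓ ps h bs))

≤-largestPart : ∀ ps → All (ℕ._≤ largestPart ps) ps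
≤-largestPart []       = []
≤-largestPart (p ∷ ps) = ℕ.m≤m⊔n p (largestPart ps) ∷
  All.map (λ h → ℕ.≤-trans h (ℕ.m≤n⊔m p (largestPart ps))) (≤-largestPart ps)

largestPart≤hook : ∀ ps → largestPart ps ℕ.≤ largestHook ps
largestPart≤hook []         = z≤n
largestPart≤hook ps@(p ∷ qs) = subst (largestPart ps ℕ.≤_)
  (cong (ℕ._∸ 1) (sym (ℕ.+-suc (largestPart ps) (length qs)))) (ℕ.m≤m+n (largestPart ps) (length qs))

length≤hook : ∀ ps → All (1 ℕ.≤_) ps → length ps ℕ.≤ largestHook ps
length≤hook []          _       = z≤n
length≤hook ps@(p ∷ qs) (h ∷ _) = ℕ.≤-pred (ℕ.≤-trans
  (ℕ.+-monoˡ-≤ (length ps) (ℕ.≤-trans h (ℕ.m≤m⊔n p (largestPart qs))))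
  (ℕ.m≤n+m∸n (largestPart ps ℕ.+ length ps) 1))

partitions-unique : ∀ n → Unique (partitions n)
partitions-unique n = Unique.filter⁺
  (λ ps → isPartition? ps ×-dec largestHook ps ℕ.≟ n) (boundedLists-unique n n)

∈-partitions : ∀ n ps → ps ∈ partitions n ⇔ (IsPartition ps × largestHook ps ≡ n)
∈-partitions n ps = mk⇔ (λ h → proj₂ (∈-filter⁻ P? {xs = boundedLists n n} h)) λ where
    ((ps>0 , dec) , refl) → ∈-filter⁺ P?
      (∈-boundedLists n n ps (length≤hook ps ps>0)
        (All.zip (ps>0 , All.map (λ h → ℕ.≤-trans h (largestPart≤hook ps)) (≤-largestPart ps))))
      ((ps>0 , dec) , refl)
  where
  P? : Decidable (λ ps → IsPartition ps × largestHook ps ≡ n)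
  P? ps = isPartition? ps ×-dec largestHook ps ℕ.≟ n

A-vanishes : ∀ n m → n ℕ.< m → A n m ≡ 0
A-vanishes n m n<m = cong length (filter-none (λ ps → evenParts ps ℕ.≟ m)
  (All.tabulate λ {ps} h e → ℕ.<⇒≱ n<m (subst (ℕ._≤ n) e (bound ps (Equivalence.to (∈-partitions n ps) h)))))
  where
  bound : ∀ ps → IsPartition ps × largestHook ps ≡ n → evenParts ps ℕ.≤ n
  bound ps ((ps>0 , _) , refl) = ℕ.≤-trans (length-filter (2 ∣?_) ps) (length≤hook ps ps>0)

{-# OPTIONS --safe #-}
-- A partition with largest hook length n + 1 ≥ 2 arises in exactly one way from one with largest hook length n,
-- by duplicating or by incrementing its first part. Tracking the parity of the first part, this yields the
-- recurrence with characteristic roots α, β, where α + β = 1 + z, αβ = z − 1 and (α − β) Fₙ = αⁿ − βⁿ. At a zero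
-- of Fₙ therefore |α| = |β|, and conjugating α + β = αβ + 2 gives |z − 1| = |α|² = 2 and Re (z − 1) ≤ 0. The
-- square root defining α and β exists only classically, but the conclusions are stable under double negation.
--
-- Conversely, for real y ∈ [−2 , 2] and μ = y/2 + i √(2 − y²/4) the point z = 1 + μ² lies on the half circle,
-- 1 + z = μ y, and Fₙ(z) = μⁿ⁻¹ Uₙ(y) with Uₙ the Chebyshev polynomials. For n = 2ᵐ⁺¹ the zeros of Uₙ include
-- 2 cos (jπ/n), j odd. They are reached without trigonometry: ρ m = 2 cos (π/n) is a nested
-- square root, the points 2 cos (jπ/n) are Chebyshev polynomials in ρ m with steps of order √(2 − ρ m), and a
-- discrete intermediate value argument finds one whose z has nearly prescribed imaginary part.
module Submission where

open import Defs
open import Algebra.Bundles using (CommutativeRing)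
open import Algebra.Structures using (IsCommutativeRing)
import Algebra.Solver.Ring as RingSolver
import Algebra.Solver.Ring.AlmostCommutativeRing as ACR
open import Data.Bool.Base using (if_then_else_)
open import Data.Empty using (⊥)
open import Data.Integer.Base as ℤ using (+_)
import Data.Integer.Properties as ℤ
open import Data.List.Base using (List; []; _∷_; _++_; length; filter; map; foldr)
open import Data.List.Properties using (length-filter; filter-accept; filter-reject)
open import Data.List.Membership.Propositional using (_∈_)
open import Data.List.Membership.Propositional.Properties using (∈-map⁺; ∈-map⁻; ∈-++⁺ˡ; ∈-++⁺ʳ; ∈-++⁻)
open import Data.List.Membership.Propositional.Properties.WithK using (unique∧set⇒bag)
open import Data.List.Relation.Binary.BagAndSetEquality using (∼bag⇒↭)
open import Data.List.Relation.Binary.Permutation.Propositional as Perm using (_↭_)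
open import Data.List.Relation.Unary.All as All using (All; []; _∷_)
open import Data.List.Relation.Unary.AllPairs using ([]; _∷_)
open import Data.List.Relation.Unary.Any using (here)
open import Data.List.Relation.Unary.Linked using (Linked; [-]; _∷_)
open import Data.List.Relation.Unary.Unique.Propositional using (Unique)
import Data.List.Relation.Unary.Unique.Propositional.Properties as Unique
open import Data.Maybe.Base using (Maybe; just; nothing)
open import Data.Nat.Base as ℕ using (ℕ; zero; suc; z≤n; s≤s; _≤_)
open import Data.Nat.Divisibility using (_∣_; _∣?_; divides; ∣m+n∣m⇒∣n; ∣⇒≤)
import Data.Nat.Properties as ℕ
open import Data.Nat.Solver using () renaming (module +-*-Solver to ℕ-Solver)
open import Data.Product.Base using (∃-syntax; _×_; _,_; proj₁; proj₂)
open import Data.Rational.Base as ℚ using (ℚ; 0ℚ; 1ℚ; ½)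
import Data.Rational.Properties as ℚ
open import Data.Rational.Solver using () renaming (module +-*-Solver to ℚ-Solver)
import Data.Rational.Unnormalised.Base as ℚᵘ
import Data.Rational.Unnormalised.Properties as ℚᵘ
open import Data.Sum.Base using (_⊎_; inj₁; inj₂)
open import Function.Base using (_$_; _∘_; case_of_)
open import Function.Bundles using (_⇔_; mk⇔; Equivalence)
open import Level using (0ℓ)
open import Relation.Binary.PropositionalEquality as ≡ using (_≡_; _≢_)
open import Relation.Nullary using (¬_; Dec; does; yes; no)
open import Relation.Nullary.Decidable using (dec-true; dec-false)
open import Relation.Nullary.Negation using (contradiction)

-- Real numbers: ring structure

both : ∀ {P Q R : ℕ → Set} → (∀ {n} → P n → Q n → R n) →
  Eventually P → Eventually Q → Eventually R
both f (M , p) (N , q) = M ℕ.⊔ N , λ n h → f (p n (ℕ.m⊔n≤o⇒m≤o M N h)) (q n (ℕ.m⊔n≤o⇒n≤o M N h))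

eventually-witness : ∀ {P : ℕ → Set} → Eventually P → ∃[ n ] P n
eventually-witness (N , p) = N , p N ℕ.≤-refl

∣-∣<⇒< : ∀ p q {ε} → ℚ.∣ p ℚ.- q ∣ ℚ.< ε → p ℚ.< q ℚ.+ ε
∣-∣<⇒< p q h = ℚ.≤-<-trans (≤-+∣-∣ p q) (ℚ.+-monoʳ-< q h)

+-halves : ∀ p ε → p ℚ.+ ½ ℚ.* ε ℚ.+ ½ ℚ.* ε ≡ p ℚ.+ ε
+-halves p ε = ≡.trans (ℚ.+-assoc p _ _) (≡.cong (p ℚ.+_) (halves ε))

pointwise : ∀ {x y} → (∀ n → seq x n ≡ seq y n) → x ≈ᴿ y
pointwise {x} {y} e = mk≈ᴿ λ ε h → 0 , λ n _ →
  ≡.subst (λ q → ℚ.∣ seq x n ℚ.- q ∣ ℚ.< ε) (e n) (∣const∣ (seq x n) h)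

pointwise-≤ : ∀ {x y} → (∀ n → seq x n ℚ.≤ seq y n) → x ≤ᴿ y
pointwise-≤ {x} {y} e = mk≤ᴿ λ ε h → 0 , λ n _ → ℚ.≤-<-trans (e n)
  (≡.subst (ℚ._< seq y n ℚ.+ ε) (ℚ.+-identityʳ (seq y n)) (ℚ.+-monoʳ-< (seq y n) h))

≈⇒≤ : ∀ {x y} → x ≈ᴿ y → x ≤ᴿ y
≈⇒≤ {x} {y} e = mk≤ᴿ λ ε h →
  let N , f = eventually-≈ e ε h in N , λ n k → ∣-∣<⇒< (seq x n) (seq y n) (f n k)

≤-antisym : ∀ {x y} → x ≤ᴿ y → y ≤ᴿ x → x ≈ᴿ y
≤-antisym p q = mk≈ᴿ λ ε h → both ∣-∣-bound (eventually-≤ p ε h) (eventually-≤ q ε h)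

≤-trans : ∀ {x y z} → x ≤ᴿ y → y ≤ᴿ z → x ≤ᴿ z
≤-trans {x} {y} {z} p q = mk≤ᴿ λ ε h → both (λ {n} → step n ε)
    (eventually-≤ p (½ ℚ.* ε) (half-pos h)) (eventually-≤ q (½ ℚ.* ε) (half-pos h))
  where
  step : ∀ n ε → seq x n ℚ.< seq y n ℚ.+ ½ ℚ.* ε → seq y n ℚ.< seq z n ℚ.+ ½ ℚ.* ε → seq x n ℚ.< seq z n ℚ.+ ε
  step n ε a b = ℚ.<-trans a (≡.subst (seq y n ℚ.+ ½ ℚ.* ε ℚ.<_)
    (+-halves (seq z n) ε) (ℚ.+-monoˡ-< (½ ℚ.* ε) b))

≤-refl : ∀ {x} → x ≤ᴿ x
≤-refl = pointwise-≤ λ _ → ℚ.≤-refl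

≈-refl : ∀ {x} → x ≈ᴿ x
≈-refl = pointwise λ _ → ≡.refl

≈-sym : ∀ {x y} → x ≈ᴿ y → y ≈ᴿ x
≈-sym {x} {y} e = mk≈ᴿ λ ε h →
  let N , f = eventually-≈ e ε h
  in N , λ n k → ≡.subst (ℚ._< ε) (∣-∣-sym (seq x n) (seq y n)) (f n k)

≈-trans : ∀ {x y z} → x ≈ᴿ y → y ≈ᴿ z → x ≈ᴿ z
≈-trans p q = ≤-antisym (≤-trans (≈⇒≤ p) (≈⇒≤ q)) (≤-trans (≈⇒≤ (≈-sym q)) (≈⇒≤ (≈-sym p)))

+-mono-≤ : ∀ {x y u v} → x ≤ᴿ y → u ≤ᴿ v → x +ᴿ u ≤ᴿ y +ᴿ v
+-mono-≤ {x} {y} {u} {v} p q = mk≤ᴿ λ ε h →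
  both (λ {n} a b → ≡.subst (seq x n ℚ.+ seq u n ℚ.<_)
         (≡.trans (eq (seq y n) (seq v n) (½ ℚ.* ε)) (≡.cong (seq y n ℚ.+ seq v n ℚ.+_) (halves ε)))
         (ℚ.+-mono-< a b))
    (eventually-≤ p (½ ℚ.* ε) (half-pos h)) (eventually-≤ q (½ ℚ.* ε) (half-pos h))
  where
  eq : ∀ a b e → (a ℚ.+ e) ℚ.+ (b ℚ.+ e) ≡ a ℚ.+ b ℚ.+ (e ℚ.+ e)
  eq = solve 3 (λ a b e → (a :+ e) :+ (b :+ e) := a :+ b :+ (e :+ e)) ≡.refl
    where open ℚ-Solver

+-cong : ∀ {x y u v} → x ≈ᴿ y → u ≈ᴿ v → x +ᴿ u ≈ᴿ y +ᴿ v
+-cong p q = ≤-antisym (+-mono-≤ (≈⇒≤ p) (≈⇒≤ q)) (+-mono-≤ (≈⇒≤ (≈-sym p)) (≈⇒≤ (≈-sym q)))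

-‿cong : ∀ {x y} → x ≈ᴿ y → -ᴿ x ≈ᴿ -ᴿ y
-‿cong {x} {y} e = mk≈ᴿ λ ε h →
  let N , f = eventually-≈ (≈-sym e) ε h
  in N , λ n k → ≡.subst (λ q → ℚ.∣ q ∣ ℚ.< ε) (eq (seq x n) (seq y n)) (f n k)
  where
  eq : ∀ a b → b ℚ.- a ≡ ℚ.- a ℚ.- ℚ.- b
  eq = solve 2 (λ a b → b :- a := :- a :- (:- b)) ≡.refl
    where open ℚ-Solver

-- A Cauchy sequence `z` is eventually bounded by some `B`, so closeness of `x` and `y` within ε /
-- `B` is enough.
*-congʳ : ∀ {x y} z → x ≈ᴿ y → x *ᴿ z ≈ᴿ y *ᴿ z
*-congʳ {x} {y} z e = mk≈ᴿ λ ε h →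
  let B , B>0 , bounded = eventually-bounded (seq z) (cauchy z)
  in both (λ {n} a b → begin-strict
       ℚ.∣ seq x n ℚ.* seq z n ℚ.- seq y n ℚ.* seq z n ∣ ≡⟨ ≡.cong ℚ.∣_∣ (eq (seq x n) (seq y n) (seq z n)) ⟩
       ℚ.∣ seq z n ℚ.* (seq x n ℚ.- seq y n) ∣           ≡⟨ ℚ.∣p*q∣≡∣p∣*∣q∣ (seq z n) _ ⟩
       ℚ.∣ seq z n ∣ ℚ.* ℚ.∣ seq x n ℚ.- seq y n ∣
         ≤⟨ ℚ.*-monoʳ-≤-nonNeg _ {{ℚ.nonNegative (ℚ.0≤∣p∣ (seq x n ℚ.- seq y n))}} a ⟩
       B ℚ.* ℚ.∣ seq x n ℚ.- seq y n ∣                   <⟨ ℚ.*-monoʳ-<-pos B {{ℚ.positive B>0}} b ⟩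
       B ℚ.* (ε ÷⁺ B>0)                                  ≡⟨ ÷⁺-cancel ε B>0 ⟩
       ε                                                 ∎)
     bounded (eventually-≈ e (ε ÷⁺ B>0) (÷⁺-pos h B>0))
  where
  open ℚ.≤-Reasoning
  eq : ∀ a b c → a ℚ.* c ℚ.- b ℚ.* c ≡ c ℚ.* (a ℚ.- b)
  eq = solve 3 (λ a b c → a :* c :- b :* c := c :* (a :- b)) ≡.refl
    where open ℚ-Solver

*-comm : ∀ x y → x *ᴿ y ≈ᴿ y *ᴿ x
*-comm x y = pointwise λ n → ℚ.*-comm (seq x n) (seq y n)

*-cong : ∀ {x y u v} → x ≈ᴿ y → u ≈ᴿ v → x *ᴿ u ≈ᴿ y *ᴿ v
*-cong {x} {y} {u} {v} p q = ≈-trans (*-congʳ u p)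
  (≈-trans (*-comm y u) (≈-trans (*-congʳ y q) (*-comm v y)))

ℝ-isCommutativeRing : IsCommutativeRing _≈ᴿ_ _+ᴿ_ _*ᴿ_ -ᴿ_ 0ᴿ 1ᴿ
ℝ-isCommutativeRing = record
  { isRing = record
    { +-isAbelianGroup = record
      { isGroup = record
        { isMonoid = record
          { isSemigroup = record
            { isMagma = record
              { isEquivalence = record { refl = ≈-refl ; sym = ≈-sym ; trans = ≈-trans }
              ; ∙-cong = +-cong
              }
            ; assoc = λ x y z → pointwise λ n → ℚ.+-assoc (seq x n) (seq y n) (seq z n)
            }
          ; identity = (λ x → pointwise λ n → ℚ.+-identityˡ (seq x n)) , λ x → pointwise λ n → ℚ.+-identityʳ (seq x n)
          }
        ; inverse = (λ x → pointwise λ n → ℚ.+-inverseˡ (seq x n)) , λ x → pointwise λ n → ℚ.+-inverseʳ (seq x n)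
        ; ⁻¹-cong = -‿cong
        }
      ; comm = λ x y → pointwise λ n → ℚ.+-comm (seq x n) (seq y n)
      }
    ; *-cong = *-cong
    ; *-assoc = λ x y z → pointwise λ n → ℚ.*-assoc (seq x n) (seq y n) (seq z n)
    ; *-identity = (λ x → pointwise λ n → ℚ.*-identityˡ (seq x n)) , λ x → pointwise λ n → ℚ.*-identityʳ (seq x n)
    ; distrib = (λ x y z → pointwise λ n → ℚ.*-distribˡ-+ (seq x n) (seq y n) (seq z n))
              , λ x y z → pointwise λ n → ℚ.*-distribʳ-+ (seq x n) (seq y n) (seq z n)
    }
  ; *-comm = *-comm
  }

ℝ-commutativeRing : CommutativeRing 0ℓ 0ℓ
ℝ-commutativeRing = record { isCommutativeRing = ℝ-isCommutativeRing }

ℝ-almostCommutativeRing : ACR.AlmostCommutativeRing 0ℓ 0ℓ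
ℝ-almostCommutativeRing = ACR.fromCommutativeRing ℝ-commutativeRing

-- Equality of reals is undecidable, so the ring solver takes its coefficients from ℚ, where it can
-- be decided. Constants such as ½ may then occur in the identities it proves.
ℚ→ℝ-morphism : CommutativeRing.rawRing ℚ.+-*-commutativeRing ACR.-Raw-AlmostCommutative⟶ ℝ-almostCommutativeRing
ℚ→ℝ-morphism = record
  { ⟦_⟧    = ℚ→ℝ
  ; +-homo = λ _ _ → pointwise λ _ → ≡.refl
  ; *-homo = λ _ _ → pointwise λ _ → ≡.refl
  ; -‿homo = λ _ → pointwise λ _ → ≡.refl
  ; 0-homo = ≈-refl
  ; 1-homo = ≈-refl
  }

ℚ→ℝ-≟ : ∀ p q → Maybe (ℚ→ℝ p ≈ᴿ ℚ→ℝ q)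
ℚ→ℝ-≟ p q with p ℚ.≟ q
... | yes ≡.refl = just ≈-refl
... | no  _      = nothing

module ℝ-Solver =
  RingSolver (CommutativeRing.rawRing ℚ.+-*-commutativeRing) ℝ-almostCommutativeRing ℚ→ℝ-morphism ℚ→ℝ-≟

-- Real numbers: order

p<p+ε : ∀ p {ε} → 0ℚ ℚ.< ε → p ℚ.< p ℚ.+ ε
p<p+ε p {ε} h = ≡.subst (ℚ._< p ℚ.+ ε) (ℚ.+-identityʳ p) (ℚ.+-monoʳ-< p h)

≤⇒≯ : ∀ {x y} → x ≤ᴿ y → ¬ (y <ᴿ x)
≤⇒≯ p q = let _ , a , b = eventually-witness (both _,_ (eventually-≤ p (gap q) (gap-pos q)) (eventually-< q))
          in ℚ.<-asym a b

-- The Cauchy property does the work: if `x` exceeded `y` by ε at one late index, it would exceed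
-- `y` by ε/2 at all late indices, which is a witness of `y <ᴿ x`. Weak inequalities may therefore
-- be proved by refuting strict ones.
≮⇒≥ : ∀ {x y} → ¬ (y <ᴿ x) → x ≤ᴿ y
≮⇒≥ {x} {y} y≮x = mk≤ᴿ λ ε h →
  let δ = ½ ℚ.* ε
      δ>0 = half-pos h
      η = ½ ℚ.* δ
      η>0 = half-pos δ>0
      M , f = cauchy x η η>0
      N , g = cauchy y η η>0
      K = M ℕ.⊔ N
      M≤K = ℕ.m≤m⊔n M N
      N≤K = ℕ.m≤n⊔m M N
      x≈ : ∀ {n} → K ℕ.≤ n → ∀ {m} → K ℕ.≤ m → seq x m ℚ.< seq x n ℚ.+ η
      x≈ {n} k {m} l = ∣-∣<⇒< (seq x m) (seq x n) (f m n (ℕ.≤-trans M≤K l) (ℕ.≤-trans M≤K k))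
      y≈ : ∀ {n} → K ℕ.≤ n → ∀ {m} → K ℕ.≤ m → seq y m ℚ.< seq y n ℚ.+ η
      y≈ {n} k {m} l = ∣-∣<⇒< (seq y m) (seq y n) (g m n (ℕ.≤-trans N≤K l) (ℕ.≤-trans N≤K k))
  in K , λ n k → ℚ.≰⇒> λ far → y≮x $ mk<ᴿ δ δ>0 $ K , λ m l →
       ℚ.≰⇒> λ near → ℚ.<-irrefl ≡.refl $ begin-strict
         seq y n ℚ.+ ε                 ≤⟨ far ⟩
         seq x n                       <⟨ x≈ l k ⟩
         seq x m ℚ.+ η                 ≤⟨ ℚ.+-monoˡ-≤ η near ⟩
         seq y m ℚ.+ δ ℚ.+ η           <⟨ ℚ.+-monoˡ-< η (ℚ.+-monoˡ-< δ (y≈ k l)) ⟩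
         seq y n ℚ.+ η ℚ.+ δ ℚ.+ η     ≡⟨ eq (seq y n) η δ ⟩
         seq y n ℚ.+ (η ℚ.+ η ℚ.+ δ)   ≡⟨ ≡.cong (λ q → seq y n ℚ.+ (q ℚ.+ δ)) (halves δ) ⟩
         seq y n ℚ.+ (δ ℚ.+ δ)         ≡⟨ ≡.cong (seq y n ℚ.+_) (halves ε) ⟩
         seq y n ℚ.+ ε                 ∎
  where
  open ℚ.≤-Reasoning
  eq : ∀ a b c → a ℚ.+ b ℚ.+ c ℚ.+ b ≡ a ℚ.+ (b ℚ.+ b ℚ.+ c)
  eq = solve 3 (λ a b c → a :+ b :+ c :+ b := a :+ (b :+ b :+ c)) ≡.refl
    where open ℚ-Solver

+-cancelʳ-<ℚ : ∀ {p q} r → p ℚ.+ r ℚ.< q ℚ.+ r → p ℚ.< q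
+-cancelʳ-<ℚ r h = ℚ.≰⇒> λ q≤p → ℚ.<-irrefl ≡.refl (ℚ.<-≤-trans h (ℚ.+-monoˡ-≤ r q≤p))

-- Half of the gap survives; the other half pays for the tolerance in `y ≤ᴿ z`.
<-≤-trans : ∀ {x y z} → x <ᴿ y → y ≤ᴿ z → x <ᴿ z
<-≤-trans {x} {y} {z} (mk<ᴿ g g>0 p) q = mk<ᴿ (½ ℚ.* g) (half-pos g>0) $
  both (λ {n} a b → +-cancelʳ-<ℚ (½ ℚ.* g) (≡.subst (ℚ._< seq z n ℚ.+ ½ ℚ.* g)
         (≡.sym (+-halves (seq x n) g)) (ℚ.<-trans a b)))
    p (eventually-≤ q (½ ℚ.* g) (half-pos g>0))

≤-<-trans : ∀ {x y z} → x ≤ᴿ y → y <ᴿ z → x <ᴿ z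
≤-<-trans {x} {y} {z} q (mk<ᴿ g g>0 p) = mk<ᴿ (½ ℚ.* g) (half-pos g>0) $
  both (λ {n} a b → ℚ.<-trans (ℚ.+-monoˡ-< (½ ℚ.* g) b)
         (≡.subst (ℚ._< seq z n) (≡.sym (+-halves (seq y n) g)) a))
    p (eventually-≤ q (½ ℚ.* g) (half-pos g>0))

<⇒≤ : ∀ {x y} → x <ᴿ y → x ≤ᴿ y
<⇒≤ p = ≮⇒≥ λ q → let _ , a , b = eventually-witness (both _,_ (eventually-< p) (eventually-< q))
  in ℚ.<-asym (ℚ.<-trans (p<p+ε _ (gap-pos p)) a) (ℚ.<-trans (p<p+ε _ (gap-pos q)) b)

ℚ→ℝ-mono-≤ : ∀ {p q} → p ℚ.≤ q → ℚ→ℝ p ≤ᴿ ℚ→ℝ q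
ℚ→ℝ-mono-≤ h = pointwise-≤ λ _ → h

ℚ→ℝ-pos : ∀ {q} → 0ℚ ℚ.< q → 0ᴿ <ᴿ ℚ→ℝ q
ℚ→ℝ-pos {q} h = mk<ᴿ (½ ℚ.* q) (half-pos h) $ 0 , λ _ _ →
  ≡.subst₂ ℚ._<_ (≡.sym (ℚ.+-identityˡ (½ ℚ.* q))) (halves q)
    (≡.subst (ℚ._< ½ ℚ.* q ℚ.+ ½ ℚ.* q) (ℚ.+-identityʳ (½ ℚ.* q)) (ℚ.+-monoʳ-< (½ ℚ.* q) (half-pos h)))

-- Comparing x with y + ½ q at a late enough index decides which alternative holds.
<⊎≥ : ∀ x y {q} → 0ℚ ℚ.< q → x <ᴿ y +ᴿ ℚ→ℝ q ⊎ y ≤ᴿ x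
<⊎≥ x y {q} q>0 = decide (cauchy x η η>0) (cauchy y η η>0)
  where
  open ℚ.≤-Reasoning
  open ℚ-Solver
  η : ℚ
  η = ½ ℚ.* (½ ℚ.* (½ ℚ.* q))
  η>0 : 0ℚ ℚ.< η
  η>0 = half-pos (half-pos (half-pos q>0))
  eq₁ : ∀ a → a ℚ.+ η ℚ.+ ½ ℚ.* q ℚ.+ η ℚ.+ η ℚ.+ η ≡ a ℚ.+ q
  eq₁ a = solve 2 (λ a q → let η = con ½ :* (con ½ :* (con ½ :* q)) in
    a :+ η :+ con ½ :* q :+ η :+ η :+ η := a :+ q) ≡.refl a q
  eq₂ : ∀ a → a ℚ.+ ½ ℚ.* q ≡ a ℚ.+ η ℚ.+ η ℚ.+ η ℚ.+ η
  eq₂ a = solve 2 (λ a q → let η = con ½ :* (con ½ :* (con ½ :* q)) in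
    a :+ con ½ :* q := a :+ η :+ η :+ η :+ η) ≡.refl a q
  decide : ∃[ M ] (∀ m n → M ℕ.≤ m → M ℕ.≤ n → ℚ.∣ seq x m ℚ.- seq x n ∣ ℚ.< η) →
           ∃[ N ] (∀ m n → N ℕ.≤ m → N ℕ.≤ n → ℚ.∣ seq y m ℚ.- seq y n ∣ ℚ.< η) →
           x <ᴿ y +ᴿ ℚ→ℝ q ⊎ y ≤ᴿ x
  decide (M , f) (N , g) with seq x (M ℕ.⊔ N) ℚ.≤? seq y (M ℕ.⊔ N) ℚ.+ ½ ℚ.* q
  ... | yes near = inj₁ $ mk<ᴿ η η>0 $ K , λ n k → begin-strict
      seq x n ℚ.+ η
        <⟨ ℚ.+-monoˡ-< η (∣-∣<⇒< (seq x n) (seq x K) (f n K (ℕ.≤-trans M≤K k) M≤K)) ⟩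
      seq x K ℚ.+ η ℚ.+ η
        ≤⟨ ℚ.+-monoˡ-≤ η (ℚ.+-monoˡ-≤ η near) ⟩
      seq y K ℚ.+ ½ ℚ.* q ℚ.+ η ℚ.+ η
        <⟨ ℚ.+-monoˡ-< η (ℚ.+-monoˡ-< η (ℚ.+-monoˡ-< (½ ℚ.* q)
             (∣-∣<⇒< (seq y K) (seq y n) (g K n N≤K (ℕ.≤-trans N≤K k))))) ⟩
      seq y n ℚ.+ η ℚ.+ ½ ℚ.* q ℚ.+ η ℚ.+ η
        <⟨ p<p+ε _ η>0 ⟩
      seq y n ℚ.+ η ℚ.+ ½ ℚ.* q ℚ.+ η ℚ.+ η ℚ.+ η
        ≡⟨ eq₁ (seq y n) ⟩
      seq y n ℚ.+ q ∎
    where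
    K = M ℕ.⊔ N
    M≤K = ℕ.m≤m⊔n M N
    N≤K = ℕ.m≤n⊔m M N
  ... | no far = inj₂ $ ≮⇒≥ λ x<y →
    let L , h = eventually-< x<y
        n = K ℕ.⊔ L
        k = ℕ.m≤m⊔n K L
    in ℚ.<-irrefl ≡.refl $ begin-strict
      seq x K
        <⟨ ∣-∣<⇒< (seq x K) (seq x n) (f K n M≤K (ℕ.≤-trans M≤K k)) ⟩
      seq x n ℚ.+ η
        <⟨ ℚ.+-monoˡ-< η (ℚ.<-trans (p<p+ε (seq x n) (gap-pos x<y)) (h n (ℕ.m≤n⊔m K L))) ⟩
      seq y n ℚ.+ η
        <⟨ ℚ.+-monoˡ-< η (∣-∣<⇒< (seq y n) (seq y K) (g n K (ℕ.≤-trans N≤K k) N≤K)) ⟩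
      seq y K ℚ.+ η ℚ.+ η
        <⟨ ℚ.<-trans (p<p+ε _ η>0) (p<p+ε _ η>0) ⟩
      seq y K ℚ.+ η ℚ.+ η ℚ.+ η ℚ.+ η
        ≡⟨ ≡.sym (eq₂ (seq y K)) ⟩
      seq y K ℚ.+ ½ ℚ.* q
        <⟨ ℚ.≰⇒> far ⟩
      seq x K ∎
    where
    K = M ℕ.⊔ N
    M≤K = ℕ.m≤m⊔n M N
    N≤K = ℕ.m≤n⊔m M N

0<y-x⇒x<y : ∀ {x y} → 0ᴿ <ᴿ y -ᴿ x → x <ᴿ y
0<y-x⇒x<y {x} {y} (mk<ᴿ g g>0 (N , h)) = mk<ᴿ g g>0 $ N , λ n k →
  ≡.subst₂ ℚ._<_ (eq₁ (seq x n) g) (eq₂ (seq x n) (seq y n)) (ℚ.+-monoʳ-< (seq x n) (h n k))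
  where
  open ℚ-Solver
  eq₁ : ∀ a g → a ℚ.+ (0ℚ ℚ.+ g) ≡ a ℚ.+ g
  eq₁ = solve 2 (λ a g → a :+ (con 0ℚ :+ g) := a :+ g) ≡.refl
  eq₂ : ∀ a b → a ℚ.+ (b ℚ.- a) ≡ b
  eq₂ = solve 2 (λ a b → a :+ (b :- a) := b) ≡.refl

x<y⇒0<y-x : ∀ {x y} → x <ᴿ y → 0ᴿ <ᴿ y -ᴿ x
x<y⇒0<y-x {x} {y} (mk<ᴿ g g>0 (N , h)) = mk<ᴿ g g>0 $ N , λ n k →
  ≡.subst (ℚ._< seq y n ℚ.- seq x n) (eq (seq x n) g) (ℚ.+-monoˡ-< (ℚ.- seq x n) (h n k))
  where
  open ℚ-Solver
  eq : ∀ a g → a ℚ.+ g ℚ.- a ≡ 0ℚ ℚ.+ g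
  eq = solve 2 (λ a g → a :+ g :- a := con 0ℚ :+ g) ≡.refl

0<*0< : ∀ {x y} → 0ᴿ <ᴿ x → 0ᴿ <ᴿ y → 0ᴿ <ᴿ x *ᴿ y
0<*0< {x} {y} (mk<ᴿ g g>0 p) (mk<ᴿ h h>0 q) = mk<ᴿ (g ℚ.* h) (*-pos g>0 h>0) $
  both (λ {n} a b → ≡.subst (ℚ._< seq x n ℚ.* seq y n) (≡.sym (ℚ.+-identityˡ (g ℚ.* h)))
    (ℚ.<-trans (ℚ.*-monoʳ-<-pos g {{ℚ.positive g>0}} (≡.subst (ℚ._< seq y n) (ℚ.+-identityˡ h) b))
      (ℚ.*-monoˡ-<-pos (seq y n) {{ℚ.positive (ℚ.<-trans h>0 (≡.subst (ℚ._< seq y n) (ℚ.+-identityˡ h) b))}}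
         (≡.subst (ℚ._< seq x n) (ℚ.+-identityˡ g) a)))) p q

0≤² : ∀ x → 0ᴿ ≤ᴿ x *ᴿ x
0≤² x = pointwise-≤ λ n → square (seq x n)
  where
  square : ∀ q → 0ℚ ℚ.≤ q ℚ.* q
  square q with ℚ.≤-total 0ℚ q
  ... | inj₁ h = 0≤* h h
  ... | inj₂ h = ≡.subst (0ℚ ℚ.≤_) (solve 1 (λ q → (:- q) :* (:- q) := q :* q) ≡.refl q)
                   (0≤* (ℚ.neg-antimono-≤ h) (ℚ.neg-antimono-≤ h))
    where open ℚ-Solver

0≤+0≤ : ∀ {x y} → 0ᴿ ≤ᴿ x → 0ᴿ ≤ᴿ y → 0ᴿ ≤ᴿ x +ᴿ y
0≤+0≤ p q = ≤-trans (pointwise-≤ λ _ → ℚ.≤-refl) (+-mono-≤ p q)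

-- x y is the square of √ x √ y.
0≤*0≤ : ∀ {x y} → 0ᴿ ≤ᴿ x → 0ᴿ ≤ᴿ y → 0ᴿ ≤ᴿ x *ᴿ y
0≤*0≤ {x} {y} p q = ≤-trans (0≤² (√ᴿ x *ᴿ √ᴿ y)) $ ≈⇒≤ $ ≈-trans (eq (√ᴿ x) (√ᴿ y)) $
  *-cong (√ᴿ-square x p) (√ᴿ-square y q)
  where
  open ℝ-Solver
  eq : ∀ a b → (a *ᴿ b) *ᴿ (a *ᴿ b) ≈ᴿ (a *ᴿ a) *ᴿ (b *ᴿ b)
  eq = solve 2 (λ a b → (a :* b) :* (a :* b) := (a :* a) :* (b :* b)) ≈-refl

x≤y⇒0≤y-x : ∀ {x y} → x ≤ᴿ y → 0ᴿ ≤ᴿ y -ᴿ x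
x≤y⇒0≤y-x {x} {y} p = ≤-trans (≈⇒≤ (≈-sym (CommutativeRing.-‿inverseʳ ℝ-commutativeRing x))) (+-mono-≤ p ≤-refl)

0≤y-x⇒x≤y : ∀ {x y} → 0ᴿ ≤ᴿ y -ᴿ x → x ≤ᴿ y
0≤y-x⇒x≤y {x} {y} p = ≤-trans (≈⇒≤ (eq₁ x)) (≤-trans (+-mono-≤ p ≤-refl) (≈⇒≤ (eq₂ x y)))
  where
  open ℝ-Solver
  eq₁ : ∀ x → x ≈ᴿ 0ᴿ +ᴿ x
  eq₁ = solve 1 (λ x → x := con 0ℚ :+ x) ≈-refl
  eq₂ : ∀ x y → y -ᴿ x +ᴿ x ≈ᴿ y
  eq₂ = solve 2 (λ x y → y :- x :+ x := y) ≈-refl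

-- The standard way to prove an inequality below: exhibit the difference as a visibly nonnegative
-- expression and leave the identity to the ring solver.
≤-by : ∀ {x y d} → 0ᴿ ≤ᴿ d → d ≈ᴿ y -ᴿ x → x ≤ᴿ y
≤-by p e = 0≤y-x⇒x≤y (≤-trans p (≈⇒≤ e))

*-monoʳ-≤ : ∀ {x y} z → 0ᴿ ≤ᴿ z → x ≤ᴿ y → z *ᴿ x ≤ᴿ z *ᴿ y
*-monoʳ-≤ {x} {y} z p q = ≤-by (0≤*0≤ p (x≤y⇒0≤y-x q)) (eq x y z)
  where
  open ℝ-Solver
  eq : ∀ x y z → z *ᴿ (y -ᴿ x) ≈ᴿ z *ᴿ y -ᴿ z *ᴿ x
  eq = solve 3 (λ x y z → z :* (y :- x) := z :* y :- z :* x) ≈-refl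

*-cancel-0≤ : ∀ {x y} → 0ᴿ <ᴿ x → 0ᴿ ≤ᴿ x *ᴿ y → 0ᴿ ≤ᴿ y
*-cancel-0≤ {x} {y} p q = ≮⇒≥ λ y<0 → ≤⇒≯ q $
  0<y-x⇒x<y $ <-≤-trans (0<*0< p (x<y⇒0<y-x y<0)) (≈⇒≤ (eq x y))
  where
  open ℝ-Solver
  eq : ∀ x y → x *ᴿ (0ᴿ -ᴿ y) ≈ᴿ 0ᴿ -ᴿ x *ᴿ y
  eq = solve 2 (λ x y → x :* (con 0ℚ :- y) := con 0ℚ :- x :* y) ≈-refl

-- If `y <ᴿ x`, then x - y is positive, and so is x + y = (x - y) + 2y; their product x² - y²
-- contradicts the hypothesis. Applied to -x as well, this bounds |x|.
²-cancel-≤ : ∀ {x y} → 0ᴿ ≤ᴿ y → x *ᴿ x ≤ᴿ y *ᴿ y → x ≤ᴿ y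
²-cancel-≤ {x} {y} p q = ≮⇒≥ λ y<x → ≤⇒≯ q $ 0<y-x⇒x<y $
  <-≤-trans (0<*0< (x<y⇒0<y-x y<x) (<-≤-trans (x<y⇒0<y-x y<x) (≤-by (0≤+0≤ p p) (eq₁ x y)))) (≈⇒≤ (eq₂ x y))
  where
  open ℝ-Solver
  eq₁ : ∀ x y → y +ᴿ y ≈ᴿ x +ᴿ y -ᴿ (x -ᴿ y)
  eq₁ = solve 2 (λ x y → y :+ y := x :+ y :- (x :- y)) ≈-refl
  eq₂ : ∀ x y → (x -ᴿ y) *ᴿ (x +ᴿ y) ≈ᴿ x *ᴿ x -ᴿ y *ᴿ y
  eq₂ = solve 2 (λ x y → (x :- y) :* (x :+ y) := x :* x :- y :* y) ≈-refl

²-cancel-≈ : ∀ {x y} → 0ᴿ ≤ᴿ x → 0ᴿ ≤ᴿ y → x *ᴿ x ≈ᴿ y *ᴿ y → x ≈ᴿ y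
²-cancel-≈ p q e = ≤-antisym (²-cancel-≤ q (≈⇒≤ e)) (²-cancel-≤ p (≈⇒≤ (≈-sym e)))

√-unique : ∀ {x y} → 0ᴿ ≤ᴿ x → 0ᴿ ≤ᴿ y → y *ᴿ y ≈ᴿ x → √ᴿ x ≈ᴿ y
√-unique {x} p q e = ²-cancel-≈ (√ᴿ-nonNeg x) q (≈-trans (√ᴿ-square x p) (≈-sym e))

²≤0⇒≈0 : ∀ {x} → x *ᴿ x ≤ᴿ 0ᴿ → x ≈ᴿ 0ᴿ
²≤0⇒≈0 {x} p = ≤-antisym (²-cancel-≤ ≤-refl q) (≤-by (²-cancel-≤ ≤-refl (≤-trans (≈⇒≤ (eq₁ x)) q) ⟨≤⟩ eq₂ x) ≈-refl)
  where
  open ℝ-Solver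
  q : x *ᴿ x ≤ᴿ 0ᴿ *ᴿ 0ᴿ
  q = ≤-trans p (≈⇒≤ (pointwise λ _ → ≡.refl))
  eq₁ : ∀ x → -ᴿ x *ᴿ -ᴿ x ≈ᴿ x *ᴿ x
  eq₁ = solve 1 (λ x → :- x :* :- x := x :* x) ≈-refl
  eq₂ : ∀ x → 0ᴿ -ᴿ -ᴿ x ≈ᴿ x -ᴿ 0ᴿ
  eq₂ = solve 1 (λ x → con 0ℚ :- :- x := x :- con 0ℚ) ≈-refl
  _⟨≤⟩_ : ∀ {x y d} → x ≤ᴿ y → y -ᴿ x ≈ᴿ d → 0ᴿ ≤ᴿ d
  p ⟨≤⟩ e = ≤-trans (x≤y⇒0≤y-x p) (≈⇒≤ e)

-- Complex numbers

≈ᶜ-refl : ∀ {z} → z ≈ᶜ z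
≈ᶜ-refl = ≈-refl ,ᶜ ≈-refl

≈ᶜ-sym : ∀ {z w} → z ≈ᶜ w → w ≈ᶜ z
≈ᶜ-sym (p ,ᶜ q) = ≈-sym p ,ᶜ ≈-sym q

≈ᶜ-trans : ∀ {z w v} → z ≈ᶜ w → w ≈ᶜ v → z ≈ᶜ v
≈ᶜ-trans (p ,ᶜ q) (r ,ᶜ s) = ≈-trans p r ,ᶜ ≈-trans q s

+ᶜ-cong : ∀ {z w u v} → z ≈ᶜ w → u ≈ᶜ v → z +ᶜ u ≈ᶜ w +ᶜ v
+ᶜ-cong (p ,ᶜ q) (r ,ᶜ s) = +-cong p r ,ᶜ +-cong q s

*ᶜ-cong : ∀ {z w u v} → z ≈ᶜ w → u ≈ᶜ v → z *ᶜ u ≈ᶜ w *ᶜ v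
*ᶜ-cong (p ,ᶜ q) (r ,ᶜ s) =
  +-cong (*-cong p r) (-‿cong (*-cong q s)) ,ᶜ +-cong (*-cong p s) (*-cong q r)

ℂ-isCommutativeRing : IsCommutativeRing _≈ᶜ_ _+ᶜ_ _*ᶜ_ -ᶜ_ 0ᶜ 1ᶜ
ℂ-isCommutativeRing = record
  { isRing = record
    { +-isAbelianGroup = record
      { isGroup = record
        { isMonoid = record
          { isSemigroup = record
            { isMagma = record
              { isEquivalence = record { refl = ≈ᶜ-refl ; sym = ≈ᶜ-sym ; trans = ≈ᶜ-trans }
              ; ∙-cong = +ᶜ-cong
              }
            ; assoc = λ { (a +i b) (c +i d) (e +i f) → R.+-assoc a c e ,ᶜ R.+-assoc b d f }
            }
          ; identity = (λ { (a +i b) → R.+-identityˡ a ,ᶜ R.+-identityˡ b })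
                     , λ { (a +i b) → R.+-identityʳ a ,ᶜ R.+-identityʳ b }
          }
        ; inverse = (λ { (a +i b) → R.-‿inverseˡ a ,ᶜ R.-‿inverseˡ b })
                  , λ { (a +i b) → R.-‿inverseʳ a ,ᶜ R.-‿inverseʳ b }
        ; ⁻¹-cong = λ { (p ,ᶜ q) → -‿cong p ,ᶜ -‿cong q }
        }
      ; comm = λ { (a +i b) (c +i d) → R.+-comm a c ,ᶜ R.+-comm b d }
      }
    ; *-cong = *ᶜ-cong
    ; *-assoc = λ { (a +i b) (c +i d) (e +i f) →
          solve 6 (λ a b c d e f → (a :* c :- b :* d) :* e :- (a :* d :+ b :* c) :* f :=
                                   a :* (c :* e :- d :* f) :- b :* (c :* f :+ d :* e)) ≈-refl a b c d e f
       ,ᶜ solve 6 (λ a b c d e f → (a :* c :- b :* d) :* f :+ (a :* d :+ b :* c) :* e :=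
                                   a :* (c :* f :+ d :* e) :+ b :* (c :* e :- d :* f)) ≈-refl a b c d e f }
    ; *-identity =
        (λ { (a +i b) → solve 2 (λ a b → con 1ℚ :* a :- con 0ℚ :* b := a) ≈-refl a b
                     ,ᶜ solve 2 (λ a b → con 1ℚ :* b :+ con 0ℚ :* a := b) ≈-refl a b })
      , λ { (a +i b) → solve 2 (λ a b → a :* con 1ℚ :- b :* con 0ℚ := a) ≈-refl a b
                    ,ᶜ solve 2 (λ a b → a :* con 0ℚ :+ b :* con 1ℚ := b) ≈-refl a b }
    ; distrib =
        (λ { (a +i b) (c +i d) (e +i f) →
             solve 6 (λ a b c d e f → a :* (c :+ e) :- b :* (d :+ f) :=
                       a :* c :- b :* d :+ (a :* e :- b :* f)) ≈-refl a b c d e f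
          ,ᶜ solve 6 (λ a b c d e f → a :* (d :+ f) :+ b :* (c :+ e) :=
                       a :* d :+ b :* c :+ (a :* f :+ b :* e)) ≈-refl a b c d e f })
      , λ { (a +i b) (c +i d) (e +i f) →
             solve 6 (λ a b c d e f → (c :+ e) :* a :- (d :+ f) :* b :=
                       c :* a :- d :* b :+ (e :* a :- f :* b)) ≈-refl a b c d e f
          ,ᶜ solve 6 (λ a b c d e f → (c :+ e) :* b :+ (d :+ f) :* a :=
                       c :* b :+ d :* a :+ (e :* b :+ f :* a)) ≈-refl a b c d e f }
    }
  ; *-comm = λ { (a +i b) (c +i d) →
        solve 4 (λ a b c d → a :* c :- b :* d := c :* a :- d :* b) ≈-refl a b c d
     ,ᶜ solve 4 (λ a b c d → a :* d :+ b :* c := c :* b :+ d :* a) ≈-refl a b c d }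
  }
  where
  open ℝ-Solver
  module R = CommutativeRing ℝ-commutativeRing

ℂ-commutativeRing : CommutativeRing 0ℓ 0ℓ
ℂ-commutativeRing = record { isCommutativeRing = ℂ-isCommutativeRing }

ℂ-almostCommutativeRing : ACR.AlmostCommutativeRing 0ℓ 0ℓ
ℂ-almostCommutativeRing = ACR.fromCommutativeRing ℂ-commutativeRing

ι : ℝ → ℂ
ι x = x +i 0ᴿ

ι-cong : ∀ {x y} → x ≈ᴿ y → ι x ≈ᶜ ι y
ι-cong p = p ,ᶜ ≈-refl

ι-* : ∀ x y → ι (x *ᴿ y) ≈ᶜ ι x *ᶜ ι y
ι-* x y = solve 2 (λ x y → x :* y := x :* y :- con 0ℚ :* con 0ℚ) ≈-refl x y
       ,ᶜ solve 2 (λ x y → con 0ℚ := x :* con 0ℚ :+ con 0ℚ :* y) ≈-refl x y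
  where open ℝ-Solver

ι-- : ∀ x y → ι (x -ᴿ y) ≈ᶜ ι x -ᶜ ι y
ι-- x y = ≈-refl ,ᶜ pointwise λ _ → ≡.refl

ℚ→ℂ : ℚ → ℂ
ℚ→ℂ q = ι (ℚ→ℝ q)

ℚ→ℂ-morphism : CommutativeRing.rawRing ℚ.+-*-commutativeRing ACR.-Raw-AlmostCommutative⟶ ℂ-almostCommutativeRing
ℚ→ℂ-morphism = record
  { ⟦_⟧    = ℚ→ℂ
  ; +-homo = λ _ _ → (pointwise λ _ → ≡.refl) ,ᶜ pointwise λ _ → ≡.refl
  ; *-homo = λ p q → ≈ᶜ-trans (ι-cong (pointwise λ _ → ≡.refl)) (ι-* (ℚ→ℝ p) (ℚ→ℝ q))
  ; -‿homo = λ _ → (pointwise λ _ → ≡.refl) ,ᶜ pointwise λ _ → ≡.refl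
  ; 0-homo = ≈ᶜ-refl
  ; 1-homo = ≈ᶜ-refl
  }

ℚ→ℂ-≟ : ∀ p q → Maybe (ℚ→ℂ p ≈ᶜ ℚ→ℂ q)
ℚ→ℂ-≟ p q with p ℚ.≟ q
... | yes ≡.refl = just ≈ᶜ-refl
... | no  _      = nothing

module ℂ-Solver =
  RingSolver (CommutativeRing.rawRing ℚ.+-*-commutativeRing) ℂ-almostCommutativeRing ℚ→ℂ-morphism ℚ→ℂ-≟

-- The recurrence for F

duplicateFirst incrementFirst : List ℕ → List ℕ
duplicateFirst []       = []
duplicateFirst (p ∷ ps) = p ∷ p ∷ ps
incrementFirst []       = []
incrementFirst (p ∷ ps) = suc p ∷ ps

-- The partitions with largest hook length n + 1.
hookPartitions : ℕ → List (List ℕ)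
hookPartitions zero    = (1 ∷ []) ∷ []
hookPartitions (suc n) = map duplicateFirst (hookPartitions n) ++ map incrementFirst (hookPartitions n)

duplicateFirst-injective : ∀ {ps qs} → duplicateFirst ps ≡ duplicateFirst qs → ps ≡ qs
duplicateFirst-injective {[]}    {[]}    _      = ≡.refl
duplicateFirst-injective {_ ∷ _} {_ ∷ _} ≡.refl = ≡.refl

incrementFirst-injective : ∀ {ps qs} → incrementFirst ps ≡ incrementFirst qs → ps ≡ qs
incrementFirst-injective {[]}    {[]}    _      = ≡.refl
incrementFirst-injective {_ ∷ _} {_ ∷ _} ≡.refl = ≡.refl

largestPart-first : ∀ p ps → IsPartition (p ∷ ps) → largestPart (p ∷ ps) ≡ p
largestPart-first p []       _                 = ℕ.⊔-identityʳ p
largestPart-first p (q ∷ ps) (_ ∷ a , q≤p ∷ l) =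
  ≡.trans (≡.cong (p ℕ.⊔_) (largestPart-first q ps (a , l))) (ℕ.m≥n⇒m⊔n≡m q≤p)

largestHook-first : ∀ p ps → IsPartition (p ∷ ps) → largestHook (p ∷ ps) ≡ p ℕ.+ length ps
largestHook-first p ps h = ≡.trans
  (≡.cong (λ k → k ℕ.+ suc (length ps) ℕ.∸ 1) (largestPart-first p ps h))
  (≡.cong (ℕ._∸ 1) (ℕ.+-suc p (length ps)))

-- For a partition p ∷ ps the largest hook length is p plus the number of remaining parts. This form
-- avoids the maximum and the truncated subtraction in `largestHook` and exposes the first part.
data FirstHook (n : ℕ) : List ℕ → Set where
  firstHook : ∀ {p ps} → IsPartition (p ∷ ps) → p ℕ.+ length ps ≡ n → FirstHook n (p ∷ ps)

firstHook⇔ : ∀ n ps → FirstHook (suc n) ps ⇔ (IsPartition ps × largestHook ps ≡ suc n)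
firstHook⇔ n ps = mk⇔
  (λ { (firstHook {p} {ps} h e) → h , ≡.trans (largestHook-first p ps h) e })
  (from ps)
  where
  from : ∀ ps → IsPartition ps × largestHook ps ≡ suc n → FirstHook (suc n) ps
  from (p ∷ ps) (h , e) = firstHook h (≡.trans (≡.sym (largestHook-first p ps h)) e)

duplicateFirst-hook : ∀ {n ps} → FirstHook n ps → FirstHook (suc n) (duplicateFirst ps)
duplicateFirst-hook (firstHook {p} {ps} (h ∷ a , l) e) =
  firstHook (h ∷ h ∷ a , ℕ.≤-refl ∷ l) (≡.trans (ℕ.+-suc p (length ps)) (≡.cong suc e))

incrementFirst-hook : ∀ {n ps} → FirstHook n ps → FirstHook (suc n) (incrementFirst ps)
incrementFirst-hook (firstHook (h ∷ a , l) e) = firstHook (s≤s z≤n ∷ a , relax l) (≡.cong suc e)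
  where
  relax : ∀ {p ps} → Linked ℕ._≥_ (p ∷ ps) → Linked ℕ._≥_ (suc p ∷ ps)
  relax [-]     = [-]
  relax (h ∷ l) = ℕ.m≤n⇒m≤1+n h ∷ l

hookPartitions-sound : ∀ n {ps} → ps ∈ hookPartitions n → FirstHook (suc n) ps
hookPartitions-sound zero    (here ≡.refl) = firstHook (s≤s z≤n ∷ [] , [-]) ≡.refl
hookPartitions-sound (suc n) h with ∈-++⁻ (map duplicateFirst (hookPartitions n)) h
... | inj₁ k with _ , l , ≡.refl ← ∈-map⁻ duplicateFirst k = duplicateFirst-hook (hookPartitions-sound n l)
... | inj₂ k with _ , l , ≡.refl ← ∈-map⁻ incrementFirst k = incrementFirst-hook (hookPartitions-sound n l)

-- Inverts the construction: if the second part equals the first, one copy is removed; otherwise the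
-- first part is larger, or stands alone, and is decremented. Only the partition 1 ∷ [] has no
-- predecessor.
hookPartitions-complete : ∀ n {ps} → FirstHook (suc n) ps → ps ∈ hookPartitions n
hookPartitions-complete _    (firstHook {zero} (() ∷ _ , _) _)
hookPartitions-complete zero (firstHook {suc (suc _)} {[]} h ())
hookPartitions-complete zero (firstHook {suc zero} {[]} h e) = here ≡.refl
hookPartitions-complete (suc n) (firstHook {suc zero} {[]} h ())
hookPartitions-complete (suc n) (firstHook {suc (suc p)} {[]} h e) =
  ∈-++⁺ʳ (map duplicateFirst (hookPartitions n)) $ ∈-map⁺ incrementFirst $ hookPartitions-complete n $
    firstHook (s≤s z≤n ∷ [] , [-]) (ℕ.suc-injective e)
hookPartitions-complete zero (firstHook {suc p} {_ ∷ qs} h e) =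
  contradiction (≡.trans (≡.sym (ℕ.+-suc p (length qs))) (ℕ.suc-injective e)) λ ()
hookPartitions-complete (suc n) (firstHook {suc p} {q ∷ qs} (h ∷ k ∷ a , q≤p ∷ l) e) with q ℕ.≟ suc p
... | yes ≡.refl = ∈-++⁺ˡ $ ∈-map⁺ duplicateFirst $ hookPartitions-complete n $
  firstHook (k ∷ a , l) (≡.trans (≡.sym (ℕ.+-suc p (length qs))) (ℕ.suc-injective e))
... | no q≢p = ∈-++⁺ʳ (map duplicateFirst (hookPartitions n)) $ ∈-map⁺ incrementFirst $ hookPartitions-complete n $
  firstHook (ℕ.≤-trans k q≤p′ ∷ k ∷ a , q≤p′ ∷ l) (ℕ.suc-injective e)
  where q≤p′ = ℕ.≤-pred (ℕ.≤∧≢⇒< q≤p q≢p)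

hookPartitions-unique : ∀ n → Unique (hookPartitions n)
hookPartitions-unique zero    = [] ∷ []
hookPartitions-unique (suc n) = Unique.++⁺
  (Unique.map⁺ duplicateFirst-injective (hookPartitions-unique n))
  (Unique.map⁺ incrementFirst-injective (hookPartitions-unique n)) λ (d , i) →
    let ps , k , e = ∈-map⁻ duplicateFirst d
        qs , l , f = ∈-map⁻ incrementFirst i
    in disjoint (hookPartitions-sound n k) (hookPartitions-sound n l) (≡.trans (≡.sym e) f)
  where
  -- Duplication makes the first two parts equal, whereas incrementing makes the first part strictly
  -- larger than the second.
  disjoint : ∀ {m n ps qs} → FirstHook m ps → FirstHook n qs → duplicateFirst ps ≡ incrementFirst qs → ⊥
  disjoint (firstHook _ _) (firstHook (_ , p≤q ∷ _) _) ≡.refl = ℕ.<-irrefl ≡.refl p≤q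

-- Both lists are free of duplicates and have the same members, so they agree up to order.
partitions↭ : ∀ n → partitions (suc n) ↭ hookPartitions n
partitions↭ n = ∼bag⇒↭ $ unique∧set⇒bag (partitions-unique (suc n)) (hookPartitions-unique n) $ λ {ps} → mk⇔
  (hookPartitions-complete n ∘ Equivalence.from (firstHook⇔ n ps) ∘ Equivalence.to (∈-partitions (suc n) ps))
  (Equivalence.from (∈-partitions (suc n) ps) ∘ Equivalence.to (firstHook⇔ n ps) ∘ hookPartitions-sound n)

-- Finite complex sums and counting by a statistic

≈ᶜ-reflexive : ∀ {z w} → z ≡ w → z ≈ᶜ w
≈ᶜ-reflexive ≡.refl = ≈ᶜ-refl

∑ : {X : Set} → (X → ℂ) → List X → ℂ
∑ f = foldr (λ x z → f x +ᶜ z) 0ᶜ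

module _ {X : Set} where

  ∑-++ : ∀ (f : X → ℂ) xs ys → ∑ f (xs ++ ys) ≈ᶜ ∑ f xs +ᶜ ∑ f ys
  ∑-++ f []       ys = solve 1 (λ s → s := con 0ℚ :+ s) ≈ᶜ-refl (∑ f ys)
    where open ℂ-Solver
  ∑-++ f (x ∷ xs) ys = ≈ᶜ-trans (+ᶜ-cong ≈ᶜ-refl (∑-++ f xs ys))
    (solve 3 (λ a s t → a :+ (s :+ t) := a :+ s :+ t) ≈ᶜ-refl (f x) (∑ f xs) (∑ f ys))
    where open ℂ-Solver

  ∑-↭ : ∀ (f : X → ℂ) {xs ys} → xs ↭ ys → ∑ f xs ≈ᶜ ∑ f ys
  ∑-↭ f Perm.refl        = ≈ᶜ-refl
  ∑-↭ f (Perm.prep x p)  = +ᶜ-cong ≈ᶜ-refl (∑-↭ f p)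
  ∑-↭ f (Perm.swap {xs} {ys} x y p) = ≈ᶜ-trans
    (solve 3 (λ a b s → a :+ (b :+ s) := b :+ (a :+ s)) ≈ᶜ-refl (f x) (f y) (∑ f xs))
    (+ᶜ-cong ≈ᶜ-refl (+ᶜ-cong ≈ᶜ-refl (∑-↭ f p)))
    where open ℂ-Solver
  ∑-↭ f (Perm.trans p q) = ≈ᶜ-trans (∑-↭ f p) (∑-↭ f q)

  ∑-linear : ∀ c (f g h : X → ℂ) xs → All (λ x → f x ≈ᶜ c *ᶜ g x +ᶜ h x) xs → ∑ f xs ≈ᶜ c *ᶜ ∑ g xs +ᶜ ∑ h xs
  ∑-linear c f g h []       []       = solve 1 (λ c → con 0ℚ := c :* con 0ℚ :+ con 0ℚ) ≈ᶜ-refl c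
    where open ℂ-Solver
  ∑-linear c f g h (x ∷ xs) (e ∷ es) = ≈ᶜ-trans (+ᶜ-cong e (∑-linear c f g h xs es))
    (solve 5 (λ c a s b t → (c :* a :+ b) :+ (c :* s :+ t) := c :* (a :+ s) :+ (b :+ t)) ≈ᶜ-refl
      c (g x) (∑ g xs) (h x) (∑ h xs))
    where open ℂ-Solver

  ∑-cong : ∀ {f g : X → ℂ} xs → (∀ x → f x ≡ g x) → ∑ f xs ≈ᶜ ∑ g xs
  ∑-cong []       e = ≈ᶜ-refl
  ∑-cong (x ∷ xs) e = +ᶜ-cong (≈ᶜ-reflexive (e x)) (∑-cong xs e)

  ∑-map : ∀ {Y : Set} (f : X → ℂ) (g : Y → X) ys → ∑ f (map g ys) ≈ᶜ ∑ (f ∘ g) ys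
  ∑-map f g []       = ≈ᶜ-refl
  ∑-map f g (y ∷ ys) = +ᶜ-cong ≈ᶜ-refl (∑-map f g ys)

∑≤-+ : ∀ n f g → ∑≤ n (λ m → f m +ᶜ g m) ≈ᶜ ∑≤ n f +ᶜ ∑≤ n g
∑≤-+ zero    f g = ≈ᶜ-refl
∑≤-+ (suc n) f g = ≈ᶜ-trans (+ᶜ-cong (∑≤-+ n f g) ≈ᶜ-refl)
  (solve 4 (λ s t a b → (s :+ t) :+ (a :+ b) := (s :+ a) :+ (t :+ b)) ≈ᶜ-refl
    (∑≤ n f) (∑≤ n g) (f (suc n)) (g (suc n)))
  where open ℂ-Solver

∑≤-cong : ∀ n {f g} → (∀ m → f m ≈ᶜ g m) → ∑≤ n f ≈ᶜ ∑≤ n g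
∑≤-cong zero    e = e zero
∑≤-cong (suc n) e = +ᶜ-cong (∑≤-cong n e) (e (suc n))

∑≤-zero : ∀ n {f} → (∀ m → m ℕ.≤ n → f m ≈ᶜ 0ᶜ) → ∑≤ n f ≈ᶜ 0ᶜ
∑≤-zero zero    e = e zero z≤n
∑≤-zero (suc n) e = ≈ᶜ-trans (+ᶜ-cong (∑≤-zero n λ m h → e m (ℕ.m≤n⇒m≤1+n h)) (e (suc n) ℕ.≤-refl))
  (CommutativeRing.+-identityˡ ℂ-commutativeRing 0ᶜ)

∑≤-single : ∀ n k f → k ℕ.≤ n → (∀ m → m ≢ k → f m ≈ᶜ 0ᶜ) → ∑≤ n f ≈ᶜ f k
∑≤-single zero    zero f z≤n e = ≈ᶜ-refl
∑≤-single (suc n) k    f k≤n e with k ℕ.≟ suc n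
... | yes ≡.refl = ≈ᶜ-trans (+ᶜ-cong (∑≤-zero n λ m h → e m (ℕ.<⇒≢ (s≤s h))) ≈ᶜ-refl)
  (CommutativeRing.+-identityˡ ℂ-commutativeRing (f (suc n)))
... | no k≢      = ≈ᶜ-trans (+ᶜ-cong (∑≤-single n k f (ℕ.≤-pred (ℕ.≤∧≢⇒< k≤n k≢)) e) (e (suc n) (k≢ ∘ ≡.sym)))
  (CommutativeRing.+-identityʳ ℂ-commutativeRing (f k))

ℕ→ℂ-suc : ∀ k → ℕ→ℂ (suc k) ≈ᶜ 1ᶜ +ᶜ ℕ→ℂ k
ℕ→ℂ-suc k = pointwise (λ _ → e) ,ᶜ pointwise λ _ → ≡.refl
  where
  e′ : ℚᵘ.mkℚᵘ (+ suc k) 0 ℚᵘ.≃ ℚᵘ.1ℚᵘ ℚᵘ.+ ℚᵘ.mkℚᵘ (+ k) 0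
  e′ = ℚᵘ.*≡* (≡.cong (ℤ._* + 1) (≡.cong (λ i → + 1 ℤ.+ i) (≡.sym (ℤ.*-identityʳ (+ k)))))
  e : + suc k ℚ./ 1 ≡ 1ℚ ℚ.+ + k ℚ./ 1
  e = ℚ.toℚᵘ-injective $ ℚᵘ.≃-trans (ℚ.toℚᵘ-fromℚᵘ (ℚᵘ.mkℚᵘ (+ suc k) 0)) $ ℚᵘ.≃-sym $
    ℚᵘ.≃-trans (ℚ.toℚᵘ-homo-+ 1ℚ (+ k ℚ./ 1)) $
    ℚᵘ.≃-trans (ℚᵘ.+-congʳ ℚᵘ.1ℚᵘ (ℚ.toℚᵘ-fromℚᵘ (ℚᵘ.mkℚᵘ (+ k) 0))) $
    ℚᵘ.≃-sym e′

-- Induction on the list: the head `x` raises the count at m = s x only, so it contributes the delta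
-- function `δ`, whose sum collapses to g (s x) because s x ≤ n lies in the range.
∑-by-statistic : ∀ {X : Set} (s : X → ℕ) n (g : ℕ → ℂ) xs → All (λ x → s x ℕ.≤ n) xs →
  ∑≤ n (λ m → ℕ→ℂ (length (filter (λ x → s x ℕ.≟ m) xs)) *ᶜ g m) ≈ᶜ ∑ (g ∘ s) xs
∑-by-statistic s n g []       []       = ∑≤-zero n λ m _ → CommutativeRing.zeroˡ ℂ-commutativeRing (g m)
∑-by-statistic {X} s n g (x ∷ xs) (h ∷ hs) = ≈ᶜ-trans (∑≤-cong n split) $
  ≈ᶜ-trans (∑≤-+ n δ (λ m → ℕ→ℂ (count m xs) *ᶜ g m)) $
  +ᶜ-cong (≈ᶜ-trans (∑≤-single n (s x) δ h δ-zero) δ-one) (∑-by-statistic s n g xs hs)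
  where
  open ℂ-Solver
  count : ℕ → List X → ℕ
  count m ys = length (filter (λ y → s y ℕ.≟ m) ys)
  indicator : ∀ {m} → Dec (s x ≡ m) → ℂ
  indicator {m} (yes _) = g m
  indicator     (no _)  = 0ᶜ
  δ : ℕ → ℂ
  δ m = indicator (s x ℕ.≟ m)
  split : ∀ m → ℕ→ℂ (count m (x ∷ xs)) *ᶜ g m ≈ᶜ δ m +ᶜ ℕ→ℂ (count m xs) *ᶜ g m
  split m = by (s x ℕ.≟ m)
    where
    by : (d : Dec (s x ≡ m)) → ℕ→ℂ (count m (x ∷ xs)) *ᶜ g m ≈ᶜ indicator d +ᶜ ℕ→ℂ (count m xs) *ᶜ g m
    by (yes e) = ≈ᶜ-trans
      (*ᶜ-cong (≈ᶜ-trans (≈ᶜ-reflexive (≡.cong (ℕ→ℂ ∘ length) (filter-accept (λ y → s y ℕ.≟ m) e)))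
                         (ℕ→ℂ-suc (count m xs))) ≈ᶜ-refl)
      (solve 2 (λ k a → (con 1ℚ :+ k) :* a := a :+ k :* a) ≈ᶜ-refl (ℕ→ℂ (count m xs)) (g m))
    by (no e)  = ≈ᶜ-trans
      (*ᶜ-cong (≈ᶜ-reflexive (≡.cong (ℕ→ℂ ∘ length) (filter-reject (λ y → s y ℕ.≟ m) e))) ≈ᶜ-refl)
      (solve 1 (λ a → a := con 0ℚ :+ a) ≈ᶜ-refl (ℕ→ℂ (count m xs) *ᶜ g m))
  δ-zero : ∀ m → m ≢ s x → δ m ≈ᶜ 0ᶜ
  δ-zero m ne with s x ℕ.≟ m
  ... | yes e = contradiction (≡.sym e) ne
  ... | no  _ = ≈ᶜ-refl
  δ-one : δ (s x) ≈ᶜ g (s x)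
  δ-one with s x ℕ.≟ s x
  ... | yes _ = ≈ᶜ-refl
  ... | no ne = contradiction ≡.refl ne

F-∑ : ∀ n z → F (suc n) z ≈ᶜ ∑ (λ ps → z ^ᶜ evenParts ps) (hookPartitions n)
F-∑ n z = ≈ᶜ-trans
  (∑-by-statistic evenParts (suc n) (z ^ᶜ_) (partitions (suc n)) (All.tabulate bound))
  (∑-↭ (λ ps → z ^ᶜ evenParts ps) (partitions↭ n))
  where
  bound : ∀ {ps} → ps ∈ partitions (suc n) → evenParts ps ℕ.≤ suc n
  bound {ps} h with (ps>0 , _) , e ← Equivalence.to (∈-partitions (suc n) ps) h =
    ℕ.≤-trans (length-filter (2 ∣?_) ps) (≡.subst (length ps ℕ.≤_) e (length≤hook ps ps>0))

-- Σ z^(even parts other than the first), over the partitions with even, respectively odd, first part.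
evenFirst oddFirst : ℂ → List ℕ → ℂ
evenFirst z []       = 0ᶜ
evenFirst z (p ∷ ps) = if does (2 ∣? p) then z ^ᶜ evenParts ps else 0ᶜ
oddFirst z []        = 0ᶜ
oddFirst z (p ∷ ps)  = if does (2 ∣? p) then 0ᶜ else z ^ᶜ evenParts ps

2∣suc : ∀ p → ¬ (2 ∣ p) → 2 ∣ suc p
2∣suc zero          h = contradiction (divides 0 ≡.refl) h
2∣suc (suc zero)    h = divides 1 ≡.refl
2∣suc (suc (suc p)) h with divides q e ← 2∣suc p (λ { (divides q e) → h (divides (suc q) (≡.cong (2 ℕ.+_) e)) }) =
  divides (suc q) (≡.cong (2 ℕ.+_) e)

¬2∣suc : ∀ p → 2 ∣ p → ¬ (2 ∣ suc p)
¬2∣suc p h k = ℕ.<-irrefl ≡.refl (∣⇒≤ (∣m+n∣m⇒∣n (≡.subst (2 ∣_) (ℕ.+-comm 1 p) k) h))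

nonempty : ∀ {n ps} → FirstHook n ps → ps ≢ []
nonempty (firstHook _ _) ()

module _ (z : ℂ) {p : ℕ} (ps : List ℕ) where

  evenFirst-even : 2 ∣ p → evenFirst z (p ∷ ps) ≡ z ^ᶜ evenParts ps
  evenFirst-even h = ≡.cong (if_then z ^ᶜ evenParts ps else 0ᶜ) (dec-true (2 ∣? p) h)

  evenFirst-odd : ¬ (2 ∣ p) → evenFirst z (p ∷ ps) ≡ 0ᶜ
  evenFirst-odd h = ≡.cong (if_then z ^ᶜ evenParts ps else 0ᶜ) (dec-false (2 ∣? p) h)

  oddFirst-even : 2 ∣ p → oddFirst z (p ∷ ps) ≡ 0ᶜ
  oddFirst-even h = ≡.cong (if_then 0ᶜ else z ^ᶜ evenParts ps) (dec-true (2 ∣? p) h)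

  oddFirst-odd : ¬ (2 ∣ p) → oddFirst z (p ∷ ps) ≡ z ^ᶜ evenParts ps
  oddFirst-odd h = ≡.cong (if_then 0ᶜ else z ^ᶜ evenParts ps) (dec-false (2 ∣? p) h)

  weight-even : 2 ∣ p → z ^ᶜ evenParts (p ∷ ps) ≡ z *ᶜ z ^ᶜ evenParts ps
  weight-even h = ≡.cong (λ qs → z ^ᶜ length qs) (filter-accept (2 ∣?_) h)

  weight-odd : ¬ (2 ∣ p) → z ^ᶜ evenParts (p ∷ ps) ≡ z ^ᶜ evenParts ps
  weight-odd h = ≡.cong (λ qs → z ^ᶜ length qs) (filter-reject (2 ∣?_) h)

-- The weight counts the first part while `evenFirst` and `oddFirst` omit it; an even first part
-- supplies the missing factor `z`.
weight-split : ∀ z ps → ps ≢ [] → z ^ᶜ evenParts ps ≈ᶜ z *ᶜ evenFirst z ps +ᶜ oddFirst z ps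
weight-split z []       h = contradiction ≡.refl h
weight-split z (p ∷ ps) _ = case 2 ∣? p of λ where
    (yes h) → ≡.subst₂ _≈ᶜ_ (≡.sym (weight-even z ps h))
      (≡.sym (≡.cong₂ (λ e o → z *ᶜ e +ᶜ o) (evenFirst-even z ps h) (oddFirst-even z ps h)))
      (solve 2 (λ z w → z :* w := z :* w :+ con 0ℚ) ≈ᶜ-refl z (z ^ᶜ evenParts ps))
    (no h)  → ≡.subst₂ _≈ᶜ_ (≡.sym (weight-odd z ps h))
      (≡.sym (≡.cong₂ (λ e o → z *ᶜ e +ᶜ o) (evenFirst-odd z ps h) (oddFirst-odd z ps h)))
      (solve 2 (λ z w → w := z :* con 0ℚ :+ w) ≈ᶜ-refl z (z ^ᶜ evenParts ps))
  where open ℂ-Solver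

-- A copy of the first part enters the counted tail and gives a factor `z` when it is even. The
-- summand `0ᶜ` fits the shape asked for by `∑-linear`.
evenFirst-duplicate : ∀ z ps → evenFirst z (duplicateFirst ps) ≈ᶜ z *ᶜ evenFirst z ps +ᶜ 0ᶜ
evenFirst-duplicate z []       = solve 1 (λ z → con 0ℚ := z :* con 0ℚ :+ con 0ℚ) ≈ᶜ-refl z
  where open ℂ-Solver
evenFirst-duplicate z (p ∷ ps) = case 2 ∣? p of λ where
    (yes h) → ≡.subst₂ _≈ᶜ_ (≡.sym (≡.trans (evenFirst-even z (p ∷ ps) h) (weight-even z ps h)))
      (≡.cong (λ e → z *ᶜ e +ᶜ 0ᶜ) (≡.sym (evenFirst-even z ps h)))
      (solve 2 (λ z w → z :* w := z :* w :+ con 0ℚ) ≈ᶜ-refl z (z ^ᶜ evenParts ps))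
    (no h)  → ≡.subst₂ _≈ᶜ_ (≡.sym (evenFirst-odd z (p ∷ ps) h))
      (≡.cong (λ e → z *ᶜ e +ᶜ 0ᶜ) (≡.sym (evenFirst-odd z ps h)))
      (solve 1 (λ z → con 0ℚ := z :* con 0ℚ :+ con 0ℚ) ≈ᶜ-refl z)
  where open ℂ-Solver

oddFirst-duplicate : ∀ z ps → oddFirst z (duplicateFirst ps) ≡ oddFirst z ps
oddFirst-duplicate z []       = ≡.refl
oddFirst-duplicate z (p ∷ ps) = case 2 ∣? p of λ where
  (yes h) → ≡.trans (oddFirst-even z (p ∷ ps) h) (≡.sym (oddFirst-even z ps h))
  (no h)  → ≡.trans (oddFirst-odd z (p ∷ ps) h) (≡.trans (weight-odd z ps h) (≡.sym (oddFirst-odd z ps h)))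

-- Incrementing flips the parity of the first part and leaves the tail alone.
evenFirst-increment : ∀ z ps → evenFirst z (incrementFirst ps) ≡ oddFirst z ps
evenFirst-increment z []       = ≡.refl
evenFirst-increment z (p ∷ ps) = case 2 ∣? p of λ where
  (yes h) → ≡.trans (evenFirst-odd z ps (¬2∣suc p h)) (≡.sym (oddFirst-even z ps h))
  (no h)  → ≡.trans (evenFirst-even z ps (2∣suc p h)) (≡.sym (oddFirst-odd z ps h))

oddFirst-increment : ∀ z ps → oddFirst z (incrementFirst ps) ≡ evenFirst z ps
oddFirst-increment z []       = ≡.refl
oddFirst-increment z (p ∷ ps) = case 2 ∣? p of λ where
  (yes h) → ≡.trans (oddFirst-odd z ps (¬2∣suc p h)) (≡.sym (evenFirst-even z ps h))
  (no h)  → ≡.trans (oddFirst-even z ps (2∣suc p h)) (≡.sym (evenFirst-odd z ps h))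

module _ (z : ℂ) where
  open ℂ-Solver

  evenGF oddGF : ℕ → ℂ
  evenGF n = ∑ (evenFirst z) (hookPartitions n)
  oddGF n = ∑ (oddFirst z) (hookPartitions n)

  ∑-hookPartitions-suc : ∀ f n → ∑ f (hookPartitions (suc n)) ≈ᶜ
    ∑ (f ∘ duplicateFirst) (hookPartitions n) +ᶜ ∑ (f ∘ incrementFirst) (hookPartitions n)
  ∑-hookPartitions-suc f n = ≈ᶜ-trans
    (∑-++ f (map duplicateFirst (hookPartitions n)) (map incrementFirst (hookPartitions n)))
    (+ᶜ-cong (∑-map f duplicateFirst (hookPartitions n)) (∑-map f incrementFirst (hookPartitions n)))

  -- Duplication gives the first summand, incrementing an odd first part the second. With
  -- `oddGF-suc`, the pair of sums evolves by a 2 × 2 matrix of trace 1 + z and determinant z - 1,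
  -- the source of the recurrence for F.
  evenGF-suc : ∀ n → evenGF (suc n) ≈ᶜ z *ᶜ evenGF n +ᶜ oddGF n
  evenGF-suc n = ≈ᶜ-trans (∑-hookPartitions-suc (evenFirst z) n) $ +ᶜ-cong
    (≈ᶜ-trans (∑-linear z (evenFirst z ∘ duplicateFirst) (evenFirst z) (λ _ → 0ᶜ) (hookPartitions n)
                 (All.universal (evenFirst-duplicate z) (hookPartitions n)))
      (≈ᶜ-trans (+ᶜ-cong ≈ᶜ-refl (∑-zero (hookPartitions n)))
        (CommutativeRing.+-identityʳ ℂ-commutativeRing (z *ᶜ evenGF n))))
    (∑-cong (hookPartitions n) (evenFirst-increment z))
    where
    ∑-zero : ∀ (xs : List (List ℕ)) → ∑ (λ _ → 0ᶜ) xs ≈ᶜ 0ᶜ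
    ∑-zero []       = ≈ᶜ-refl
    ∑-zero (x ∷ xs) = ≈ᶜ-trans (CommutativeRing.+-identityˡ ℂ-commutativeRing _) (∑-zero xs)

  oddGF-suc : ∀ n → oddGF (suc n) ≈ᶜ oddGF n +ᶜ evenGF n
  oddGF-suc n = ≈ᶜ-trans (∑-hookPartitions-suc (oddFirst z) n) $ +ᶜ-cong
    (∑-cong (hookPartitions n) (oddFirst-duplicate z)) (∑-cong (hookPartitions n) (oddFirst-increment z))

  F-split : ∀ n → F (suc n) z ≈ᶜ z *ᶜ evenGF n +ᶜ oddGF n
  F-split n = ≈ᶜ-trans (F-∑ n z) $
    ∑-linear z (λ ps → z ^ᶜ evenParts ps) (evenFirst z) (oddFirst z) (hookPartitions n) $
    All.tabulate λ {ps} h → weight-split z ps (nonempty (hookPartitions-sound n h))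

  -- `Φ n` is to equal `F n` z for n ≥ 1. The value 0 at n = 0 continues the recurrence one step
  -- down, as Binet's formula requires.
  Φ : ℕ → ℂ
  Φ zero          = 0ᶜ
  Φ (suc zero)    = 1ᶜ
  Φ (suc (suc n)) = (1ᶜ +ᶜ z) *ᶜ Φ (suc n) +ᶜ (1ᶜ -ᶜ z) *ᶜ Φ n

  weighted-GF≈Φ : ∀ n → z *ᶜ evenGF n +ᶜ oddGF n ≈ᶜ Φ (suc n)
  weighted-GF≈Φ zero          = solve 1 (λ z → z :* (con 0ℚ :+ con 0ℚ) :+ (con 1ℚ :+ con 0ℚ) := con 1ℚ) ≈ᶜ-refl z
  weighted-GF≈Φ (suc zero)    = ≈ᶜ-trans (+ᶜ-cong (*ᶜ-cong ≈ᶜ-refl (evenGF-suc 0)) (oddGF-suc 0)) $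
    solve 1 (λ z → let e = con 0ℚ :+ con 0ℚ ; o = con 1ℚ :+ con 0ℚ in
      z :* (z :* e :+ o) :+ (o :+ e) := (con 1ℚ :+ z) :* con 1ℚ :+ (con 1ℚ :- z) :* con 0ℚ) ≈ᶜ-refl z
  -- Everything is expanded down to `evenGF n` and `oddGF n`, where the recurrence becomes a
  -- polynomial identity.
  weighted-GF≈Φ (suc (suc n)) = ≈ᶜ-trans (+ᶜ-cong (*ᶜ-cong ≈ᶜ-refl (evenGF-suc (suc n))) (oddGF-suc (suc n))) $
    ≈ᶜ-trans (+ᶜ-cong (*ᶜ-cong ≈ᶜ-refl (+ᶜ-cong ≈ᶜ-refl (oddGF-suc n))) (+ᶜ-cong (oddGF-suc n) ≈ᶜ-refl)) $
    ≈ᶜ-trans (+ᶜ-cong (*ᶜ-cong ≈ᶜ-refl (+ᶜ-cong (*ᶜ-cong ≈ᶜ-refl (evenGF-suc n)) ≈ᶜ-refl))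
      (+ᶜ-cong ≈ᶜ-refl (evenGF-suc n))) $
    ≈ᶜ-trans (solve 3 (λ z e o → let e′ = z :* e :+ o ; o′ = o :+ e in
        z :* (z :* e′ :+ o′) :+ (o′ :+ e′) :=
        (con 1ℚ :+ z) :* (z :* e′ :+ o′) :+ (con 1ℚ :- z) :* (z :* e :+ o)) ≈ᶜ-refl z (evenGF n) (oddGF n)) $
    +ᶜ-cong (*ᶜ-cong ≈ᶜ-refl (≈ᶜ-trans
        (≈ᶜ-sym (+ᶜ-cong (*ᶜ-cong ≈ᶜ-refl (evenGF-suc n)) (oddGF-suc n))) (weighted-GF≈Φ (suc n))))
      (*ᶜ-cong ≈ᶜ-refl (weighted-GF≈Φ n))

  F≈Φ : ∀ n → F (suc n) z ≈ᶜ Φ (suc n)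
  F≈Φ n = ≈ᶜ-trans (F-split n) (weighted-GF≈Φ n)

-- Zeros lie on the half circle

2ℚ : ℚ
2ℚ = + 2 ℚ./ 1

½ᴿ : ℝ
½ᴿ = ℚ→ℝ ½

vanish : ∀ {x y} → x ≈ᴿ y → x -ᴿ y ≈ᴿ 0ᴿ
vanish {x} {y} e = ≈-trans (+-cong e ≈-refl) (CommutativeRing.-‿inverseʳ ℝ-commutativeRing y)

unvanish : ∀ {x y} → x -ᴿ y ≈ᴿ 0ᴿ → x ≈ᴿ y
unvanish {x} {y} e = ≈-trans (solve 2 (λ x y → x := (x :- y) :+ y) ≈-refl x y)
  (≈-trans (+-cong e ≈-refl) (CommutativeRing.+-identityˡ ℝ-commutativeRing y))
  where open ℝ-Solver

-- Format for deriving one polynomial equation from others: the target is written as a combination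
-- of expressions known to vanish, with explicit cofactors. Spare slots are filled with 0 · 0.
combine₃ : ∀ k l m {u v w} → u ≈ᴿ 0ᴿ → v ≈ᴿ 0ᴿ → w ≈ᴿ 0ᴿ → k *ᴿ u +ᴿ l *ᴿ v +ᴿ m *ᴿ w ≈ᴿ 0ᴿ
combine₃ k l m hu hv hw = ≈-trans
  (+-cong (+-cong (*-cong {x = k} ≈-refl hu) (*-cong {x = l} ≈-refl hv)) (*-cong {x = m} ≈-refl hw))
  (solve 3 (λ k l m → k :* con 0ℚ :+ l :* con 0ℚ :+ m :* con 0ℚ := con 0ℚ) ≈-refl k l m)
  where open ℝ-Solver

normSq : ℂ → ℝ
normSq z = re z *ᴿ re z +ᴿ im z *ᴿ im z

normSq-cong : ∀ {z w} → z ≈ᶜ w → normSq z ≈ᴿ normSq w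
normSq-cong (p ,ᶜ q) = +-cong (*-cong p p) (*-cong q q)

normSq-nonNeg : ∀ z → 0ᴿ ≤ᴿ normSq z
normSq-nonNeg z = 0≤+0≤ (0≤² (re z)) (0≤² (im z))

normSq-* : ∀ z w → normSq (z *ᶜ w) ≈ᴿ normSq z *ᴿ normSq w
normSq-* (a +i b) (c +i d) = solve 4 (λ a b c d →
  (a :* c :- b :* d) :* (a :* c :- b :* d) :+ (a :* d :+ b :* c) :* (a :* d :+ b :* c) :=
  (a :* a :+ b :* b) :* (c :* c :+ d :* d)) ≈-refl a b c d
  where open ℝ-Solver

*-mono-< : ∀ {x y u v} → 0ᴿ ≤ᴿ x → x <ᴿ y → 0ᴿ ≤ᴿ u → u <ᴿ v → x *ᴿ u <ᴿ y *ᴿ v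
*-mono-< {x} {y} {u} {v} 0≤x x<y 0≤u u<v = 0<y-x⇒x<y $
  <-≤-trans (0<*0< (x<y⇒0<y-x x<y) (≤-<-trans 0≤u u<v))
    (≤-by (0≤*0≤ 0≤x (x≤y⇒0≤y-x (<⇒≤ u<v)))
      (solve 4 (λ x y u v → x :* (v :- u) := y :* v :- x :* u :- (y :- x) :* v) ≈-refl x y u v))
  where open ℝ-Solver

normSq-^-mono-< : ∀ {z w} n → normSq z <ᴿ normSq w → normSq (z ^ᶜ suc n) <ᴿ normSq (w ^ᶜ suc n)
normSq-^-mono-< {z} {w} zero    h = ≤-<-trans (≈⇒≤ (normSq-cong (*-identityʳ z)))
  (<-≤-trans h (≈⇒≤ (normSq-cong (≈ᶜ-sym (*-identityʳ w)))))
  where open CommutativeRing ℂ-commutativeRing using (*-identityʳ)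
normSq-^-mono-< {z} {w} (suc n) h = ≤-<-trans (≈⇒≤ (normSq-* z (z ^ᶜ suc n))) $
  <-≤-trans (*-mono-< (normSq-nonNeg z) h (normSq-nonNeg (z ^ᶜ suc n)) (normSq-^-mono-< n h))
    (≈⇒≤ (≈-sym (normSq-* w (w ^ᶜ suc n))))

-- Strict monotonicity of powers refutes both strict inequalities between the two norms.
normSq-^-injective : ∀ {z w} n → z ^ᶜ suc n ≈ᶜ w ^ᶜ suc n → normSq z ≈ᴿ normSq w
normSq-^-injective n e = ≤-antisym
  (≮⇒≥ (≤⇒≯ (≈⇒≤ (normSq-cong e)) ∘ normSq-^-mono-< n))
  (≮⇒≥ (≤⇒≯ (≈⇒≤ (normSq-cong (≈ᶜ-sym e))) ∘ normSq-^-mono-< n))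

-- `x ≤ᴿ y` amounts to the negation of `y <ᴿ x`. This licenses classical choices of signs and roots
-- when the goal is an inequality or an equality.
≤-stable : ∀ {x y} → ¬ ¬ (x ≤ᴿ y) → x ≤ᴿ y
≤-stable h = ≮⇒≥ λ y<x → h λ x≤y → ≤⇒≯ x≤y y<x

≈-stable : ∀ {x y} → ¬ ¬ (x ≈ᴿ y) → x ≈ᴿ y
≈-stable h = ≤-antisym (≤-stable λ k → h (k ∘ ≈⇒≤)) (≤-stable λ k → h (k ∘ ≈⇒≤ ∘ ≈-sym))

¬¬-sign : ∀ x → ¬ ¬ (0ᴿ ≤ᴿ x ⊎ x ≤ᴿ 0ᴿ)
¬¬-sign x h = h (inj₁ (≮⇒≥ λ x<0 → h (inj₂ (<⇒≤ x<0))))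

0≤½ : 0ᴿ ≤ᴿ ½ᴿ
0≤½ = ℚ→ℝ-mono-≤ (ℚ.<⇒≤ (ℚ.positive⁻¹ ½))

-- Complex square roots, up to double negation

module _ {a b m : ℝ} (0≤m : 0ᴿ ≤ᴿ m) (m² : m *ᴿ m ≈ᴿ a *ᴿ a +ᴿ b *ᴿ b) where
  open ℝ-Solver

  private
    a²≤m² : a *ᴿ a ≤ᴿ m *ᴿ m
    a²≤m² = ≤-by (0≤² b) (≈-trans (solve 2 (λ a b → b :* b := a :* a :+ b :* b :- a :* a) ≈-refl a b)
      (+-cong (≈-sym m²) ≈-refl))

  0≤½[m+a] : 0ᴿ ≤ᴿ ½ᴿ *ᴿ (m +ᴿ a)
  0≤½[m+a] = 0≤*0≤ 0≤½ (≤-trans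
    (x≤y⇒0≤y-x (²-cancel-≤ { -ᴿ a} 0≤m (≤-trans (≈⇒≤ (solve 1 (λ a → :- a :* :- a := a :* a) ≈-refl a)) a²≤m²)))
    (≈⇒≤ (solve 2 (λ m a → m :- :- a := m :+ a) ≈-refl m a)))

  0≤½[m-a] : 0ᴿ ≤ᴿ ½ᴿ *ᴿ (m -ᴿ a)
  0≤½[m-a] = 0≤*0≤ 0≤½ (x≤y⇒0≤y-x (²-cancel-≤ 0≤m a²≤m²))

  module _ {u v : ℝ} (0≤u : 0ᴿ ≤ᴿ u) (0≤v : 0ᴿ ≤ᴿ v)
    (u² : u *ᴿ u ≈ᴿ ½ᴿ *ᴿ (m +ᴿ a)) (v² : v *ᴿ v ≈ᴿ ½ᴿ *ᴿ (m -ᴿ a)) where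

    u²-v² : u *ᴿ u -ᴿ v *ᴿ v ≈ᴿ a
    u²-v² = ≈-trans (+-cong u² (-‿cong v²))
      (solve 2 (λ m a → con ½ :* (m :+ a) :- con ½ :* (m :- a) := a) ≈-refl m a)

    -- `c` stands for |b|: (uv)² = (m² - a²)/4 = b²/4, and nonnegative numbers with equal squares
    -- agree.
    uv : ∀ c → 0ᴿ ≤ᴿ c → c *ᴿ c ≈ᴿ b *ᴿ b → u *ᴿ v ≈ᴿ ½ᴿ *ᴿ c
    uv c 0≤c c² = ²-cancel-≈ (0≤*0≤ 0≤u 0≤v) (0≤*0≤ 0≤½ 0≤c) $
      ≈-trans (solve 2 (λ u v → (u :* v) :* (u :* v) := (u :* u) :* (v :* v)) ≈-refl u v) $
      ≈-trans (*-cong u² v²) $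
      ≈-trans (solve 2 (λ m a → (con ½ :* (m :+ a)) :* (con ½ :* (m :- a)) :=
                                con ½ :* con ½ :* (m :* m :- a :* a)) ≈-refl m a) $
      ≈-trans (*-cong ≈-refl (+-cong m² ≈-refl)) $
      ≈-trans (solve 2 (λ a b → con ½ :* con ½ :* (a :* a :+ b :* b :- a :* a) :=
                                con ½ :* con ½ :* (b :* b)) ≈-refl a b) $
      ≈-trans (*-cong ≈-refl (≈-sym c²)) $
      solve 1 (λ c → con ½ :* con ½ :* (c :* c) := (con ½ :* c) :* (con ½ :* c)) ≈-refl c

    -- Here m is the modulus of a + ib, and u² = (m + a)/2, v² = (m - a)/2. As 2uv = |b|, the sign
    -- in u ± iv has to be that of b.
    complex-√-by-sign : 0ᴿ ≤ᴿ b ⊎ b ≤ᴿ 0ᴿ → ∃[ δ ] δ *ᶜ δ ≈ᶜ a +i b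
    complex-√-by-sign (inj₁ 0≤b) = u +i v , u²-v² ,ᶜ
      ≈-trans (solve 2 (λ u v → u :* v :+ v :* u := con 2ℚ :* (u :* v)) ≈-refl u v)
        (≈-trans (*-cong ≈-refl (uv b 0≤b ≈-refl))
          (solve 1 (λ b → con 2ℚ :* (con ½ :* b) := b) ≈-refl b))
    complex-√-by-sign (inj₂ b≤0) = u +i (-ᴿ v) ,
         ≈-trans (solve 2 (λ u v → u :* u :- (:- v) :* (:- v) := u :* u :- v :* v) ≈-refl u v) u²-v²
      ,ᶜ ≈-trans (solve 2 (λ u v → u :* (:- v) :+ (:- v) :* u := :- (con 2ℚ :* (u :* v))) ≈-refl u v)
           (≈-trans (-‿cong (*-cong ≈-refl (uv (-ᴿ b)
               (≤-by (x≤y⇒0≤y-x b≤0) (solve 1 (λ b → con 0ℚ :- b := :- b :- con 0ℚ) ≈-refl b))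
               (solve 1 (λ b → :- b :* :- b := b :* b) ≈-refl b))))
             (solve 1 (λ b → :- (con 2ℚ :* (con ½ :* :- b)) := b) ≈-refl b))

-- The double negation comes only from the sign of the imaginary part, which cannot be decided.
complex-√ : ∀ w → ¬ ¬ (∃[ δ ] δ *ᶜ δ ≈ᶜ w)
complex-√ w none = ¬¬-sign (im w) λ s → none $ complex-√-by-sign
  (√ᴿ-nonNeg (normSq w)) m² (√ᴿ-nonNeg _) (√ᴿ-nonNeg _)
  (√ᴿ-square _ (0≤½[m+a] (√ᴿ-nonNeg (normSq w)) m²)) (√ᴿ-square _ (0≤½[m-a] (√ᴿ-nonNeg (normSq w)) m²)) s
  where
  m² : ∣ w ∣ᶜ *ᴿ ∣ w ∣ᶜ ≈ᴿ re w *ᴿ re w +ᴿ im w *ᴿ im w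
  m² = √ᴿ-square (normSq w) (normSq-nonNeg w)

-- The roots are (s ± δ)/2, where δ is a square root of the discriminant s² - 4p.
quadratic-roots : ∀ s p → ¬ ¬ (∃[ α ] ∃[ β ] (α +ᶜ β ≈ᶜ s × α *ᶜ β ≈ᶜ p))
quadratic-roots s p none = complex-√ (s *ᶜ s -ᶜ (ℚ→ℂ 2ℚ *ᶜ ℚ→ℂ 2ℚ) *ᶜ p) λ (δ , δ²) →
  none (ℚ→ℂ ½ *ᶜ (s +ᶜ δ) , ℚ→ℂ ½ *ᶜ (s -ᶜ δ)
    , solve 2 (λ s δ → con ½ :* (s :+ δ) :+ con ½ :* (s :- δ) := s) ≈ᶜ-refl s δ
    , ≈ᶜ-trans (solve 2 (λ s δ →
        (con ½ :* (s :+ δ)) :* (con ½ :* (s :- δ)) := con ½ :* con ½ :* (s :* s :- δ :* δ)) ≈ᶜ-refl s δ)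
        (≈ᶜ-trans (*ᶜ-cong ≈ᶜ-refl (+ᶜ-cong ≈ᶜ-refl (CommutativeRing.-‿cong ℂ-commutativeRing δ²)))
          (solve 2 (λ s p → con ½ :* con ½ :* (s :* s :- (s :* s :- (con 2ℚ :* con 2ℚ) :* p)) := p) ≈ᶜ-refl s p)))
  where open ℂ-Solver

-- Characteristic roots and the location of the zeros

module _ {z α β : ℂ} (sum : α +ᶜ β ≈ᶜ 1ᶜ +ᶜ z) (product : α *ᶜ β ≈ᶜ z -ᶜ 1ᶜ) where
  open ℂ-Solver

  -- Induction along the recurrence, whose coefficients are α + β and -αβ. Keeping α - β on the left
  -- avoids a division, so a double root is covered too.
  binet : ∀ n → (α -ᶜ β) *ᶜ Φ z n ≈ᶜ α ^ᶜ n -ᶜ β ^ᶜ n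
  binet zero          = solve 2 (λ α β → (α :- β) :* con 0ℚ := con 1ℚ :- con 1ℚ) ≈ᶜ-refl α β
  binet (suc zero)    = solve 2 (λ α β → (α :- β) :* con 1ℚ := α :* con 1ℚ :- β :* con 1ℚ) ≈ᶜ-refl α β
  binet (suc (suc n)) = ≈ᶜ-trans
    (solve 4 (λ d z f g → d :* ((con 1ℚ :+ z) :* f :+ (con 1ℚ :- z) :* g) :=
                          (con 1ℚ :+ z) :* (d :* f) :- (z :- con 1ℚ) :* (d :* g)) ≈ᶜ-refl
       (α -ᶜ β) z (Φ z (suc n)) (Φ z n)) $
    ≈ᶜ-trans (+ᶜ-cong (*ᶜ-cong (≈ᶜ-sym sum) (binet (suc n)))
      (CommutativeRing.-‿cong ℂ-commutativeRing (*ᶜ-cong (≈ᶜ-sym product) (binet n)))) $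
    solve 4 (λ α β a b → (α :+ β) :* (α :* a :- β :* b) :- (α :* β) :* (a :- b) :=
                         α :* (α :* a) :- β :* (β :* b)) ≈ᶜ-refl α β (α ^ᶜ n) (β ^ᶜ n)

  equal-norms : ∀ n → Φ z (suc n) ≈ᶜ 0ᶜ → normSq α ≈ᴿ normSq β
  equal-norms n e = normSq-^-injective n $
    ≈ᶜ-trans (solve 2 (λ a b → a := (a :- b) :+ b) ≈ᶜ-refl (α ^ᶜ suc n) (β ^ᶜ suc n)) $
    ≈ᶜ-trans (+ᶜ-cong (≈ᶜ-trans (≈ᶜ-sym (binet (suc n))) (*ᶜ-cong ≈ᶜ-refl e)) ≈ᶜ-refl) $
    solve 2 (λ d b → d :* con 0ℚ :+ b := b) ≈ᶜ-refl (α -ᶜ β) (β ^ᶜ suc n)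

-- With t = 2 − r, the hypotheses give t²d = − t²(r² + 4), and d ≥ 0 forces t = 0.
radius : ∀ r p q d → 0ᴿ ≤ᴿ d → d ≈ᴿ 2ᴿ *ᴿ 2ᴿ *ᴿ r -ᴿ ((p +ᴿ 2ᴿ) *ᴿ (p +ᴿ 2ᴿ) +ᴿ q *ᴿ q) →
  (2ᴿ -ᴿ r) *ᴿ (p -ᴿ r) ≈ᴿ 0ᴿ → (2ᴿ -ᴿ r) *ᴿ q ≈ᴿ 0ᴿ → r ≈ᴿ 2ᴿ
radius r p q d 0≤d d≈ u≈0 v≈0 = ≈-sym $ unvanish $ ²≤0⇒≈0 $
  ≤-by (0≤*0≤ {ℚ→ℝ (½ ℚ.* ½)} (ℚ→ℝ-mono-≤ (ℚ.<⇒≤ (ℚ.positive⁻¹ _)))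
         (0≤+0≤ (0≤² (t *ᴿ r)) (0≤*0≤ (0≤² t) 0≤d))) $ unvanish $
  ≈-trans (solve 4 (λ r p q d →
      let t = con 2ℚ :- r ; u = t :* (p :- r) ; v = t :* q in
      con (½ ℚ.* ½) :* ((t :* r) :* (t :* r) :+ t :* t :* d) :- (con 0ℚ :- t :* t) :=
      (con (½ ℚ.* ½) :* t :* t) :* (d :- (con 2ℚ :* con 2ℚ :* r :- ((p :+ con 2ℚ) :* (p :+ con 2ℚ) :+ q :* q)))
      :+ (con (½ ℚ.* ½) :* :- (t :* (r :+ con 2ℚ) :+ t :* (r :+ con 2ℚ) :+ u)) :* u
      :+ (con (½ ℚ.* ½) :* :- v) :* v)
    ≈-refl r p q d) $
  combine₃ _ _ _ (vanish d≈) u≈0 v≈0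
  where
  open ℝ-Solver
  t : ℝ
  t = 2ᴿ -ᴿ r

-- With P = αβ, S = α + β and |α|² = |β|² = r, conjugation gives S̄ P = r S; as S = P + 2 and |P| = r,
-- this is (2 − r)(P − r) = 0.
module _ {a b c d p q : ℝ}
  (re-sum : a +ᴿ c ≈ᴿ p +ᴿ 2ᴿ) (im-sum : b +ᴿ d ≈ᴿ q)
  (re-product : a *ᴿ c -ᴿ b *ᴿ d ≈ᴿ p) (im-product : a *ᴿ d +ᴿ b *ᴿ c ≈ᴿ q)
  (norms : a *ᴿ a +ᴿ b *ᴿ b ≈ᴿ c *ᴿ c +ᴿ d *ᴿ d) where
  open ℝ-Solver

  private
    r : ℝ
    r = a *ᴿ a +ᴿ b *ᴿ b

    norm-product : p *ᴿ p +ᴿ q *ᴿ q ≈ᴿ r *ᴿ r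
    norm-product = ≈-trans (≈-sym (+-cong (*-cong re-product re-product) (*-cong im-product im-product))) $
      ≈-trans (normSq-* (a +i b) (c +i d)) (*-cong ≈-refl (≈-sym norms))

    conj-re : (p +ᴿ 2ᴿ) *ᴿ p +ᴿ q *ᴿ q ≈ᴿ r *ᴿ (p +ᴿ 2ᴿ)
    conj-re = ≈-trans (≈-sym (+-cong (*-cong re-sum re-product) (*-cong im-sum im-product))) $
      ≈-trans (solve 4 (λ a b c d → (a :+ c) :* (a :* c :- b :* d) :+ (b :+ d) :* (a :* d :+ b :* c) :=
                 (a :* a :+ b :* b) :* c :+ (c :* c :+ d :* d) :* a) ≈-refl a b c d) $
      ≈-trans (+-cong ≈-refl (*-cong (≈-sym norms) ≈-refl)) $
      ≈-trans (solve 3 (λ r a c → r :* c :+ r :* a := r :* (a :+ c)) ≈-refl r a c) $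
      *-cong ≈-refl re-sum

    conj-im : (p +ᴿ 2ᴿ) *ᴿ q -ᴿ q *ᴿ p ≈ᴿ r *ᴿ q
    conj-im = ≈-trans (≈-sym (+-cong (*-cong re-sum im-product) (-‿cong (*-cong im-sum re-product)))) $
      ≈-trans (solve 4 (λ a b c d → (a :+ c) :* (a :* d :+ b :* c) :- (b :+ d) :* (a :* c :- b :* d) :=
                 (a :* a :+ b :* b) :* d :+ (c :* c :+ d :* d) :* b) ≈-refl a b c d) $
      ≈-trans (+-cong ≈-refl (*-cong (≈-sym norms) ≈-refl)) $
      ≈-trans (solve 3 (λ r b d → r :* d :+ r :* b := r :* (b :+ d)) ≈-refl r b d) $
      *-cong ≈-refl im-sum

    δ : ℝ
    δ = (a -ᴿ c) *ᴿ (a -ᴿ c) +ᴿ (b -ᴿ d) *ᴿ (b -ᴿ d)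

    0≤δ : 0ᴿ ≤ᴿ δ
    0≤δ = 0≤+0≤ (0≤² (a -ᴿ c)) (0≤² (b -ᴿ d))

    parallelogram : δ ≈ᴿ 2ᴿ *ᴿ 2ᴿ *ᴿ r -ᴿ ((p +ᴿ 2ᴿ) *ᴿ (p +ᴿ 2ᴿ) +ᴿ q *ᴿ q)
    parallelogram = ≈-trans (solve 4 (λ a b c d →
        (a :- c) :* (a :- c) :+ (b :- d) :* (b :- d) :=
        con 2ℚ :* (a :* a :+ b :* b) :+ con 2ℚ :* (c :* c :+ d :* d)
          :- ((a :+ c) :* (a :+ c) :+ (b :+ d) :* (b :+ d)))
        ≈-refl a b c d) $
      ≈-trans (+-cong (+-cong ≈-refl (*-cong {x = 2ᴿ} ≈-refl (≈-sym norms)))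
        (-‿cong (+-cong (*-cong re-sum re-sum) (*-cong im-sum im-sum)))) $
      solve 3 (λ r p q → con 2ℚ :* r :+ con 2ℚ :* r :- ((p :+ con 2ℚ) :* (p :+ con 2ℚ) :+ q :* q) :=
        con 2ℚ :* con 2ℚ :* r :- ((p :+ con 2ℚ) :* (p :+ con 2ℚ) :+ q :* q)) ≈-refl r p q

    lemma-re : ∀ r p q → p *ᴿ p +ᴿ q *ᴿ q ≈ᴿ r *ᴿ r → (p +ᴿ 2ᴿ) *ᴿ p +ᴿ q *ᴿ q ≈ᴿ r *ᴿ (p +ᴿ 2ᴿ) →
      (2ᴿ -ᴿ r) *ᴿ (p -ᴿ r) ≈ᴿ 0ᴿ
    lemma-re r p q h k = ≈-trans (solve 3 (λ r p q →
        (con 2ℚ :- r) :* (p :- r) :=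
        con 1ℚ :* (((p :+ con 2ℚ) :* p :+ q :* q) :- r :* (p :+ con 2ℚ)) :+
        :- con 1ℚ :* ((p :* p :+ q :* q) :- r :* r) :+ con 0ℚ :* con 0ℚ) ≈-refl r p q) $
      combine₃ 1ᴿ (-ᴿ 1ᴿ) 0ᴿ (vanish k) (vanish h) ≈-refl

    lemma-im : ∀ r p q → (p +ᴿ 2ᴿ) *ᴿ q -ᴿ q *ᴿ p ≈ᴿ r *ᴿ q → (2ᴿ -ᴿ r) *ᴿ q ≈ᴿ 0ᴿ
    lemma-im r p q k = ≈-trans (solve 3 (λ r p q →
        (con 2ℚ :- r) :* q := ((p :+ con 2ℚ) :* q :- q :* p) :- r :* q) ≈-refl r p q) (vanish k)

    r≈2 : r ≈ᴿ 2ᴿ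
    r≈2 = radius r p q δ 0≤δ parallelogram (lemma-re r p q norm-product conj-re) (lemma-im r p q conj-im)

  norm≈4 : p *ᴿ p +ᴿ q *ᴿ q ≈ᴿ 2ᴿ *ᴿ 2ᴿ
  norm≈4 = ≈-trans norm-product (*-cong r≈2 r≈2)

  -- With r = 2 and p² + q² = 4 the parallelogram law reduces to |α - β|² = -4p.
  re≤0 : p ≤ᴿ 0ᴿ
  re≤0 = ≤-by (0≤*0≤ {ℚ→ℝ (½ ℚ.* ½)} (ℚ→ℝ-mono-≤ (ℚ.<⇒≤ (ℚ.positive⁻¹ _))) 0≤δ) $
    ≈-trans (*-cong ≈-refl (≈-trans parallelogram (+-cong (*-cong {x = 2ᴿ *ᴿ 2ᴿ} ≈-refl r≈2) ≈-refl))) $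
    unvanish $ ≈-trans (solve 2 (λ p q →
      con (½ ℚ.* ½) :* (con 2ℚ :* con 2ℚ :* con 2ℚ :- ((p :+ con 2ℚ) :* (p :+ con 2ℚ) :+ q :* q)) :- (con 0ℚ :- p) :=
      :- con (½ ℚ.* ½) :* ((p :* p :+ q :* q) :- con 2ℚ :* con 2ℚ)
        :+ con 0ℚ :* con 0ℚ :+ con 0ℚ :* con 0ℚ) ≈-refl p q) $
    combine₃ (-ᴿ ℚ→ℝ (½ ℚ.* ½)) 0ᴿ 0ᴿ (vanish norm≈4) ≈-refl ≈-refl

left-half-circle : ∀ z → normSq (z -ᶜ 1ᶜ) ≈ᴿ 2ᴿ *ᴿ 2ᴿ → re (z -ᶜ 1ᶜ) ≤ᴿ 0ᴿ → LeftHalfCircle z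
left-half-circle z h k =
    √-unique (normSq-nonNeg (z -ᶜ 1ᶜ)) (ℚ→ℝ-mono-≤ (ℚ.<⇒≤ (ℚ.positive⁻¹ 2ℚ))) (≈-sym h)
  , ≤-by (x≤y⇒0≤y-x k) (solve 1 (λ x → con 0ℚ :- (x :- con 1ℚ) := con 1ℚ :- x) ≈-refl (re z))
  where open ℝ-Solver

Φ-zero⇒ : ∀ n z → Φ z (suc n) ≈ᶜ 0ᶜ → ¬ ¬ (normSq (z -ᶜ 1ᶜ) ≈ᴿ 2ᴿ *ᴿ 2ᴿ × re (z -ᶜ 1ᶜ) ≤ᴿ 0ᴿ)
Φ-zero⇒ n z h none = quadratic-roots (1ᶜ +ᶜ z) (z -ᶜ 1ᶜ) λ (α , β , sum , product) →
  let re-sum = ≈-trans (re-≈ sum) (shift (re z))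
      im-sum = ≈-trans (im-≈ sum) (drop (im z))
      norms  = equal-norms {z} {α} {β} sum product n h
  in none (norm≈4 re-sum im-sum (re-≈ product) (im-≈ product) norms
         , re≤0 re-sum im-sum (re-≈ product) (im-≈ product) norms)
  where
  open ℝ-Solver
  shift : ∀ x → 1ᴿ +ᴿ x ≈ᴿ (x -ᴿ 1ᴿ) +ᴿ 2ᴿ
  shift = solve 1 (λ x → con 1ℚ :+ x := (x :- con 1ℚ) :+ con 2ℚ) ≈-refl
  drop : ∀ x → 0ᴿ +ᴿ x ≈ᴿ x -ᴿ 0ᴿ
  drop = solve 1 (λ x → con 0ℚ :+ x := x :- con 0ℚ) ≈-refl

F-zeros⊆LeftHalfCircle : ∀ n → 1 ℕ.≤ n → ∀ z → F n z ≈ᶜ 0ᶜ → LeftHalfCircle z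
F-zeros⊆LeftHalfCircle (suc n) _ z h = left-half-circle z
  (≈-stable λ k → ¬¬both (k ∘ proj₁)) (≤-stable λ k → ¬¬both (k ∘ proj₂))
  where ¬¬both = Φ-zero⇒ n z (≈ᶜ-trans (≈ᶜ-sym (F≈Φ z n)) h)

-- Chebyshev polynomials and nested square roots

#_ : ℕ → ℝ
# n = ℚ→ℝ (+ n ℚ./ 1)

0≤ℚ→ℝ : ∀ q .{{_ : ℚ.NonNegative q}} → 0ᴿ ≤ᴿ ℚ→ℝ q
0≤ℚ→ℝ q = ℚ→ℝ-mono-≤ (ℚ.nonNegative⁻¹ q)

-- Structural recursion lets `U` and `T` at `double (suc n)` unfold by their recurrence without
-- arithmetic on indices.
double : ℕ → ℕ
double zero    = zero
double (suc n) = suc (suc (double n))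

-- Chebyshev polynomials on [-2 , 2]: U (2 cos t) n = sin (n t) / sin t and T (2 cos t) n = 2 cos (n t).
U T : ℝ → ℕ → ℝ
U y zero          = 0ᴿ
U y (suc zero)    = 1ᴿ
U y (suc (suc n)) = y *ᴿ U y (suc n) -ᴿ U y n
T x zero          = 2ᴿ
T x (suc zero)    = x
T x (suc (suc n)) = x *ᴿ T x (suc n) -ᴿ T x n

module _ where
  open ℝ-Solver

  T-cong : ∀ {x y} n → x ≈ᴿ y → T x n ≈ᴿ T y n
  T-cong zero          e = ≈-refl
  T-cong (suc zero)    e = e
  T-cong (suc (suc n)) e = +-cong (*-cong e (T-cong (suc n) e)) (-‿cong (T-cong n e))

  private
    double-step : ∀ y a b → let c = y *ᴿ a -ᴿ b in
      y *ᴿ (y *ᴿ c -ᴿ a) -ᴿ c ≈ᴿ (y *ᴿ y -ᴿ 2ᴿ) *ᴿ c -ᴿ b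
    double-step = solve 3 (λ y a b → let c = y :* a :- b in
      y :* (y :* c :- a) :- c := (y :* y :- con 2ℚ) :* c :- b) ≈-refl

  -- For y = 2 cos t this is sin (2nt) / sin t = 2 cos t · sin (n · 2t) / sin 2t, with y² - 2 = 2
  -- cos 2t. Along indices of equal parity the recurrence has coefficient y² - 2, by `double-step`.
  U-double : ∀ y n → U y (double n) ≈ᴿ y *ᴿ U (y *ᴿ y -ᴿ 2ᴿ) n
  U-double y zero          = solve 1 (λ y → con 0ℚ := y :* con 0ℚ) ≈-refl y
  U-double y (suc zero)    = solve 1 (λ y → y :* con 1ℚ :- con 0ℚ := y :* con 1ℚ) ≈-refl y
  U-double y (suc (suc n)) = ≈-trans (double-step y (U y (suc (double n))) (U y (double n))) $
    ≈-trans (+-cong (*-cong {x = y *ᴿ y -ᴿ 2ᴿ} ≈-refl (U-double y (suc n))) (-‿cong (U-double y n))) $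
    solve 4 (λ g y a b → g :* (y :* a) :- y :* b := y :* (g :* a :- b)) ≈-refl
      (y *ᴿ y -ᴿ 2ᴿ) y (U (y *ᴿ y -ᴿ 2ᴿ) (suc n)) (U (y *ᴿ y -ᴿ 2ᴿ) n)

  T-double : ∀ x n → T x (double n) ≈ᴿ T (x *ᴿ x -ᴿ 2ᴿ) n
  T-double x zero          = ≈-refl
  T-double x (suc zero)    = ≈-refl
  T-double x (suc (suc n)) = ≈-trans (double-step x (T x (suc (double n))) (T x (double n))) $
    +-cong (*-cong {x = x *ᴿ x -ᴿ 2ᴿ} ≈-refl (T-double x (suc n))) (-‿cong (T-double x n))

  -- The recurrence conserves this quadratic form; for x = 2 cos t its value is 4 sin² t. It
  -- replaces trigonometry in the bounds on size and on steps.
  T-invariant : ∀ x n → let c = T x n ; c′ = T x (suc n) in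
    c *ᴿ c +ᴿ c′ *ᴿ c′ -ᴿ x *ᴿ c *ᴿ c′ ≈ᴿ # 4 -ᴿ x *ᴿ x
  T-invariant x zero    = solve 1 (λ x → con 2ℚ :* con 2ℚ :+ x :* x :- x :* con 2ℚ :* x :=
    con (+ 4 ℚ./ 1) :- x :* x) ≈-refl x
  T-invariant x (suc n) = ≈-trans (solve 3 (λ x c c′ → let c″ = x :* c′ :- c in
      c′ :* c′ :+ c″ :* c″ :- x :* c′ :* c″ := c :* c :+ c′ :* c′ :- x :* c :* c′) ≈-refl
      x (T x n) (T x (suc n)))
    (T-invariant x n)

  -- The double-angle formula 2 cos 2nt = (2 cos nt)² - 2; the inductive step differs from an
  -- identity by -2 times the invariant.
  T-square : ∀ x n → T (x *ᴿ x -ᴿ 2ᴿ) n ≈ᴿ T x n *ᴿ T x n -ᴿ 2ᴿ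
  T-square x zero          = solve 0 (con 2ℚ := con 2ℚ :* con 2ℚ :- con 2ℚ) ≈-refl
  T-square x (suc zero)    = ≈-refl
  T-square x (suc (suc n)) = ≈-trans
    (+-cong (*-cong {x = x *ᴿ x -ᴿ 2ᴿ} ≈-refl (T-square x (suc n))) (-‿cong (T-square x n))) $
    unvanish $ ≈-trans (solve 3 (λ x c c′ →
      ((x :* x :- con 2ℚ) :* (c′ :* c′ :- con 2ℚ) :- (c :* c :- con 2ℚ)) :-
        ((x :* c′ :- c) :* (x :* c′ :- c) :- con 2ℚ) :=
      :- con 2ℚ :* ((c :* c :+ c′ :* c′ :- x :* c :* c′) :- (con (+ 4 ℚ./ 1) :- x :* x))
        :+ con 0ℚ :* con 0ℚ :+ con 0ℚ :* con 0ℚ) ≈-refl x (T x n) (T x (suc n))) $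
    combine₃ (-ᴿ 2ᴿ) 0ᴿ 0ᴿ (vanish (T-invariant x n)) ≈-refl ≈-refl

  T-odd-zero : ∀ {x} i → x ≈ᴿ 0ᴿ → T x (suc (double i)) ≈ᴿ 0ᴿ
  T-odd-zero zero    e = e
  T-odd-zero {x} (suc i) e = ≈-trans (+-cong (*-cong {u = T x (double (suc i))} e ≈-refl) (-‿cong (T-odd-zero i e)))
    (solve 1 (λ c → con 0ℚ :* c :- con 0ℚ := con 0ℚ) ≈-refl (T x (double (suc i))))

-- The numbers 2 cos (π / 2ᵐ⁺¹) as nested square roots

half-recip : ∀ m → ½ ℚ.* (+ 1 ℚ./ suc m) ℚ.≤ + 1 ℚ./ suc (suc m)
half-recip m = fromℚᵘ-*-≤ (ℚᵘ.mkℚᵘ (+ 1) 1) (ℚᵘ.mkℚᵘ (+ 1) m) (ℚᵘ.mkℚᵘ (+ 1) (suc m)) $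
  ℚᵘ.*≤* $ ℤ.+≤+ $ ≡.subst₂ ℕ._≤_ e₁ e₂ (ℕ.m≤m+n (suc (suc m)) m)
  where
  open ℕ-Solver
  e₁ : suc (suc m) ≡ suc (suc (m ℕ.+ 0))
  e₁ = ≡.cong (λ k → suc (suc k)) (≡.sym (ℕ.+-identityʳ m))
  e₂ : suc (suc m) ℕ.+ m ≡ suc (m ℕ.+ suc (m ℕ.+ 0)) ℕ.+ 0
  e₂ = solve 1 (λ m → con 2 :+ m :+ m := con 1 :+ (m :+ (con 1 :+ (m :+ con 0))) :+ con 0) ≡.refl m

-- By the half-angle formula `ρ m` is 2 cos (π / 2ᵐ⁺¹), starting from 2 cos (π/2) = 0.
ρ : ℕ → ℝ
ρ zero    = 0ᴿ
ρ (suc m) = √ᴿ (2ᴿ +ᴿ ρ m)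

-- pow₂ m is 2ᵐ⁺¹.
pow₂ : ℕ → ℕ
pow₂ zero    = 2
pow₂ (suc m) = double (pow₂ m)

module _ where
  open ℝ-Solver

  0≤ρ : ∀ m → 0ᴿ ≤ᴿ ρ m
  0≤ρ zero    = ≤-refl
  0≤ρ (suc m) = √ᴿ-nonNeg _

  ρ-suc² : ∀ m → ρ (suc m) *ᴿ ρ (suc m) ≈ᴿ 2ᴿ +ᴿ ρ m
  ρ-suc² m = √ᴿ-square _ (0≤+0≤ (0≤ℚ→ℝ 2ℚ) (0≤ρ m))

  ρ-suc²-2 : ∀ m → ρ (suc m) *ᴿ ρ (suc m) -ᴿ 2ᴿ ≈ᴿ ρ m
  ρ-suc²-2 m = ≈-trans (+-cong (ρ-suc² m) ≈-refl)
    (solve 1 (λ r → (con 2ℚ :+ r) :- con 2ℚ := r) ≈-refl (ρ m))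

  ρ≤2 : ∀ m → ρ m ≤ᴿ 2ᴿ
  ρ≤2 zero    = 0≤ℚ→ℝ 2ℚ
  ρ≤2 (suc m) = ²-cancel-≤ (0≤ℚ→ℝ 2ℚ) $ ≤-trans (≈⇒≤ (ρ-suc² m)) $
    ≤-by (x≤y⇒0≤y-x (ρ≤2 m)) (solve 1 (λ r → con 2ℚ :- r := con 2ℚ :* con 2ℚ :- (con 2ℚ :+ r)) ≈-refl (ρ m))

  4-ρ² : ∀ m → # 4 -ᴿ ρ (suc m) *ᴿ ρ (suc m) ≈ᴿ 2ᴿ -ᴿ ρ m
  4-ρ² m = ≈-trans (+-cong ≈-refl (-‿cong (ρ-suc² m)))
    (solve 1 (λ r → con (+ 4 ℚ./ 1) :- (con 2ℚ :+ r) := con 2ℚ :- r) ≈-refl (ρ m))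

  -- 4 (2 − x) ≥ (2 + x)(2 − x) for 0 ≤ x ≤ 2.
  0<2-ρ : ∀ m → 0ᴿ <ᴿ 2ᴿ -ᴿ ρ m
  0<2-ρ zero    = <-≤-trans (ℚ→ℝ-pos (ℚ.positive⁻¹ 2ℚ)) (≈⇒≤ (solve 0 (con 2ℚ := con 2ℚ :- con 0ℚ) ≈-refl))
  0<2-ρ (suc m) = <-≤-trans (0<*0< (ℚ→ℝ-pos {½ ℚ.* ½} (ℚ.positive⁻¹ _)) (<-≤-trans (0<2-ρ m) (≈⇒≤ (≈-sym (4-ρ² m)))))
    (≤-by (0≤*0≤ (0≤*0≤ (0≤ℚ→ℝ (½ ℚ.* ½)) (x≤y⇒0≤y-x (ρ≤2 (suc m)))) (x≤y⇒0≤y-x (ρ≤2 (suc m))))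
      (solve 1 (λ x → con (½ ℚ.* ½) :* (con 2ℚ :- x) :* (con 2ℚ :- x) :=
        (con 2ℚ :- x) :- con (½ ℚ.* ½) :* (con (+ 4 ℚ./ 1) :- x :* x)) ≈-refl (ρ (suc m))))

  -- For x = `ρ (suc m)` the product (2 - x)(2 + x) is at least 2(2 - x), and it equals 2 - `ρ m`.
  2-ρ-halves : ∀ m → 2ᴿ -ᴿ ρ (suc m) ≤ᴿ ½ᴿ *ᴿ (2ᴿ -ᴿ ρ m)
  2-ρ-halves m = ≤-trans
    (≤-by (0≤*0≤ (0≤*0≤ 0≤½ (x≤y⇒0≤y-x (ρ≤2 (suc m)))) (0≤ρ (suc m)))
      (solve 1 (λ x → con ½ :* (con 2ℚ :- x) :* x :=
        con ½ :* (con (+ 4 ℚ./ 1) :- x :* x) :- (con 2ℚ :- x)) ≈-refl (ρ (suc m))))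
    (≈⇒≤ (*-cong ≈-refl (4-ρ² m)))

  0<4-ρ² : ∀ m → 0ᴿ <ᴿ # 4 -ᴿ ρ m *ᴿ ρ m
  0<4-ρ² zero    = <-≤-trans (ℚ→ℝ-pos (ℚ.positive⁻¹ (+ 4 ℚ./ 1)))
    (≈⇒≤ (solve 0 (con (+ 4 ℚ./ 1) := con (+ 4 ℚ./ 1) :- con 0ℚ :* con 0ℚ) ≈-refl))
  0<4-ρ² (suc m) = <-≤-trans (0<2-ρ m) (≈⇒≤ (≈-sym (4-ρ² m)))

  -- Halving at each step suffices, since half of 1/(m + 1) is at most 1/(m + 2). This rate has the
  -- form that `recip-eventually-≤` handles.
  2-ρ≤ : ∀ m → 2ᴿ -ᴿ ρ m ≤ᴿ 2ᴿ *ᴿ ℚ→ℝ (+ 1 ℚ./ suc m)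
  2-ρ≤ zero    = ≈⇒≤ (solve 0 (con 2ℚ :- con 0ℚ := con 2ℚ :* con 1ℚ) ≈-refl)
  2-ρ≤ (suc m) = ≤-trans (2-ρ-halves m) $ ≤-trans (*-monoʳ-≤ ½ᴿ 0≤½ (2-ρ≤ m)) $
    ≤-trans (≈⇒≤ (solve 1 (λ x → con ½ :* (con 2ℚ :* x) := con 2ℚ :* (con ½ :* x)) ≈-refl (ℚ→ℝ (+ 1 ℚ./ suc m)))) $
    *-monoʳ-≤ 2ᴿ (0≤ℚ→ℝ 2ℚ) (pointwise-≤ λ _ → half-recip m)

  -- For y = 2 cos t the map y ↦ y² - 2 doubles the angle, so the condition says cos (2ᵐ t) = 0: t
  -- is an odd multiple of π / 2ᵐ⁺¹.
  IterZero : ℕ → ℝ → Set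
  IterZero zero    y = y ≈ᴿ 0ᴿ
  IterZero (suc m) y = IterZero m (y *ᴿ y -ᴿ 2ᴿ)

  IterZero-resp : ∀ m {x y} → x ≈ᴿ y → IterZero m x → IterZero m y
  IterZero-resp zero    e h = ≈-trans (≈-sym e) h
  IterZero-resp (suc m) e h = IterZero-resp m (+-cong (*-cong e e) ≈-refl) h

  IterZero⇒U≈0 : ∀ m {y} → IterZero m y → U y (pow₂ m) ≈ᴿ 0ᴿ
  IterZero⇒U≈0 zero    {y} h = ≈-trans (solve 1 (λ y → y :* con 1ℚ :- con 0ℚ := y) ≈-refl y) h
  IterZero⇒U≈0 (suc m) {y} h = ≈-trans (U-double y (pow₂ m)) $
    ≈-trans (*-cong ≈-refl (IterZero⇒U≈0 m h)) (CommutativeRing.zeroʳ ℝ-commutativeRing y)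

  -- Angle doubling turns 2 cos (jπ / 2ᵐ⁺²) into 2 cos (jπ / 2ᵐ⁺¹) with the same odd j, and the
  -- chain ends at 2 cos (jπ/2) = 0.
  T-odd-IterZero : ∀ m i → IterZero m (T (ρ m) (suc (double i)))
  T-odd-IterZero zero    i = T-odd-zero i ≈-refl
  T-odd-IterZero (suc m) i = IterZero-resp m
    (≈-trans (T-cong (suc (double i)) (≈-sym (ρ-suc²-2 m))) (T-square (ρ (suc m)) (suc (double i))))
    (T-odd-IterZero m i)

  -- The value 2 cos π, reached by doubling the angle down to `ρ zero`. It is the far end of the
  -- search for a prescribed height.
  T-end : ∀ m → T (ρ m) (pow₂ m) ≈ᴿ -ᴿ 2ᴿ
  T-end zero    = solve 0 (con 0ℚ :* con 0ℚ :- con 2ℚ := :- con 2ℚ) ≈-refl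
  T-end (suc m) = ≈-trans (T-double (ρ (suc m)) (pow₂ m)) (≈-trans (T-cong (pow₂ m) (ρ-suc²-2 m)) (T-end m))

  -- Completing the square in the invariant turns (4 - x²)(4 - c²) into (2c′ - xc)².
  4-c²-bound : ∀ x c c′ → c *ᴿ c +ᴿ c′ *ᴿ c′ -ᴿ x *ᴿ c *ᴿ c′ ≈ᴿ # 4 -ᴿ x *ᴿ x →
    0ᴿ ≤ᴿ (# 4 -ᴿ x *ᴿ x) *ᴿ (# 4 -ᴿ c *ᴿ c)
  4-c²-bound x c c′ e = ≤-trans (0≤² (2ᴿ *ᴿ c′ -ᴿ x *ᴿ c)) $ ≈⇒≤ $ unvanish $
    ≈-trans (solve 3 (λ x c c′ → let 4ℚ = con (+ 4 ℚ./ 1) ; d = con 2ℚ :* c′ :- x :* c in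
      d :* d :- (4ℚ :- x :* x) :* (4ℚ :- c :* c) :=
      4ℚ :* ((c :* c :+ c′ :* c′ :- x :* c :* c′) :- (4ℚ :- x :* x))
        :+ con 0ℚ :* con 0ℚ :+ con 0ℚ :* con 0ℚ) ≈-refl x c c′) $
    combine₃ (# 4) 0ᴿ 0ᴿ (vanish e) ≈-refl ≈-refl

  T-bounded : ∀ m n → T (ρ m) n *ᴿ T (ρ m) n ≤ᴿ # 4
  T-bounded m n = 0≤y-x⇒x≤y $
    *-cancel-0≤ (0<4-ρ² m) (4-c²-bound (ρ m) (T (ρ m) n) (T (ρ m) (suc n)) (T-invariant (ρ m) n))

  -- The invariant reads (c - c′)² = (2 - x)(2 + x - cc′), and the second factor is at most 8
  -- because x ≤ 2 and cc′ ≥ -4.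
  step-bound : ∀ x c c′ → x ≤ᴿ 2ᴿ → c *ᴿ c ≤ᴿ # 4 → c′ *ᴿ c′ ≤ᴿ # 4 →
    c *ᴿ c +ᴿ c′ *ᴿ c′ -ᴿ x *ᴿ c *ᴿ c′ ≈ᴿ # 4 -ᴿ x *ᴿ x →
    (c -ᴿ c′) *ᴿ (c -ᴿ c′) ≤ᴿ # 8 *ᴿ (2ᴿ -ᴿ x)
  step-bound x c c′ hx hc hc′ e = ≤-by
    (0≤*0≤ (x≤y⇒0≤y-x hx) (0≤+0≤ (x≤y⇒0≤y-x hx)
      (0≤*0≤ 0≤½ (0≤+0≤ (0≤+0≤ (0≤² (c +ᴿ c′)) (x≤y⇒0≤y-x hc)) (x≤y⇒0≤y-x hc′))))) $
    unvanish $ ≈-trans (solve 3 (λ x c c′ → let 4ℚ = con (+ 4 ℚ./ 1) in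
      (con 2ℚ :- x) :* ((con 2ℚ :- x) :+ con ½ :* ((c :+ c′) :* (c :+ c′) :+ (4ℚ :- c :* c) :+ (4ℚ :- c′ :* c′)))
        :- (con (+ 8 ℚ./ 1) :* (con 2ℚ :- x) :- (c :- c′) :* (c :- c′)) :=
      con 1ℚ :* ((c :* c :+ c′ :* c′ :- x :* c :* c′) :- (4ℚ :- x :* x))
        :+ con 0ℚ :* con 0ℚ :+ con 0ℚ :* con 0ℚ) ≈-refl x c c′) $
    combine₃ 1ᴿ 0ᴿ 0ᴿ (vanish e) ≈-refl ≈-refl

  T-step : ∀ m n → let d = T (ρ m) n -ᴿ T (ρ m) (suc n) in d *ᴿ d ≤ᴿ # 8 *ᴿ (2ᴿ -ᴿ ρ m)
  T-step m n = step-bound (ρ m) (T (ρ m) n) (T (ρ m) (suc n))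
    (ρ≤2 m) (T-bounded m n) (T-bounded m (suc n)) (T-invariant (ρ m) n)

-- From Chebyshev zeros to zeros of F

¼ : ℚ
¼ = ½ ℚ.* ½

4ℚ : ℚ
4ℚ = + 4 ℚ./ 1

-- Searches from the left. Exact comparison is undecidable, so `<⊎≥` is used with slack δ: either V
-- 0 is below v + 2δ and the search stops, or V 0 is at least v + δ and the next value still lies
-- above v.
discrete-ivt : ∀ (V : ℕ → ℝ) J {v δ} → 0ℚ ℚ.< δ → v ≤ᴿ V 0 → V J ≤ᴿ v →
  (∀ j → V j ≤ᴿ V (suc j) +ᴿ ℚ→ℝ δ) → ∃[ j ] (v ≤ᴿ V j × V j ≤ᴿ v +ᴿ ℚ→ℝ δ +ᴿ ℚ→ℝ δ)
discrete-ivt V zero    {v} {δ} δ>0 start end step = 0 , start , ≤-trans end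
  (≤-by (0≤+0≤ (ℚ→ℝ-mono-≤ (ℚ.<⇒≤ δ>0)) (ℚ→ℝ-mono-≤ (ℚ.<⇒≤ δ>0)))
    (solve 2 (λ v δ → δ :+ δ := v :+ δ :+ δ :- v) ≈-refl v (ℚ→ℝ δ)))
  where open ℝ-Solver
discrete-ivt V (suc J) {v} {δ} δ>0 start end step = search (<⊎≥ (V 0) (v +ᴿ ℚ→ℝ δ) δ>0)
  where
  open ℝ-Solver
  next : v +ᴿ ℚ→ℝ δ ≤ᴿ V 0 → v ≤ᴿ V 1
  next far = ≤-by (x≤y⇒0≤y-x (≤-trans far (step 0)))
    (solve 3 (λ v δ w → (w :+ δ) :- (v :+ δ) := w :- v) ≈-refl v (ℚ→ℝ δ) (V 1))
  search : V 0 <ᴿ v +ᴿ ℚ→ℝ δ +ᴿ ℚ→ℝ δ ⊎ v +ᴿ ℚ→ℝ δ ≤ᴿ V 0 →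
    ∃[ j ] (v ≤ᴿ V j × V j ≤ᴿ v +ᴿ ℚ→ℝ δ +ᴿ ℚ→ℝ δ)
  search (inj₁ near) = 0 , start , <⇒≤ near
  search (inj₂ far)  = let j , h = discrete-ivt (V ∘ suc) J δ>0 (next far) end (step ∘ suc) in suc j , h

²-bound : ∀ {x e} → x ≤ᴿ e → -ᴿ e ≤ᴿ x → x *ᴿ x ≤ᴿ e *ᴿ e
²-bound {x} {e} h k = ≤-by (0≤*0≤ (x≤y⇒0≤y-x h) (x≤y⇒0≤y-x k))
  (solve 2 (λ x e → (e :- x) :* (x :- :- e) := e :* e :- x :* x) ≈-refl x e)
  where open ℝ-Solver

+²≤ : ∀ {x y} → x *ᴿ x ≤ᴿ # 4 → y *ᴿ y ≤ᴿ # 4 → (x +ᴿ y) *ᴿ (x +ᴿ y) ≤ᴿ # 16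
+²≤ {x} {y} hx hy = ≤-by
  (0≤+0≤ (0≤² (x -ᴿ y)) (0≤*0≤ (0≤ℚ→ℝ 2ℚ) (0≤+0≤ (x≤y⇒0≤y-x hx) (x≤y⇒0≤y-x hy))))
  (solve 2 (λ x y → (x :- y) :* (x :- y) :+ con 2ℚ :* ((con 4ℚ :- x :* x) :+ (con 4ℚ :- y :* y)) :=
     con (+ 16 ℚ./ 1) :- (x :+ y) :* (x :+ y)) ≈-refl x y)
  where open ℝ-Solver

*-mono-≤ : ∀ {x y u v} → 0ᴿ ≤ᴿ u → u ≤ᴿ v → 0ᴿ ≤ᴿ x → x ≤ᴿ y → u *ᴿ x ≤ᴿ v *ᴿ y
*-mono-≤ {x} {y} {u} {v} 0≤u u≤v 0≤x x≤y = ≤-trans (*-monoʳ-≤ u 0≤u x≤y) $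
  ≤-trans (≈⇒≤ (*-comm u y)) $ ≤-trans (*-monoʳ-≤ y (≤-trans 0≤x x≤y) u≤v) (≈⇒≤ (*-comm y v))

module _ {y s y′ s′ : ℝ} (y²≤4 : y *ᴿ y ≤ᴿ # 4) (y′²≤4 : y′ *ᴿ y′ ≤ᴿ # 4)
  (1≤s : 1ᴿ ≤ᴿ s) (1≤s′ : 1ᴿ ≤ᴿ s′)
  (s² : s *ᴿ s ≈ᴿ 2ᴿ -ᴿ ℚ→ℝ ¼ *ᴿ (y *ᴿ y)) (s′² : s′ *ᴿ s′ ≈ᴿ 2ᴿ -ᴿ ℚ→ℝ ¼ *ᴿ (y′ *ᴿ y′)) where
  open ℝ-Solver

  private
    Δ² σ² : ℝ
    Δ² = (y -ᴿ y′) *ᴿ (y -ᴿ y′)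
    σ² = (s -ᴿ s′) *ᴿ (s -ᴿ s′)

    4≤[s+s′]² : # 4 ≤ᴿ (s +ᴿ s′) *ᴿ (s +ᴿ s′)
    4≤[s+s′]² = ≤-trans (≈⇒≤ (solve 0 (con 4ℚ := con 2ℚ :* con 2ℚ) ≈-refl))
      (*-mono-≤ (0≤ℚ→ℝ 2ℚ) 2≤ (0≤ℚ→ℝ 2ℚ) 2≤)
      where
      2≤ : 2ᴿ ≤ᴿ s +ᴿ s′
      2≤ = ≤-trans (≈⇒≤ (solve 0 (con 2ℚ := con 1ℚ :+ con 1ℚ) ≈-refl)) (+-mono-≤ 1≤s 1≤s′)

    -- As s + s′ ≥ 2, the left side is at most (s² - s′²)² = (y - y′)²(y + y′)²/16, and (y + y′)² ≤
    -- 16.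
    4σ²≤Δ² : # 4 *ᴿ σ² ≤ᴿ Δ²
    4σ²≤Δ² = ≤-trans (*-mono-≤ (0≤ℚ→ℝ 4ℚ) 4≤[s+s′]² (0≤² (s -ᴿ s′)) ≤-refl) $
      ≤-trans (≈⇒≤ (≈-trans (solve 2 (λ s s′ → ((s :+ s′) :* (s :+ s′)) :* ((s :- s′) :* (s :- s′)) :=
                  (s :* s :- s′ :* s′) :* (s :* s :- s′ :* s′)) ≈-refl s s′)
                (≈-trans (*-cong d d) (solve 2 (λ y y′ → let ¼ℝ = con ¼ in
                  (¼ℝ :* (y′ :* y′ :- y :* y)) :* (¼ℝ :* (y′ :* y′ :- y :* y)) :=
                  con (¼ ℚ.* ¼) :* (((y :- y′) :* (y :- y′)) :* ((y :+ y′) :* (y :+ y′)))) ≈-refl y y′)))) $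
      ≤-trans (*-monoʳ-≤ (ℚ→ℝ (¼ ℚ.* ¼)) (0≤ℚ→ℝ _) (*-monoʳ-≤ Δ² (0≤² (y -ᴿ y′)) (+²≤ y²≤4 y′²≤4))) $
      ≈⇒≤ (solve 1 (λ d → con (¼ ℚ.* ¼) :* (d :* con (+ 16 ℚ./ 1)) := d) ≈-refl Δ²)
      where
      d : s *ᴿ s -ᴿ s′ *ᴿ s′ ≈ᴿ ℚ→ℝ ¼ *ᴿ (y′ *ᴿ y′ -ᴿ y *ᴿ y)
      d = ≈-trans (+-cong s² (-‿cong s′²)) (solve 2 (λ y y′ →
        (con 2ℚ :- con ¼ :* (y :* y)) :- (con 2ℚ :- con ¼ :* (y′ :* y′)) :=
        con ¼ :* (y′ :* y′ :- y :* y)) ≈-refl y y′)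

    s²≤2 : s *ᴿ s ≤ᴿ 2ᴿ
    s²≤2 = ≤-by (0≤*0≤ (0≤ℚ→ℝ ¼) (0≤² y)) $ ≈-trans
      (solve 1 (λ y → con ¼ :* (y :* y) := con 2ℚ :- (con 2ℚ :- con ¼ :* (y :* y))) ≈-refl y)
      (+-cong ≈-refl (-‿cong (≈-sym s²)))

  -- y s − y′ s′ = (y − y′) s + y′ (s − s′).
  height-lipschitz : (y *ᴿ s -ᴿ y′ *ᴿ s′) *ᴿ (y *ᴿ s -ᴿ y′ *ᴿ s′) ≤ᴿ # 6 *ᴿ Δ²
  height-lipschitz = ≤-trans
    (≤-by (0≤² ((y -ᴿ y′) *ᴿ s -ᴿ y′ *ᴿ (s -ᴿ s′))) (solve 4 (λ y s y′ s′ →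
      let u = (y :- y′) :* s ; v = y′ :* (s :- s′) ; w = y :* s :- y′ :* s′ in
      (u :- v) :* (u :- v) := con 2ℚ :* (((y :- y′) :* (y :- y′)) :* (s :* s)) :+
        con 2ℚ :* ((y′ :* y′) :* ((s :- s′) :* (s :- s′))) :- w :* w) ≈-refl y s y′ s′)) $
    ≤-trans (+-mono-≤ (*-monoʳ-≤ 2ᴿ (0≤ℚ→ℝ 2ℚ) (*-monoʳ-≤ Δ² (0≤² (y -ᴿ y′)) s²≤2))
      (*-monoʳ-≤ 2ᴿ (0≤ℚ→ℝ 2ℚ) (≤-trans (*-mono-≤ (0≤² y′) y′²≤4 (0≤² (s -ᴿ s′)) ≤-refl) 4σ²≤Δ²))) $
    ≈⇒≤ (solve 1 (λ d → con 2ℚ :* (d :* con 2ℚ) :+ con 2ℚ :* d := con (+ 6 ℚ./ 1) :* d) ≈-refl Δ²)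

module _ (y : ℝ) where

  slope² slope : ℝ
  slope² = 2ᴿ -ᴿ ℚ→ℝ ¼ *ᴿ (y *ᴿ y)
  slope  = √ᴿ slope²

  -- With s = slope y and μ = y/2 + i s one has 1 + z = μ y and z − 1 = μ² for z = zeroAt y.
  zeroAt : ℂ
  zeroAt = (ℚ→ℝ ½ *ᴿ (y *ᴿ y) -ᴿ 1ᴿ) +i (y *ᴿ slope)

module _ {y : ℝ} (y²≤4 : y *ᴿ y ≤ᴿ # 4) where
  open ℝ-Solver

  1≤slope² : 1ᴿ ≤ᴿ slope² y
  1≤slope² = ≤-by (0≤*0≤ (0≤ℚ→ℝ ¼) (x≤y⇒0≤y-x y²≤4))
    (solve 1 (λ a → con ¼ :* (con 4ℚ :- a) := (con 2ℚ :- con ¼ :* a) :- con 1ℚ) ≈-refl (y *ᴿ y))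

  slope-square : slope y *ᴿ slope y ≈ᴿ slope² y
  slope-square = √ᴿ-square _ (≤-trans (0≤ℚ→ℝ 1ℚ) 1≤slope²)

  1≤slope : 1ᴿ ≤ᴿ slope y
  1≤slope = ²-cancel-≤ (√ᴿ-nonNeg _)
    (≤-trans (≈⇒≤ (solve 0 (con 1ℚ :* con 1ℚ := con 1ℚ) ≈-refl)) (≤-trans 1≤slope² (≈⇒≤ (≈-sym slope-square))))

module _ where
  open ℂ-Solver

  z*1+w*0≈z : ∀ a b → a *ᶜ 1ᶜ +ᶜ b *ᶜ 0ᶜ ≈ᶜ a
  z*1+w*0≈z = solve 2 (λ a b → a :* con 1ℚ :+ b :* con 0ℚ := a) ≈ᶜ-refl

  z*w≈z*1*w : ∀ a b → a *ᶜ b ≈ᶜ (a *ᶜ 1ᶜ) *ᶜ b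
  z*w≈z*1*w = solve 2 (λ a b → a :* b := (a :* con 1ℚ) :* b) ≈ᶜ-refl

  -- After the substitutions 1 + z = μy and 1 - z = -μ², the factor μ²p comes out of the recurrence
  -- for `Φ` and leaves that for `U`.
  scaled-step : ∀ μ p y a b →
    (μ *ᶜ y) *ᶜ ((μ *ᶜ p) *ᶜ a) +ᶜ (-ᶜ (μ *ᶜ μ)) *ᶜ (p *ᶜ b) ≈ᶜ (μ *ᶜ (μ *ᶜ p)) *ᶜ (y *ᶜ a -ᶜ b)
  scaled-step = solve 5 (λ μ p y a b →
    (μ :* y) :* ((μ :* p) :* a) :+ (:- (μ :* μ)) :* (p :* b) := (μ :* (μ :* p)) :* (y :* a :- b)) ≈ᶜ-refl

module _ {y s : ℝ} (s² : s *ᴿ s ≈ᴿ 2ᴿ -ᴿ ℚ→ℝ ¼ *ᴿ (y *ᴿ y)) where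
  open ℝ-Solver

  private
    μ z : ℂ
    μ = (ℚ→ℝ ½ *ᴿ y) +i s
    z = (ℚ→ℝ ½ *ᴿ (y *ᴿ y) -ᴿ 1ᴿ) +i (y *ᴿ s)

    1+z : 1ᶜ +ᶜ z ≈ᶜ μ *ᶜ ι y
    1+z = solve 2 (λ y s → con 1ℚ :+ (con ½ :* (y :* y) :- con 1ℚ) := con ½ :* y :* y :- s :* con 0ℚ) ≈-refl y s
       ,ᶜ solve 2 (λ y s → con 0ℚ :+ y :* s := con ½ :* y :* con 0ℚ :+ s :* y) ≈-refl y s

    1-z : 1ᶜ -ᶜ z ≈ᶜ -ᶜ (μ *ᶜ μ)
    1-z = ≈-trans (solve 1 (λ y → con 1ℚ :- (con ½ :* (y :* y) :- con 1ℚ) :=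
                     :- ((con ½ :* y) :* (con ½ :* y) :- (con 2ℚ :- con ¼ :* (y :* y)))) ≈-refl y)
            (-‿cong (+-cong ≈-refl (-‿cong (≈-sym s²))))
       ,ᶜ solve 2 (λ y s → con 0ℚ :- y :* s := :- ((con ½ :* y) :* s :+ s :* (con ½ :* y))) ≈-refl y s

  -- The left side is (2 - y²/2)² + y²(2 - y²/4), where the terms in y² and y⁴ cancel.
  circle : (1ᴿ -ᴿ re z) *ᴿ (1ᴿ -ᴿ re z) +ᴿ im z *ᴿ im z ≈ᴿ # 4
  circle = ≈-trans (+-cong ≈-refl (≈-trans
      (solve 2 (λ y s → (y :* s) :* (y :* s) := (y :* y) :* (s :* s)) ≈-refl y s) (*-cong ≈-refl s²)))
    (solve 1 (λ a → (con 1ℚ :- (con ½ :* a :- con 1ℚ)) :* (con 1ℚ :- (con ½ :* a :- con 1ℚ)) :+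
        a :* (con 2ℚ :- con ¼ :* a) := con 4ℚ) ≈-refl (y *ᴿ y))

  Φ≈U : ∀ n → Φ z (suc n) ≈ᶜ μ ^ᶜ n *ᶜ ι (U y (suc n))
  Φ≈U zero          = ≈ᶜ-sym (CommutativeRing.*-identityˡ ℂ-commutativeRing 1ᶜ)
  Φ≈U (suc zero)    = ≈ᶜ-trans (≈ᶜ-trans (z*1+w*0≈z (1ᶜ +ᶜ z) (1ᶜ -ᶜ z)) 1+z) $
    ≈ᶜ-trans (z*w≈z*1*w μ (ι y)) (*ᶜ-cong ≈ᶜ-refl (ι-cong (solve 1 (λ y → y := y :* con 1ℚ :- con 0ℚ) ≈-refl y)))
  Φ≈U (suc (suc n)) = ≈ᶜ-trans (+ᶜ-cong (*ᶜ-cong 1+z (Φ≈U (suc n))) (*ᶜ-cong 1-z (Φ≈U n))) $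
    ≈ᶜ-trans (scaled-step μ (μ ^ᶜ n) (ι y) (ι (U y (suc (suc n)))) (ι (U y (suc n)))) $
    *ᶜ-cong ≈ᶜ-refl (≈ᶜ-sym (≈ᶜ-trans (ι-- (y *ᴿ U y (suc (suc n))) (U y (suc n)))
      (+ᶜ-cong (ι-* y (U y (suc (suc n)))) ≈ᶜ-refl)))

  F≈U : ∀ n → F (suc n) z ≈ᶜ μ ^ᶜ n *ᶜ ι (U y (suc n))
  F≈U n = ≈ᶜ-trans (F≈Φ z n) (Φ≈U n)

-- On the circle, (x − x′)⁴ ≤ (x − x′)²(x + x′)² = (v − v′)²(v + v′)² for x = 1 − u and x′ = 1 − u′.
module _ {u v u′ v′ e : ℝ}
  (on : (1ᴿ -ᴿ u) *ᴿ (1ᴿ -ᴿ u) +ᴿ v *ᴿ v ≈ᴿ # 4) (on′ : (1ᴿ -ᴿ u′) *ᴿ (1ᴿ -ᴿ u′) +ᴿ v′ *ᴿ v′ ≈ᴿ # 4)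
  (u≤1 : u ≤ᴿ 1ᴿ) (u′≤1 : u′ ≤ᴿ 1ᴿ) (0≤e : 0ᴿ ≤ᴿ e) (near : (v -ᴿ v′) *ᴿ (v -ᴿ v′) ≤ᴿ e *ᴿ e) where
  open ℝ-Solver

  private
    height²≤4 : ∀ {u v} → (1ᴿ -ᴿ u) *ᴿ (1ᴿ -ᴿ u) +ᴿ v *ᴿ v ≈ᴿ # 4 → v *ᴿ v ≤ᴿ # 4
    height²≤4 {u} {v} h = ≤-by (0≤² (1ᴿ -ᴿ u)) $
      ≈-trans (solve 2 (λ a b → a := a :+ b :- b) ≈-refl ((1ᴿ -ᴿ u) *ᴿ (1ᴿ -ᴿ u)) (v *ᴿ v)) (+-cong h ≈-refl)

    d² : ℝ
    d² = (u -ᴿ u′) *ᴿ (u -ᴿ u′)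

    swap-coordinates : ((1ᴿ -ᴿ u) -ᴿ (1ᴿ -ᴿ u′)) *ᴿ ((1ᴿ -ᴿ u) +ᴿ (1ᴿ -ᴿ u′)) ≈ᴿ -ᴿ ((v -ᴿ v′) *ᴿ (v +ᴿ v′))
    swap-coordinates = unvanish $ ≈-trans (solve 4 (λ a b v v′ →
        (a :- b) :* (a :+ b) :- (:- ((v :- v′) :* (v :+ v′))) :=
        con 1ℚ :* ((a :* a :+ v :* v) :- con 4ℚ) :+ :- con 1ℚ :* ((b :* b :+ v′ :* v′) :- con 4ℚ)
          :+ con 0ℚ :* con 0ℚ) ≈-refl (1ᴿ -ᴿ u) (1ᴿ -ᴿ u′) v v′) $
      combine₃ 1ᴿ (-ᴿ 1ᴿ) 0ᴿ (vanish on) (vanish on′) ≈-refl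

    d⁴≤ : d² *ᴿ d² ≤ᴿ (# 4 *ᴿ e) *ᴿ (# 4 *ᴿ e)
    d⁴≤ = ≤-trans (≤-by (0≤*0≤ (0≤² (u -ᴿ u′)) (0≤*0≤ (0≤ℚ→ℝ 4ℚ) (0≤*0≤ (x≤y⇒0≤y-x u≤1) (x≤y⇒0≤y-x u′≤1))))
        (solve 2 (λ u u′ → let d = u :- u′ ; a = con 1ℚ :- u ; b = con 1ℚ :- u′ in
          (d :* d) :* (con 4ℚ :* (a :* b)) :=
          ((a :- b) :* (a :+ b)) :* ((a :- b) :* (a :+ b)) :- (d :* d) :* (d :* d)) ≈-refl u u′)) $
      ≤-trans (≈⇒≤ (≈-trans (*-cong swap-coordinates swap-coordinates)
        (solve 2 (λ v v′ → (:- ((v :- v′) :* (v :+ v′))) :* (:- ((v :- v′) :* (v :+ v′))) :=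
          ((v :- v′) :* (v :- v′)) :* ((v :+ v′) :* (v :+ v′))) ≈-refl v v′))) $
      ≤-trans (*-mono-≤ (0≤² (v -ᴿ v′)) near (0≤² (v +ᴿ v′)) (+²≤ (height²≤4 on) (height²≤4 on′))) $
      ≈⇒≤ (solve 1 (λ e → (e :* e) :* con (+ 16 ℚ./ 1) := (con 4ℚ :* e) :* (con 4ℚ :* e)) ≈-refl e)

  distance-by-height : (u -ᴿ u′) *ᴿ (u -ᴿ u′) +ᴿ (v -ᴿ v′) *ᴿ (v -ᴿ v′) ≤ᴿ # 4 *ᴿ e +ᴿ e *ᴿ e
  distance-by-height = +-mono-≤ (²-cancel-≤ (0≤*0≤ (0≤ℚ→ℝ 4ℚ) 0≤e) d⁴≤) near

-- Density

height : ℝ → ℝ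
height y = y *ᴿ slope y

small-steps : ∀ {δ} → 0ℚ ℚ.< δ → ∃[ m ] # 6 *ᴿ (# 8 *ᴿ (2ᴿ -ᴿ ρ m)) ≤ᴿ ℚ→ℝ δ *ᴿ ℚ→ℝ δ
small-steps {δ} δ>0 =
  -- 96 = 6 · 8 · 2 collects the constants of `height-lipschitz`, `T-step` and `2-ρ≤`.
  let κ = + 1 ℚ./ 96 ℚ.* (δ ℚ.* δ)
      m , recip≤κ = eventually-witness (recip-eventually-≤ κ
        (*-pos (ℚ.positive⁻¹ (+ 1 ℚ./ 96)) (*-pos δ>0 δ>0)))
  in m , ≤-trans (*-monoʳ-≤ (# 6) (0≤ℚ→ℝ _) $ *-monoʳ-≤ (# 8) (0≤ℚ→ℝ _) $ ≤-trans (2-ρ≤ m) $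
           *-monoʳ-≤ 2ᴿ (0≤ℚ→ℝ 2ℚ) (pointwise-≤ {y = ℚ→ℝ (+ 1 ℚ./ 96) *ᴿ (ℚ→ℝ δ *ᴿ ℚ→ℝ δ)} λ _ → recip≤κ))
         (≈⇒≤ (solve 1 (λ d →
             con (+ 6 ℚ./ 1) :* (con (+ 8 ℚ./ 1) :* (con 2ℚ :* (con (+ 1 ℚ./ 96) :* (d :* d)))) := d :* d)
           ≈-refl (ℚ→ℝ δ)))
  where open ℝ-Solver

parity : ∀ j → (∃[ i ] j ≡ double i) ⊎ (∃[ i ] j ≡ suc (double i))
parity zero    = inj₁ (0 , ≡.refl)
parity (suc j) with parity j
... | inj₁ (i , e) = inj₂ (i , ≡.cong suc e)
... | inj₂ (i , e) = inj₁ (suc i , ≡.cong suc e)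

difference-≤ : ∀ {x y e} → 0ᴿ ≤ᴿ e → (x -ᴿ y) *ᴿ (x -ᴿ y) ≤ᴿ e *ᴿ e → x ≤ᴿ y +ᴿ e
difference-≤ {x} {y} {e} 0≤e h = ≤-by (x≤y⇒0≤y-x (²-cancel-≤ 0≤e h))
  (solve 3 (λ x y e → e :- (x :- y) := (y :+ e) :- x) ≈-refl x y e)
  where open ℝ-Solver

module _ {v : ℝ} (v²≤4 : v *ᴿ v ≤ᴿ # 4) {δ : ℚ} (δ>0 : 0ℚ ℚ.< δ)
  (m : ℕ) (small : # 6 *ᴿ (# 8 *ᴿ (2ᴿ -ᴿ ρ m)) ≤ᴿ ℚ→ℝ δ *ᴿ ℚ→ℝ δ) where
  open ℝ-Solver

  private
    V : ℕ → ℝ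
    V j = height (T (ρ m) j)

    0≤δ : 0ᴿ ≤ᴿ ℚ→ℝ δ
    0≤δ = ℚ→ℝ-mono-≤ (ℚ.<⇒≤ δ>0)

    steps : ∀ j → (V j -ᴿ V (suc j)) *ᴿ (V j -ᴿ V (suc j)) ≤ᴿ ℚ→ℝ δ *ᴿ ℚ→ℝ δ
    steps j = ≤-trans (height-lipschitz
      (b j) (b (suc j)) (1≤slope (b j)) (1≤slope (b (suc j))) (slope-square (b j)) (slope-square (b (suc j)))) $
      ≤-trans (*-monoʳ-≤ (# 6) (0≤ℚ→ℝ _) (T-step m j)) small
      where b = T-bounded m

    down : ∀ j → V j ≤ᴿ V (suc j) +ᴿ ℚ→ℝ δ
    down j = difference-≤ 0≤δ (steps j)

    up : ∀ j → V (suc j) ≤ᴿ V j +ᴿ ℚ→ℝ δ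
    up j = difference-≤ 0≤δ (≤-trans
      (≈⇒≤ (solve 2 (λ x y → (x :- y) :* (x :- y) := (y :- x) :* (y :- x)) ≈-refl (V (suc j)) (V j)))
      (steps j))

    -2≤v : -ᴿ 2ᴿ ≤ᴿ v
    -2≤v = ≤-by (x≤y⇒0≤y-x (²-cancel-≤ { -ᴿ v} (0≤ℚ→ℝ 2ℚ)
      (≤-trans (≈⇒≤ (solve 1 (λ v → :- v :* :- v := v :* v) ≈-refl v))
      (≤-trans v²≤4 (≈⇒≤ (solve 0 (con 4ℚ := con 2ℚ :* con 2ℚ) ≈-refl))))))
      (solve 1 (λ v → con 2ℚ :- :- v := v :- :- con 2ℚ) ≈-refl v)

    v≤2 : v ≤ᴿ 2ᴿ
    v≤2 = ²-cancel-≤ (0≤ℚ→ℝ 2ℚ) (≤-trans v²≤4 (≈⇒≤ (solve 0 (con 4ℚ := con 2ℚ :* con 2ℚ) ≈-refl)))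

    -- `T` starts at 2 and the slope is at least 1, so the first height is at least 2;
    -- symmetrically, `end` has height at most -2.
    start : v ≤ᴿ V 0
    start = ≤-trans v≤2 $ ≤-trans (≈⇒≤ (solve 0 (con 2ℚ := con 2ℚ :* con 1ℚ) ≈-refl)) $
      *-monoʳ-≤ 2ᴿ (0≤ℚ→ℝ 2ℚ) (1≤slope (T-bounded m 0))

    end : V (pow₂ m) ≤ᴿ v
    end = ≤-trans (≈⇒≤ (*-cong (T-end m) ≈-refl)) $
      ≤-trans (scaled (slope (T (ρ m) (pow₂ m))) (1≤slope (T-bounded m (pow₂ m)))) -2≤v
      where
      scaled : ∀ s → 1ᴿ ≤ᴿ s → (-ᴿ 2ᴿ) *ᴿ s ≤ᴿ -ᴿ 2ᴿ
      scaled s h = ≤-by (0≤*0≤ (0≤ℚ→ℝ 2ℚ) (x≤y⇒0≤y-x h))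
        (solve 1 (λ s → con 2ℚ :* (s :- con 1ℚ) := :- con 2ℚ :- (:- con 2ℚ) :* s) ≈-refl s)

    near : ∀ {x y} → v ≤ᴿ x → x ≤ᴿ v +ᴿ ℚ→ℝ δ +ᴿ ℚ→ℝ δ → x ≤ᴿ y +ᴿ ℚ→ℝ δ → y ≤ᴿ x +ᴿ ℚ→ℝ δ →
      (y -ᴿ v) *ᴿ (y -ᴿ v) ≤ᴿ (# 3 *ᴿ ℚ→ℝ δ) *ᴿ (# 3 *ᴿ ℚ→ℝ δ)
    near {x} {y} v≤x x≤v x≤y y≤x = ²-bound
      (≤-by (0≤+0≤ (x≤y⇒0≤y-x x≤v) (x≤y⇒0≤y-x y≤x)) (solve 4 (λ v x y d →
        ((v :+ d :+ d) :- x) :+ ((x :+ d) :- y) := con (+ 3 ℚ./ 1) :* d :- (y :- v)) ≈-refl v x y (ℚ→ℝ δ)))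
      (≤-by (0≤+0≤ (0≤+0≤ (x≤y⇒0≤y-x v≤x) (x≤y⇒0≤y-x x≤y)) (0≤+0≤ 0≤δ 0≤δ)) (solve 4 (λ v x y d →
        (x :- v) :+ ((y :+ d) :- x) :+ (d :+ d) := (y :- v) :- :- (con (+ 3 ℚ./ 1) :* d)) ≈-refl v x y (ℚ→ℝ δ)))

  -- The search gives an index with height within 2δ of v, but only odd indices yield zeros. Moving
  -- from an even index to the next costs one more δ, hence 3δ.
  odd-height-near : ∃[ i ] let d = height (T (ρ m) (suc (double i))) -ᴿ v in
    d *ᴿ d ≤ᴿ (# 3 *ᴿ ℚ→ℝ δ) *ᴿ (# 3 *ᴿ ℚ→ℝ δ)
  odd-height-near = choose (discrete-ivt V (pow₂ m) δ>0 start end down)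
    where
    Near : ℕ → Set
    Near j = (V j -ᴿ v) *ᴿ (V j -ᴿ v) ≤ᴿ (# 3 *ᴿ ℚ→ℝ δ) *ᴿ (# 3 *ᴿ ℚ→ℝ δ)
    stay : ∀ x → x ≤ᴿ x +ᴿ ℚ→ℝ δ
    stay x = ≤-by 0≤δ (solve 2 (λ x d → d := (x :+ d) :- x) ≈-refl x (ℚ→ℝ δ))
    choose : ∃[ j ] (v ≤ᴿ V j × V j ≤ᴿ v +ᴿ ℚ→ℝ δ +ᴿ ℚ→ℝ δ) → ∃[ i ] Near (suc (double i))
    choose (j , v≤ , ≤v) = by-parity (parity j)
      where
      by-parity : (∃[ i ] j ≡ double i) ⊎ (∃[ i ] j ≡ suc (double i)) → ∃[ i ] Near (suc (double i))
      by-parity (inj₁ (i , e)) = i , ≡.subst (Near ∘ suc) e (near v≤ ≤v (down j) (up j))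
      by-parity (inj₂ (i , e)) = i , ≡.subst Near e (near v≤ ≤v (stay (V j)) (stay (V j)))

zeroAt-zero : ∀ m {y} → y *ᴿ y ≤ᴿ # 4 → IterZero m y → ∃[ n ] (1 ≤ n × F n (zeroAt y) ≈ᶜ 0ᶜ)
zeroAt-zero m {y} y²≤4 h =
  let k , e = predecessor m
  in suc k , s≤s z≤n , ≈ᶜ-trans (F≈U (slope-square y²≤4) k) (≈ᶜ-trans
       (*ᶜ-cong ≈ᶜ-refl (ι-cong (≡.subst (λ n → U y n ≈ᴿ 0ᴿ) e (IterZero⇒U≈0 m h))))
       (CommutativeRing.zeroʳ ℂ-commutativeRing _))
  where
  predecessor : ∀ m → ∃[ k ] pow₂ m ≡ suc k
  predecessor zero    = 1 , ≡.refl
  predecessor (suc m) with k , e ← predecessor m = suc (double k) , ≡.cong double e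

LeftHalfCircle⇒ : ∀ {w} → LeftHalfCircle w → (1ᴿ -ᴿ re w) *ᴿ (1ᴿ -ᴿ re w) +ᴿ im w *ᴿ im w ≈ᴿ # 4
LeftHalfCircle⇒ {w} (h , _) = ≈-trans (solve 2 (λ u v → (con 1ℚ :- u) :* (con 1ℚ :- u) :+ v :* v :=
    (u :- con 1ℚ) :* (u :- con 1ℚ) :+ (v :- con 0ℚ) :* (v :- con 0ℚ)) ≈-refl (re w) (im w)) $
  ≈-trans (≈-sym (√ᴿ-square _ (normSq-nonNeg (w -ᶜ 1ᶜ)))) $
  ≈-trans (*-cong h h) (solve 0 (con 2ℚ :* con 2ℚ := con 4ℚ) ≈-refl)
  where open ℝ-Solver

-- Take 3δ = e = min (1, η²/5): then e² ≤ e, so 4e + e² ≤ 5e ≤ η².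
small-radius : ∀ {η} → 0ℚ ℚ.< η → ∃[ δ ] (0ℚ ℚ.< δ ×
  # 4 *ᴿ (# 3 *ᴿ ℚ→ℝ δ) +ᴿ (# 3 *ᴿ ℚ→ℝ δ) *ᴿ (# 3 *ᴿ ℚ→ℝ δ) ≤ᴿ ℚ→ℝ η *ᴿ ℚ→ℝ η)
small-radius {η} η>0 = ⅓ ℚ.* e , *-pos (ℚ.positive⁻¹ ⅓) e>0 ,
  ≤-trans (≈⇒≤ (+-cong (*-cong {x = # 4} ≈-refl triple) (*-cong triple triple)))
  (≤-trans (≤-by (0≤*0≤ (ℚ→ℝ-mono-≤ (ℚ.<⇒≤ e>0)) (x≤y⇒0≤y-x (ℚ→ℝ-mono-≤ (ℚ.p⊓q≤p 1ℚ (⅕ ℚ.* (η ℚ.* η))))))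
    (solve 1 (λ e → e :* (con 1ℚ :- e) := con (+ 5 ℚ./ 1) :* e :- (con 4ℚ :* e :+ e :* e)) ≈-refl (ℚ→ℝ e)))
  (≤-trans (*-monoʳ-≤ (# 5) (0≤ℚ→ℝ _) (pointwise-≤ {y = ℚ→ℝ ⅕ *ᴿ (ℚ→ℝ η *ᴿ ℚ→ℝ η)}
      λ _ → ℚ.p⊓q≤q 1ℚ (⅕ ℚ.* (η ℚ.* η))))
    (≈⇒≤ (solve 1 (λ η → con (+ 5 ℚ./ 1) :* (con ⅕ :* (η :* η)) := η :* η) ≈-refl (ℚ→ℝ η)))))
  where
  open ℝ-Solver
  ⅓ ⅕ e : ℚ
  ⅓ = + 1 ℚ./ 3
  ⅕ = + 1 ℚ./ 5
  e = 1ℚ ℚ.⊓ (⅕ ℚ.* (η ℚ.* η))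
  triple : # 3 *ᴿ ℚ→ℝ (⅓ ℚ.* e) ≈ᴿ ℚ→ℝ e
  triple = pointwise λ _ → ≡.trans (≡.sym (ℚ.*-assoc (+ 3 ℚ./ 1) ⅓ e)) (ℚ.*-identityˡ e)
  e>0 : 0ℚ ℚ.< e
  e>0 with ℚ.⊓-sel 1ℚ (⅕ ℚ.* (η ℚ.* η))
  ... | inj₁ q = ≡.subst (0ℚ ℚ.<_) (≡.sym q) (ℚ.positive⁻¹ 1ℚ)
  ... | inj₂ q = ≡.subst (0ℚ ℚ.<_) (≡.sym q) (*-pos (ℚ.positive⁻¹ ⅕) (*-pos η>0 η>0))

zeroAt-near : ∀ {y w δ η} → y *ᴿ y ≤ᴿ # 4 → LeftHalfCircle w → 0ℚ ℚ.< δ → 0ℚ ℚ.< η →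
  (height y -ᴿ im w) *ᴿ (height y -ᴿ im w) ≤ᴿ (# 3 *ᴿ ℚ→ℝ δ) *ᴿ (# 3 *ᴿ ℚ→ℝ δ) →
  # 4 *ᴿ (# 3 *ᴿ ℚ→ℝ δ) +ᴿ (# 3 *ᴿ ℚ→ℝ δ) *ᴿ (# 3 *ᴿ ℚ→ℝ δ) ≤ᴿ ℚ→ℝ η *ᴿ ℚ→ℝ η →
  ∣ zeroAt y -ᶜ w ∣ᶜ ≤ᴿ ℚ→ℝ η
zeroAt-near {y} {w} y²≤4 hw δ>0 η>0 near small = ²-cancel-≤ (ℚ→ℝ-mono-≤ (ℚ.<⇒≤ η>0)) $
  ≤-trans (≈⇒≤ (√ᴿ-square _ (normSq-nonNeg (zeroAt y -ᶜ w)))) $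
  ≤-trans (distance-by-height (circle (slope-square y²≤4)) (LeftHalfCircle⇒ {w} hw) re≤1 (proj₂ hw)
    (0≤*0≤ (0≤ℚ→ℝ _) (ℚ→ℝ-mono-≤ (ℚ.<⇒≤ δ>0))) near) small
  where
  open ℝ-Solver
  re≤1 : re (zeroAt y) ≤ᴿ 1ᴿ
  re≤1 = ≤-by (0≤*0≤ 0≤½ (x≤y⇒0≤y-x y²≤4))
    (solve 1 (λ a → con ½ :* (con 4ℚ :- a) := con 1ℚ :- (con ½ :* a :- con 1ℚ)) ≈-refl (y *ᴿ y))

rational-below : ∀ {ε} → 0ᴿ <ᴿ ε → ∃[ η ] (0ℚ ℚ.< η × ℚ→ℝ η <ᴿ ε)
rational-below (mk<ᴿ g g>0 (M , h)) = ½ ℚ.* g , half-pos g>0 , mk<ᴿ (½ ℚ.* g) (half-pos g>0) (M , λ n k →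
  ≡.subst (ℚ._< _) (≡.trans (ℚ.+-identityˡ g) (≡.sym (halves g))) (h n k))

F-zeros-dense : ∀ w → LeftHalfCircle w → ∀ ε → 0ᴿ <ᴿ ε →
  ∃[ n ] ∃[ z ] (1 ≤ n × F n z ≈ᶜ 0ᶜ × ∣ z -ᶜ w ∣ᶜ <ᴿ ε)
F-zeros-dense w hw ε ε>0 =
  -- Tolerances are chosen backwards: η below ε bounds the distance, δ makes a height error of 3δ
  -- affordable, and m makes consecutive heights differ by at most δ.
  let η , η>0 , η<ε   = rational-below ε>0
      δ , δ>0 , small = small-radius η>0
      m , steps       = small-steps δ>0
      i , near        = odd-height-near {im w} im²≤4 δ>0 m steps
      y               = T (ρ m) (suc (double i))
      n , 1≤n , Fz≈0  = zeroAt-zero m {y} (T-bounded m (suc (double i))) (T-odd-IterZero m i)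
  in n , zeroAt y , 1≤n , Fz≈0 ,
     ≤-<-trans (zeroAt-near {y} {w} (T-bounded m (suc (double i))) hw δ>0 η>0 near small) η<ε
  where
  im²≤4 : im w *ᴿ im w ≤ᴿ # 4
  im²≤4 = ≤-by (0≤² (1ᴿ -ᴿ re w)) $ ≈-trans (solve 2 (λ a b → a := a :+ b :- b) ≈-refl _ _)
    (+-cong (LeftHalfCircle⇒ {w} hw) ≈-refl)
    where open ℝ-Solver

theorem1p2 : (∀ n → 1 ≤ n → ∀ z → F n z ≈ᶜ 0ᶜ → LeftHalfCircle z) ×
    (∀ w → LeftHalfCircle w → ∀ ε → 0ᴿ <ᴿ ε →
    ∃[ n ] ∃[ z ] (1 ≤ n × F n z ≈ᶜ 0ᶜ × ∣ z -ᶜ w ∣ᶜ <ᴿ ε))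
theorem1p2 = F-zeros⊆LeftHalfCircle , F-zeros-dense
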